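{- Fix a prime $p\ge5$ and assume that \[ [q^{np}]\,C(q)U_p(q)^\ell\equiv0\pmod{p^4}\qquad(n\ge1,\ \ell=1,2,3). \] Then $A_{mp}\equiv A_m\pmod{p^4}$ for all $m\ge1$.
   Context: $A_n=27^n[z^n]\,{}_2F_1(\tfrac13,\tfrac13;1;z)^3$. $\chi_3(n)=\left(\frac{n}{3}\right)$; $C(q)=1+\sum_{n\ge1}c_nq^n$, $c_n=3\sum_{d\mid n}\chi_3(d)d^4$; $t(q)=q\prod_{n\ge1}(1-q^{3n})^{12}(1-q^n)^{ -12}$; $U_p(q):=\log\bigl(t(q)^p/t(q^p)\bigr)$ (formal logarithm). Congruence mod $p^4$ means the difference lies in $p^4\mathbf{Z}_{(p)}$. -}

module Defs where

open import Data.Nat as ℕ using (ℕ; zero; suc; _∸_; _≤_; _!)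
open import Data.Nat.Divisibility using (_∣_; _∣?_)
open import Data.Nat.DivMod using (_%_)
open import Data.Integer as ℤ using (ℤ; +_; ∣_∣)
open import Data.Rational as ℚ using (ℚ; 0ℚ; 1ℚ; _+_; _*_; -_; _-_; _/_; ↥_; ↧ₙ_)
open import Data.Product using (_×_)
open import Relation.Nullary using (¬_; yes; no)

fromℕ : ℕ → ℚ
fromℕ n = + n / 1

_^ℚ_ : ℚ → ℕ → ℚ
x ^ℚ zero    = 1ℚ
x ^ℚ (suc k) = x * (x ^ℚ k)

Σ< : ℕ → (ℕ → ℚ) → ℚ
Σ< zero    f = 0ℚ
Σ< (suc n) f = Σ< n f + f n

Σ≤ : ℕ → (ℕ → ℚ) → ℚ
Σ≤ n f = Σ< (suc n) f

-- x ∈ p^k Z_(p) : (normalised) numerator divisible by p^k,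
-- denominator prime to p.
InPowZp : ℕ → ℕ → ℚ → Set
InPowZp p k x = (p ℕ.^ k) ∣ ∣ ↥ x ∣ × ¬ (p ∣ ↧ₙ x)

_≡_[modPow_^_] : ℚ → ℚ → ℕ → ℕ → Set
x ≡ y [modPow p ^ k ] = InPowZp p k (x - y)

Series : Set
Series = ℕ → ℚ

coeff : ℕ → Series → ℚ
coeff n f = f n

one : Series
one zero    = 1ℚ
one (suc _) = 0ℚ

_⊕_ : Series → Series → Series
(f ⊕ g) n = f n + g n

_⊖_ : Series → Series → Series
(f ⊖ g) n = f n - g n

scale : ℚ → Series → Series
scale c f n = c * f n

_⊗_ : Series → Series → Series
(f ⊗ g) n = Σ≤ n (λ i → f i * g (n ∸ i))

pow : Series → ℕ → Series
pow f zero    = one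
pow f (suc k) = f ⊗ pow f k

qPow : ℕ → Series
qPow k n with k ℕ.≟ n
... | yes _ = 1ℚ
... | no  _ = 0ℚ

subst-qPow : ℕ → Series → Series
-- (defined for k ≥ 1; k = 0 is never used)
subst-qPow zero    f n = 0ℚ
subst-qPow (suc k) f n with suc k ∣? n
... | yes _ = f (n ℕ./ suc k)
... | no  _ = 0ℚ

-- multiplicative inverse of a series f with f 0 = 1:
-- 1/f = 1/(1+g) = Σ_{k≥0} (-g)^k with g = f - 1 (coefficient n only
-- involves k ≤ n, since g has zero constant term).
inv : Series → Series
inv f n = Σ≤ n (λ k → pow (scale (- 1ℚ) (f ⊖ one)) k n)

-- formal logarithm of a series f with f 0 = 1:
-- log(1+g) = Σ_{k≥1} (-1)^{k+1} g^k / k.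
logS : Series → Series
logS f n = Σ< n (λ j → ((- 1ℚ) ^ℚ j) * ((+ 1) / suc j) * pow (f ⊖ one) (suc j) n)

-- infinite product ∏_{m≥1} F m, where F m ≡ 1 mod q^m:
-- coefficient n equals that of the finite product ∏_{m=1}^{n} F m.
finProd : (ℕ → Series) → ℕ → Series
finProd F zero    = one
finProd F (suc N) = finProd F N ⊗ F (suc N)

infProd : (ℕ → Series) → Series
infProd F n = finProd F n n

-- f / q^k  (for a series divisible by q^k)
divQPow : ℕ → Series → Series
divQPow k f n = f (n ℕ.+ k)

χ₃ : ℕ → ℚ
χ₃ n with n % 3
... | 1 = 1ℚ
... | 2 = - 1ℚ
... | _ = 0ℚ

divisorSum : ℕ → (ℕ → ℚ) → ℚ
divisorSum n g = Σ< n (λ i → term (suc i))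
  where
  term : ℕ → ℚ
  term d with d ∣? n
  ... | yes _ = g d
  ... | no  _ = 0ℚ

c : ℕ → ℚ
c n = fromℕ 3 * divisorSum n (λ d → χ₃ d * (fromℕ d ^ℚ 4))

C : Series
C zero    = 1ℚ
C (suc n) = c (suc n)

tFactor : ℕ → Series
tFactor m = pow (one ⊖ qPow (3 ℕ.* m)) 12 ⊗ pow (inv (one ⊖ qPow m)) 12

t : Series
t = qPow 1 ⊗ infProd tFactor

-- t(q)^p / t(q^p): both numerator and denominator have the form
-- q^p·(1 + O(q)), so the quotient is the power series
-- (t^p / q^p) · (t(q^p) / q^p)^{-1}.
tRatio : ℕ → Series
tRatio p = divQPow p (pow t p) ⊗ inv (divQPow p (subst-qPow p t))

U : ℕ → Series
U p = logS (tRatio p)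

poch : ℚ → ℕ → ℚ
poch a zero    = 1ℚ
poch a (suc k) = poch a k * (a + fromℕ k)

invFact : ℕ → ℚ
invFact zero    = 1ℚ
invFact (suc k) = invFact k * ((+ 1) / suc k)

-- 2F1(1/3,1/3;1;z) = Σ_k ((1/3)_k)^2 / (k!)^2 z^k
F : Series
F k = poch ((+ 1) / 3) k * poch ((+ 1) / 3) k * (invFact k * invFact k)

A : ℕ → ℚ
A n = (fromℕ 27 ^ℚ n) * coeff n (pow F 3)

{-# OPTIONS --safe #-}
module Submission where

-- Let D = q d/dq, let b³ = e and a² = P be the cubic theta functions of Borwein, and Z = 3 D log(b) + P. As Lambert
-- series a, P, Z, e and C satisfy a² = P, 3 Da = aZ - e, 3 DZ = Z² - ae, De = Ze - C and C = Pe; each of these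
-- is a convolution identity that follows from u_m u_k = u_{m+k} (1 + u_m + u_k) for u_m = q^m/(1 - q^m).
-- Moreover Dt = Pt, whence a³ - e = 27te, and these equations turn the hypergeometric equation of
-- ₂F₁(1/3,1/3;1;-27t) into D log ₂F₁ = D log b. Thus C = P Σ (-1)ⁿ Aₙ tⁿ, and Lagrange inversion gives
-- (-1)ⁿ Aₙ = [qⁿ] C (q/t)ⁿ.
--
-- Comparing logarithmic derivatives, (q/t)^{mp} = exp(-m U) · ((q/t)^m)(q^p). Here U has coefficients in p ℤ₍ₚ₎, so
-- U^ℓ/ℓ! vanishes modulo p⁴ for ℓ ≥ 4, while ℓ = 1, 2, 3 are covered by the hypothesis. Only
-- [q^{kp}] C ≡ [q^k] C (mod p⁴) remains, and it holds because a divisor of kp not dividing k is divisible by p.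

open import Defs
open import Data.Nat as ℕ using (ℕ; zero; suc; _∸_; _≤_; _<_; z≤n; s≤s; _!)
import Data.Nat.Properties as ℕP
import Data.Nat.Solver
open import Data.Nat.Divisibility
open import Data.Nat.DivMod using (_%_; [m+n]%n≡m%n; m≡m%n+[m/n]*n; m%n<n; m*n/n≡m)
open import Data.Nat.Primality using (Prime; euclidsLemma; prime⇒irreducible; prime⇒nonTrivial)
import Data.Nat.Coprimality as Coprimality
open import Data.Integer as ℤ using (ℤ; +_; ∣_∣)
import Data.Integer.Properties as ℤP
import Data.Integer.Divisibility.Signed as Signed
open import Data.Rational as ℚ using (ℚ; mkℚ; 0ℚ; 1ℚ; _+_; -_; _-_; _/_; ↥_; ↧ₙ_)
import Data.Rational.Properties as ℚP
import Data.Rational.Unnormalised as ℚᵘ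
import Data.Rational.Unnormalised.Properties as ℚᵘP
open import Data.Rational.Solver using (module +-*-Solver)
open import Data.Fin using (zero; suc)
open import Data.List using (List; []; _∷_)
open import Data.Maybe using (Maybe; just; nothing)
open import Data.Product using (_×_; _,_; ∃-syntax)
open import Data.Sum using (_⊎_; inj₁; inj₂; [_,_]′)
open import Data.Vec using (Vec; []; _∷_)
open import Level using (0ℓ)
open import Relation.Nullary using (¬_; Dec; yes; no; contradiction)
open import Relation.Binary.PropositionalEquality
open import Algebra.Bundles using (CommutativeRing)
import Algebra.Solver.Ring as RingSolver
import Algebra.Solver.Ring.AlmostCommutativeRing as ACR
open ≡-Reasoning

-- No theory of modular forms is available here, so an identity between products of Lambert series
-- cannot be settled by comparing finitely many coefficients. Two devices replace it. The relation
-- for u_m u_k is summed against an auxiliary kernel g; if g is a combination of monomials in m and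
-- N = m + k times characters modulo 3, the conditions for a double sum to collapse to a single
-- Lambert series plus a derivative are finitely many polynomial identities, which normalisation
-- decides. Identities that involve infinite products or compositions are reduced to an equation D f
-- = g f with g(0) = 0, whose formal solution is fixed by f(0).
--
-- The bound p ≥ 5 enters twice: v_p(ℓ!) < ℓ/4 gives ℓ - v_p(ℓ!) ≥ 4 for all ℓ ≥ 4 (with equality at
-- p = ℓ = 5), and p odd gives (-1)^(mp) = (-1)^m. The factor ((q/t)^m)(q^p) passes through the
-- extraction of the coefficients at multiples of p, which is why the hypothesis speaks only of the
-- coefficients of C U^ℓ at q^(np).

module _ where

  open import Data.Rational using (_*_)

  module RS = +-*-Solver

  -- Integers inside the rationals

  fromℤ : ℤ → ℚ
  fromℤ i = i / 1

  fromℤ-homo-+ : ∀ i j → fromℤ (i ℤ.+ j) ≡ fromℤ i + fromℤ j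
  fromℤ-homo-+ i j = ℚP.toℚᵘ-injective (ℚᵘP.≃-trans (ℚP.toℚᵘ-fromℚᵘ _) (ℚᵘP.≃-trans step (ℚᵘP.≃-sym
    (ℚᵘP.≃-trans (ℚP.toℚᵘ-homo-+ (fromℤ i) (fromℤ j))
      (ℚᵘP.+-cong (ℚP.toℚᵘ-fromℚᵘ (ℚᵘ.mkℚᵘ i 0)) (ℚP.toℚᵘ-fromℚᵘ (ℚᵘ.mkℚᵘ j 0)))))))
    where
    step : ℚᵘ.mkℚᵘ (i ℤ.+ j) 0 ℚᵘ.≃ ℚᵘ.mkℚᵘ i 0 ℚᵘ.+ ℚᵘ.mkℚᵘ j 0
    step = ℚᵘ.*≡* (cong (ℤ._* + 1) (cong₂ ℤ._+_ (sym (ℤP.*-identityʳ i)) (sym (ℤP.*-identityʳ j))))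

  fromℤ-homo-* : ∀ i j → fromℤ (i ℤ.* j) ≡ fromℤ i * fromℤ j
  fromℤ-homo-* i j = ℚP.toℚᵘ-injective (ℚᵘP.≃-trans (ℚP.toℚᵘ-fromℚᵘ _) (ℚᵘP.≃-trans step (ℚᵘP.≃-sym
    (ℚᵘP.≃-trans (ℚP.toℚᵘ-homo-* (fromℤ i) (fromℤ j))
      (ℚᵘP.*-cong (ℚP.toℚᵘ-fromℚᵘ (ℚᵘ.mkℚᵘ i 0)) (ℚP.toℚᵘ-fromℚᵘ (ℚᵘ.mkℚᵘ j 0)))))))
    where
    step : ℚᵘ.mkℚᵘ (i ℤ.* j) 0 ℚᵘ.≃ ℚᵘ.mkℚᵘ i 0 ℚᵘ.* ℚᵘ.mkℚᵘ j 0
    step = ℚᵘ.*≡* refl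

  fromℕ-homo-+ : ∀ m n → fromℕ (m ℕ.+ n) ≡ fromℕ m + fromℕ n
  fromℕ-homo-+ m n = fromℤ-homo-+ (+ m) (+ n)

  fromℕ-homo-* : ∀ m n → fromℕ (m ℕ.* n) ≡ fromℕ m * fromℕ n
  fromℕ-homo-* m n = trans (cong fromℤ (ℤP.pos-* m n)) (fromℤ-homo-* (+ m) (+ n))

  fromℕ-suc : ∀ n → fromℕ (suc n) ≡ fromℕ n + 1ℚ
  fromℕ-suc n = trans (cong fromℕ (ℕP.+-comm 1 n)) (fromℕ-homo-+ n 1)

  suc*1/suc : ∀ k → fromℕ (suc k) * (+ 1 / suc k) ≡ 1ℚ
  suc*1/suc k = ℚP.toℚᵘ-injective (ℚᵘP.≃-trans (ℚP.toℚᵘ-homo-* (fromℕ (suc k)) (+ 1 / suc k))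
    (ℚᵘP.≃-trans (ℚᵘP.*-cong (ℚP.toℚᵘ-fromℚᵘ (ℚᵘ.mkℚᵘ (+ suc k) 0)) (ℚP.toℚᵘ-fromℚᵘ (ℚᵘ.mkℚᵘ (+ 1) k)))
      (ℚᵘ.*≡* (trans (ℤP.*-identityʳ _) (trans (ℤP.*-identityʳ _) (cong (λ z → + suc z) (sym (trans (ℕP.+-identityʳ _) (ℕP.+-identityʳ k)))))))))

  fromℕ-suc-cancel : ∀ k x → fromℕ (suc k) * x ≡ 0ℚ → x ≡ 0ℚ
  fromℕ-suc-cancel k x eq = begin
    x                                             ≡⟨ RS.solve 1 (λ x → x RS.:= RS.con 1ℚ RS.:* x) refl x ⟩
    1ℚ * x                                        ≡⟨ cong (_* x) (sym (suc*1/suc k)) ⟩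
    (fromℕ (suc k) * (+ 1 / suc k)) * x           ≡⟨ RS.solve 3 (λ a b x → (a RS.:* b) RS.:* x RS.:= b RS.:* (a RS.:* x)) refl (fromℕ (suc k)) (+ 1 / suc k) x ⟩
    (+ 1 / suc k) * (fromℕ (suc k) * x)           ≡⟨ cong ((+ 1 / suc k) *_) eq ⟩
    (+ 1 / suc k) * 0ℚ                            ≡⟨ ℚP.*-zeroʳ (+ 1 / suc k) ⟩
    0ℚ ∎

  sub-zero : ∀ {x y} → x - y ≡ 0ℚ → x ≡ y
  sub-zero {x} {y} eq = begin
    x            ≡⟨ RS.solve 2 (λ x y → x RS.:= (x RS.:- y) RS.:+ y) refl x y ⟩
    (x - y) + y  ≡⟨ cong (_+ y) eq ⟩
    0ℚ + y       ≡⟨ ℚP.+-identityˡ y ⟩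
    y ∎

  -- Finite sums

  Σ<-cong : ∀ n {f g : ℕ → ℚ} → (∀ i → i < n → f i ≡ g i) → Σ< n f ≡ Σ< n g
  Σ<-cong zero    eq = refl
  Σ<-cong (suc n) eq = cong₂ _+_ (Σ<-cong n (λ i i<n → eq i (ℕP.m<n⇒m<1+n i<n))) (eq n ℕP.≤-refl)

  Σ<-zero : ∀ n {f : ℕ → ℚ} → (∀ i → i < n → f i ≡ 0ℚ) → Σ< n f ≡ 0ℚ
  Σ<-zero zero    eq = refl
  Σ<-zero (suc n) eq = cong₂ _+_ (Σ<-zero n (λ i i<n → eq i (ℕP.m<n⇒m<1+n i<n))) (eq n ℕP.≤-refl)

  Σ<-+ : ∀ n (f g : ℕ → ℚ) → Σ< n (λ i → f i + g i) ≡ Σ< n f + Σ< n g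
  Σ<-+ zero    f g = refl
  Σ<-+ (suc n) f g = trans (cong (_+ (f n + g n)) (Σ<-+ n f g))
    (RS.solve 4 (λ a b c d → (a RS.:+ b) RS.:+ (c RS.:+ d) RS.:= (a RS.:+ c) RS.:+ (b RS.:+ d)) refl (Σ< n f) (Σ< n g) (f n) (g n))

  Σ<-*ˡ : ∀ n c (f : ℕ → ℚ) → Σ< n (λ i → c * f i) ≡ c * Σ< n f
  Σ<-*ˡ zero    c f = sym (ℚP.*-zeroʳ c)
  Σ<-*ˡ (suc n) c f = trans (cong (_+ c * f n) (Σ<-*ˡ n c f)) (sym (ℚP.*-distribˡ-+ c (Σ< n f) (f n)))

  Σ<-front : ∀ n (f : ℕ → ℚ) → Σ< (suc n) f ≡ f 0 + Σ< n (λ i → f (suc i))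
  Σ<-front zero    f = ℚP.+-comm 0ℚ (f 0)
  Σ<-front (suc n) f = trans (cong (_+ f (suc n)) (Σ<-front n f)) (ℚP.+-assoc (f 0) _ _)

  Σ<-swap : ∀ m n (h : ℕ → ℕ → ℚ) → Σ< m (λ i → Σ< n (h i)) ≡ Σ< n (λ j → Σ< m (λ i → h i j))
  Σ<-swap zero    n h = sym (Σ<-zero n (λ _ _ → refl))
  Σ<-swap (suc m) n h = trans (cong (_+ Σ< n (h m)) (Σ<-swap m n h)) (sym (Σ<-+ n _ (h m)))

  Σ<-extend : ∀ N k (f : ℕ → ℚ) → (∀ j → N ≤ j → f j ≡ 0ℚ) → Σ< (k ℕ.+ N) f ≡ Σ< N f
  Σ<-extend N zero    f z = refl
  Σ<-extend N (suc k) f z = trans (cong₂ _+_ (Σ<-extend N k f z) (z (k ℕ.+ N) (ℕP.m≤n+m N k))) (ℚP.+-identityʳ _)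

  Σ<-truncate : ∀ {N n} (f : ℕ → ℚ) → N ≤ n → (∀ j → N ≤ j → f j ≡ 0ℚ) → Σ< n f ≡ Σ< N f
  Σ<-truncate {N} {n} f N≤n z = trans (cong (λ k → Σ< k f) (sym (ℕP.m∸n+n≡m N≤n))) (Σ<-extend N (n ∸ N) f z)

  Σ<-split : ∀ n (h : ℕ → ℕ → ℚ) →
    Σ< n (λ i → Σ< n (h i)) ≡ Σ< n (λ i → h i i) + Σ< n (λ i → Σ< i (λ j → h i j + h j i))
  Σ<-split zero    h = refl
  Σ<-split (suc n) h = begin
    Σ< n (λ i → Σ< n (h i) + h i n) + (Σ< n (h n) + h n n)
      ≡⟨ cong (_+ (Σ< n (h n) + h n n)) (trans (Σ<-+ n _ _) (cong (_+ Σ< n (λ i → h i n)) (Σ<-split n h))) ⟩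
    ((Σ< n (λ i → h i i) + Σ< n (λ i → Σ< i (λ j → h i j + h j i))) + Σ< n (λ i → h i n)) + (Σ< n (h n) + h n n)
      ≡⟨ RS.solve 5 (λ a b c d e → ((a RS.:+ b) RS.:+ c) RS.:+ (d RS.:+ e) RS.:= (a RS.:+ e) RS.:+ (b RS.:+ (d RS.:+ c))) refl (Σ< n (λ i → h i i)) (Σ< n (λ i → Σ< i (λ j → h i j + h j i))) (Σ< n (λ i → h i n)) (Σ< n (h n)) (h n n) ⟩
    (Σ< n (λ i → h i i) + h n n) + (Σ< n (λ i → Σ< i (λ j → h i j + h j i)) + (Σ< n (h n) + Σ< n (λ i → h i n)))
      ≡⟨ cong (λ z → (Σ< n (λ i → h i i) + h n n) + (Σ< n (λ i → Σ< i (λ j → h i j + h j i)) + z)) (sym (Σ<-+ n (h n) (λ i → h i n))) ⟩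
    _ ∎

  -- The substitution k = i + 1 + j followed by an exchange of the two sums. It collects the pairs
  -- (m, k) of a double Lambert sum by the value of m + k.
  Σ<-triangle : ∀ n (f : ℕ → ℕ → ℚ) →
    Σ< n (λ i → Σ< (n ∸ suc i) (λ j → f i (i ℕ.+ suc j))) ≡ Σ< n (λ k → Σ< k (λ i → f i k))
  Σ<-triangle zero    f = refl
  Σ<-triangle (suc n) f = begin
    Σ< n (λ i → Σ< (n ∸ i) (λ j → f i (i ℕ.+ suc j))) + Σ< (n ∸ n) (λ j → f n (n ℕ.+ suc j))
      ≡⟨ cong₂ _+_ (Σ<-cong n row) (cong (λ k → Σ< k (λ j → f n (n ℕ.+ suc j))) (ℕP.n∸n≡0 n)) ⟩
    Σ< n (λ i → Σ< (n ∸ suc i) (λ j → f i (i ℕ.+ suc j)) + f i n) + 0ℚ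
      ≡⟨ ℚP.+-identityʳ _ ⟩
    Σ< n (λ i → Σ< (n ∸ suc i) (λ j → f i (i ℕ.+ suc j)) + f i n)
      ≡⟨ Σ<-+ n _ _ ⟩
    Σ< n (λ i → Σ< (n ∸ suc i) (λ j → f i (i ℕ.+ suc j))) + Σ< n (λ i → f i n)
      ≡⟨ cong (_+ Σ< n (λ i → f i n)) (Σ<-triangle n f) ⟩
    _ ∎
    where
    row : ∀ i → i < n → Σ< (n ∸ i) (λ j → f i (i ℕ.+ suc j)) ≡ Σ< (n ∸ suc i) (λ j → f i (i ℕ.+ suc j)) + f i n
    row i i<n = trans (cong (λ k → Σ< k (λ j → f i (i ℕ.+ suc j))) (ℕP.+-∸-assoc 1 i<n))
      (cong (λ k → Σ< (n ∸ suc i) (λ j → f i (i ℕ.+ suc j)) + f i k)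
        (trans (ℕP.+-suc i (n ∸ suc i)) (ℕP.m+[n∸m]≡n i<n)))

  -- The ring of power series

  infix 4 _≈_
  -- A record rather than a bare pointwise equality, so that the two series can be inferred from a
  -- proof.
  record _≈_ (f g : Series) : Set where
    constructor mk≈
    field at : ∀ n → f n ≡ g n
  open _≈_ public

  ≈-refl : ∀ {f} → f ≈ f
  ≈-refl .at n = refl

  ≈-sym : ∀ {f g} → f ≈ g → g ≈ f
  ≈-sym p .at n = sym (p .at n)

  ≈-trans : ∀ {f g h} → f ≈ g → g ≈ h → f ≈ h
  ≈-trans p q .at n = trans (p .at n) (q .at n)

  const : ℚ → Series
  const c zero    = c
  const c (suc _) = 0ℚ

  tail : Series → Series
  tail f n = f (suc n)

  shift : Series → Series
  shift f zero    = 0ℚ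
  shift f (suc n) = f n

  infixl 7 _·_
  infixl 6 _∔_

  -- Opaque copies of the operations, so that unification treats them as injective.
  opaque
    _·_ : Series → Series → Series
    f · g = f ⊗ g

    _∔_ : Series → Series → Series
    f ∔ g = f ⊕ g

    ⊝_ : Series → Series
    (⊝ f) n = - f n

    D : Series → Series
    D f n = fromℕ n * f n

  opaque
    unfolding _·_ _∔_ ⊝_ D

    ·-def : ∀ f g n → (f · g) n ≡ (f ⊗ g) n
    ·-def f g n = refl

    ∔-at : ∀ f g n → (f ∔ g) n ≡ f n + g n
    ∔-at f g n = refl

    ⊝-at : ∀ f n → (⊝ f) n ≡ - f n
    ⊝-at f n = refl

    D-at : ∀ f n → D f n ≡ fromℕ n * f n
    D-at f n = refl

    -- Splitting off the constant term of the left factor makes commutativity and associativity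
    -- inductions on the degree, without any reindexing of double sums.
    ·-suc : ∀ f g n → (f · g) (suc n) ≡ f 0 * g (suc n) + (tail f · g) n
    ·-suc f g n = Σ<-front (suc n) _

    ·-suc′ : ∀ f g n → (f · g) (suc n) ≡ (f · tail g) n + f (suc n) * g 0
    ·-suc′ f g n = cong₂ _+_ (Σ<-cong (suc n) λ i i≤n → cong (λ k → f i * g k) (ℕP.+-∸-assoc 1 (ℕP.≤-pred i≤n)))
      (cong (λ k → f (suc n) * g k) (ℕP.n∸n≡0 n))

    ·-cong≤ : ∀ {f f′ g g′} n → (∀ i → i ≤ n → f i ≡ f′ i) → (∀ i → i ≤ n → g i ≡ g′ i) → (f · g) n ≡ (f′ · g′) n
    ·-cong≤ n p q = Σ<-cong (suc n) λ i i≤n → cong₂ _*_ (p i (ℕP.≤-pred i≤n)) (q (n ∸ i) (ℕP.m∸n≤m n i))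

    ·-cong : ∀ {f f′ g g′} → f ≈ f′ → g ≈ g′ → f · g ≈ f′ · g′
    ·-cong p q .at n = ·-cong≤ n (λ i _ → p .at i) (λ i _ → q .at i)

    ·-zeroˡ-at : ∀ f g n → (∀ i → i ≤ n → f i ≡ 0ℚ) → (f · g) n ≡ 0ℚ
    ·-zeroˡ-at f g n z = Σ<-zero (suc n) λ i i≤n → trans (cong (_* g (n ∸ i)) (z i (ℕP.≤-pred i≤n))) (ℚP.*-zeroˡ (g (n ∸ i)))

    ·-distribʳ-at : ∀ f g h n → ((f ∔ g) · h) n ≡ (f · h) n + (g · h) n
    ·-distribʳ-at f g h n = trans (Σ<-cong (suc n) λ i _ → ℚP.*-distribʳ-+ (h (n ∸ i)) (f i) (g i)) (Σ<-+ (suc n) _ _)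

    ·-scaleˡ-at : ∀ c f h n → (scale c f · h) n ≡ c * (f · h) n
    ·-scaleˡ-at c f h n = trans (Σ<-cong (suc n) λ i _ → ℚP.*-assoc c (f i) (h (n ∸ i))) (Σ<-*ˡ (suc n) c _)

    ·-comm-at : ∀ n f g → (f · g) n ≡ (g · f) n
    ·-comm-at zero    f g = cong (λ z → 0ℚ + z) (ℚP.*-comm (f 0) (g 0))
    ·-comm-at (suc n) f g = begin
      (f · g) (suc n)                       ≡⟨ ·-suc f g n ⟩
      f 0 * g (suc n) + (tail f · g) n      ≡⟨ cong₂ _+_ (ℚP.*-comm (f 0) (g (suc n))) (·-comm-at n (tail f) g) ⟩
      g (suc n) * f 0 + (g · tail f) n      ≡⟨ ℚP.+-comm _ ((g · tail f) n) ⟩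
      (g · tail f) n + g (suc n) * f 0      ≡⟨ sym (·-suc′ g f n) ⟩
      (g · f) (suc n) ∎

    ·-at-0 : ∀ f g → (f · g) 0 ≡ f 0 * g 0
    ·-at-0 f g = ℚP.+-identityˡ (f 0 * g 0)

    ·-assoc-at : ∀ n f g h → ((f · g) · h) n ≡ (f · (g · h)) n
    ·-assoc-at zero    f g h = begin
      ((f · g) · h) 0       ≡⟨ trans (·-at-0 (f · g) h) (cong (_* h 0) (·-at-0 f g)) ⟩
      (f 0 * g 0) * h 0     ≡⟨ ℚP.*-assoc (f 0) (g 0) (h 0) ⟩
      f 0 * (g 0 * h 0)     ≡⟨ sym (trans (·-at-0 f (g · h)) (cong (f 0 *_) (·-at-0 g h))) ⟩
      (f · (g · h)) 0 ∎
    ·-assoc-at (suc n) f g h = begin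
      ((f · g) · h) (suc n)
        ≡⟨ ·-suc (f · g) h n ⟩
      (f · g) 0 * h (suc n) + (tail (f · g) · h) n
        ≡⟨ cong₂ _+_ (cong (_* h (suc n)) (·-at-0 f g)) (·-cong≤ {g = h} n (λ i _ → ·-suc f g i) (λ _ _ → refl)) ⟩
      (f 0 * g 0) * h (suc n) + ((scale (f 0) (tail g) ∔ (tail f · g)) · h) n
        ≡⟨ cong (λ z → (f 0 * g 0) * h (suc n) + z) (trans (·-distribʳ-at (scale (f 0) (tail g)) (tail f · g) h n)
             (cong₂ _+_ (·-scaleˡ-at (f 0) (tail g) h n) (·-assoc-at n (tail f) g h))) ⟩
      (f 0 * g 0) * h (suc n) + (f 0 * (tail g · h) n + (tail f · (g · h)) n)
        ≡⟨ RS.solve 5 (λ a b c d e → (a RS.:* b) RS.:* c RS.:+ (a RS.:* d RS.:+ e) RS.:= a RS.:* (b RS.:* c RS.:+ d) RS.:+ e) refl (f 0) (g 0) (h (suc n)) ((tail g · h) n) ((tail f · (g · h)) n) ⟩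
      f 0 * (g 0 * h (suc n) + (tail g · h) n) + (tail f · (g · h)) n
        ≡⟨ cong (λ z → f 0 * z + (tail f · (g · h)) n) (sym (·-suc g h n)) ⟩
      f 0 * (g · h) (suc n) + (tail f · (g · h)) n
        ≡⟨ sym (·-suc f (g · h) n) ⟩
      (f · (g · h)) (suc n) ∎

    const-·-at : ∀ c f n → (const c · f) n ≡ c * f n
    const-·-at c f zero    = ·-at-0 (const c) f
    const-·-at c f (suc n) = trans (·-suc (const c) f n)
      (trans (cong (λ z → c * f (suc n) + z) (·-zeroˡ-at (tail (const c)) f n (λ _ _ → refl))) (ℚP.+-identityʳ _))

    ·-comm : ∀ f g → f · g ≈ g · f
    ·-comm f g .at n = ·-comm-at n f g

    ·-assoc : ∀ f g h → (f · g) · h ≈ f · (g · h)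
    ·-assoc f g h .at n = ·-assoc-at n f g h

    ·-distribʳ : ∀ h f g → (f ∔ g) · h ≈ (f · h) ∔ (g · h)
    ·-distribʳ h f g .at n = ·-distribʳ-at f g h n

    ·-distribˡ : ∀ h f g → h · (f ∔ g) ≈ (h · f) ∔ (h · g)
    ·-distribˡ h f g .at n = trans (·-comm-at n h (f ∔ g)) (trans (·-distribʳ-at f g h n) (cong₂ _+_ (·-comm-at n f h) (·-comm-at n g h)))

    ∔-cong : ∀ {f f′ g g′} → f ≈ f′ → g ≈ g′ → f ∔ g ≈ f′ ∔ g′
    ∔-cong p q .at n = cong₂ _+_ (p .at n) (q .at n)

    ⊝-cong : ∀ {f g} → f ≈ g → ⊝ f ≈ ⊝ g
    ⊝-cong p .at n = cong -_ (p .at n)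

    one-· : ∀ f → const 1ℚ · f ≈ f
    one-· f .at n = trans (const-·-at 1ℚ f n) (ℚP.*-identityˡ (f n))

    ∔-assoc : ∀ f g h → (f ∔ g) ∔ h ≈ f ∔ (g ∔ h)
    ∔-assoc f g h .at n = ℚP.+-assoc (f n) (g n) (h n)

    ∔-comm : ∀ f g → f ∔ g ≈ g ∔ f
    ∔-comm f g .at n = ℚP.+-comm (f n) (g n)

    ∔-identityˡ : ∀ f → const 0ℚ ∔ f ≈ f
    ∔-identityˡ f .at zero    = ℚP.+-identityˡ (f 0)
    ∔-identityˡ f .at (suc n) = ℚP.+-identityˡ (f (suc n))

    ⊝-inverseˡ : ∀ f → (⊝ f) ∔ f ≈ const 0ℚ
    ⊝-inverseˡ f .at zero    = ℚP.+-inverseˡ (f 0)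
    ⊝-inverseˡ f .at (suc n) = ℚP.+-inverseˡ (f (suc n))

    const-+ : ∀ x y → const (x + y) ≈ const x ∔ const y
    const-+ x y .at zero    = refl
    const-+ x y .at (suc n) = refl

    const-* : ∀ x y → const (x * y) ≈ const x · const y
    const-* x y .at zero    = sym (·-at-0 (const x) (const y))
    const-* x y .at (suc n) = sym (trans (const-·-at x (const y) (suc n)) (ℚP.*-zeroʳ x))

    const-neg : ∀ x → const (- x) ≈ ⊝ const x
    const-neg x .at zero    = refl
    const-neg x .at (suc n) = refl

    D-cong : ∀ {f g} → f ≈ g → D f ≈ D g
    D-cong p .at n = cong (fromℕ n *_) (p .at n)

    D-at-0 : ∀ f → D f 0 ≡ 0ℚ
    D-at-0 f = ℚP.*-zeroˡ (f 0)

    D-∔ : ∀ f g → D (f ∔ g) ≈ D f ∔ D g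
    D-∔ f g .at n = ℚP.*-distribˡ-+ (fromℕ n) (f n) (g n)

    D-⊝ : ∀ f → D (⊝ f) ≈ ⊝ D f
    D-⊝ f .at n = sym (ℚP.neg-distribʳ-* (fromℕ n) (f n))

    D-const : ∀ c → D (const c) ≈ const 0ℚ
    D-const c .at zero    = ℚP.*-zeroˡ c
    D-const c .at (suc n) = ℚP.*-zeroʳ (fromℕ (suc n))

    D-· : ∀ f g → D (f · g) ≈ D f · g ∔ f · D g
    D-· f g .at n = begin
      fromℕ n * (f ⊗ g) n                        ≡⟨ sym (Σ<-*ˡ (suc n) (fromℕ n) _) ⟩
      Σ≤ n (λ i → fromℕ n * (f i * g (n ∸ i)))    ≡⟨ Σ<-cong (suc n) term ⟩
      Σ≤ n (λ i → D f i * g (n ∸ i) + f i * D g (n ∸ i)) ≡⟨ Σ<-+ (suc n) _ _ ⟩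
      (D f · g ∔ f · D g) n ∎
      where
      term : ∀ i → i < suc n → fromℕ n * (f i * g (n ∸ i)) ≡ D f i * g (n ∸ i) + f i * D g (n ∸ i)
      term i i≤n = trans (cong (_* (f i * g (n ∸ i))) (trans (cong fromℕ (sym (ℕP.m+[n∸m]≡n (ℕP.≤-pred i≤n)))) (fromℕ-homo-+ i (n ∸ i))))
        (RS.solve 4 (λ a b x y → (a RS.:+ b) RS.:* (x RS.:* y) RS.:= (a RS.:* x) RS.:* y RS.:+ x RS.:* (b RS.:* y)) refl (fromℕ i) (fromℕ (n ∸ i)) (f i) (g (n ∸ i)))

  seriesRing : CommutativeRing 0ℓ 0ℓ
  seriesRing = record
    { Carrier = Series ; _≈_ = _≈_ ; _+_ = _∔_ ; _*_ = _·_ ; -_ = ⊝_ ; 0# = const 0ℚ ; 1# = const 1ℚ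
    ; isCommutativeRing = record
      { isRing = record
        { +-isAbelianGroup = record
          { isGroup = record
            { isMonoid = record
              { isSemigroup = record
                { isMagma = record
                  { isEquivalence = record { refl = ≈-refl ; sym = ≈-sym ; trans = ≈-trans }
                  ; ∙-cong = ∔-cong }
                ; assoc = ∔-assoc }
              ; identity = ∔-identityˡ , (λ f → ≈-trans (∔-comm f _) (∔-identityˡ f)) }
            ; inverse = ⊝-inverseˡ , (λ f → ≈-trans (∔-comm f _) (⊝-inverseˡ f))
            ; ⁻¹-cong = ⊝-cong }
          ; comm = ∔-comm }
        ; *-cong = ·-cong
        ; *-assoc = ·-assoc
        ; *-identity = one-· , (λ f → ≈-trans (·-comm f _) (one-· f))
        ; distrib = ·-distribˡ , ·-distribʳ }
      ; *-comm = ·-comm } }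

  seriesACR : ACR.AlmostCommutativeRing 0ℓ 0ℓ
  seriesACR = ACR.fromCommutativeRing seriesRing

  const-morphism : ℚ.+-*-rawRing ACR.-Raw-AlmostCommutative⟶ seriesACR
  const-morphism = record
    { ⟦_⟧ = const ; +-homo = const-+ ; *-homo = const-* ; -‿homo = const-neg ; 0-homo = ≈-refl ; 1-homo = ≈-refl }

  const≟ : ∀ x y → Maybe (const x ≈ const y)
  const≟ x y with x ℚP.≟ y
  ... | yes refl = just ≈-refl
  ... | no _     = nothing

  module SS = RingSolver ℚ.+-*-rawRing seriesACR const-morphism const≟

  -- A factor without constant term raises degrees, so only coefficients of f and g strictly below n
  -- are seen. The inductions on the degree for powers, differential equations and compositions all
  -- rest on this.
  ·-congˡ< : ∀ {s f g} n → s 0 ≡ 0ℚ → (∀ i → i < n → f i ≡ g i) → (s · f) n ≡ (s · g) n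
  ·-congˡ< {s} {f} {g} zero    s0 eq = trans (·-at-0 s f) (trans (cong (_* f 0) s0) (trans (ℚP.*-zeroˡ (f 0)) (sym (trans (·-at-0 s g) (trans (cong (_* g 0) s0) (ℚP.*-zeroˡ (g 0)))))))
  ·-congˡ< {s} {f} {g} (suc n) s0 eq = trans (·-suc s f n) (trans (cong₂ _+_ head (·-cong≤ {f = tail s} n (λ _ _ → refl) (λ i i≤n → eq i (s≤s i≤n)))) (sym (·-suc s g n)))
    where
    head : s 0 * f (suc n) ≡ s 0 * g (suc n)
    head = trans (cong (_* f (suc n)) s0) (trans (ℚP.*-zeroˡ (f (suc n))) (sym (trans (cong (_* g (suc n)) s0) (ℚP.*-zeroˡ (g (suc n))))))

  ·-const0 : ∀ s → s · const 0ℚ ≈ const 0ℚ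
  ·-const0 s = SS.solve 1 (λ s → s SS.:* SS.con 0ℚ SS.:= SS.con 0ℚ) ≈-refl s

  const0-at : ∀ n → const 0ℚ n ≡ 0ℚ
  const0-at zero    = refl
  const0-at (suc n) = refl

  ·-zeroʳ-at : ∀ s f n → s 0 ≡ 0ℚ → (∀ i → i < n → f i ≡ 0ℚ) → (s · f) n ≡ 0ℚ
  ·-zeroʳ-at s f n s0 z = trans (·-congˡ< {s} {f} {const 0ℚ} n s0 (λ i i<n → trans (z i i<n) (sym (const0-at i)))) (trans (·-const0 s .at n) (const0-at n))

  -- Powers, the Euler operator D and first order equations

  infixr 8 _↑_
  _↑_ : Series → ℕ → Series
  f ↑ zero  = const 1ℚ
  f ↑ suc k = f · f ↑ k

  one≈const : one ≈ const 1ℚ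
  one≈const .at zero    = refl
  one≈const .at (suc n) = refl

  ⊗≈· : ∀ {f f′ g g′} → f ≈ f′ → g ≈ g′ → f ⊗ g ≈ f′ · g′
  ⊗≈· {f} {f′} {g} {g′} p q .at n = trans (sym (·-def f g n)) (·-cong p q .at n)

  pow≈↑ : ∀ {f g} k → f ≈ g → pow f k ≈ g ↑ k
  pow≈↑ zero    p = one≈const
  pow≈↑ (suc k) p = ⊗≈· p (pow≈↑ k p)

  ⊖≈ : ∀ {f f′ g g′} → f ≈ f′ → g ≈ g′ → f ⊖ g ≈ f′ ∔ (⊝ g′)
  ⊖≈ {f} {f′} {g} {g′} p q .at n = trans (cong₂ _-_ (p .at n) (q .at n)) (sym (trans (∔-at f′ (⊝ g′) n) (cong (λ z → f′ n + z) (⊝-at g′ n))))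

  ↑-cong : ∀ {f g} k → f ≈ g → f ↑ k ≈ g ↑ k
  ↑-cong zero    p = ≈-refl
  ↑-cong (suc k) p = ·-cong p (↑-cong k p)

  ↑-· : ∀ f g k → (f · g) ↑ k ≈ f ↑ k · g ↑ k
  ↑-· f g zero    = ≈-sym (one-· (const 1ℚ))
  ↑-· f g (suc k) = ≈-trans (·-cong ≈-refl (↑-· f g k))
    (SS.solve 4 (λ f g a b → (f SS.:* g) SS.:* (a SS.:* b) SS.:= (f SS.:* a) SS.:* (g SS.:* b)) ≈-refl f g (f ↑ k) (g ↑ k))

  ↑-at-0 : ∀ f k → f 0 ≡ 1ℚ → (f ↑ k) 0 ≡ 1ℚ
  ↑-at-0 f zero    f0 = refl
  ↑-at-0 f (suc k) f0 = trans (·-at-0 f (f ↑ k)) (cong₂ _*_ f0 (↑-at-0 f k f0))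

  ↑-vanish : ∀ s k n → s 0 ≡ 0ℚ → n < k → (s ↑ k) n ≡ 0ℚ
  ↑-vanish s (suc k) n s0 (s≤s n≤k) = ·-zeroʳ-at s (s ↑ k) n s0 (λ i i<n → ↑-vanish s k i s0 (ℕP.≤-trans i<n n≤k))

  D-const-· : ∀ c f → D (const c · f) ≈ const c · D f
  D-const-· c f = ≈-trans (D-· (const c) f) (≈-trans (∔-cong (·-cong (D-const c) ≈-refl) ≈-refl)
    (SS.solve 2 (λ f x → SS.con 0ℚ SS.:* f SS.:+ x SS.:= x) ≈-refl f (const c · D f)))

  D-↑ : ∀ f k → D (f ↑ suc k) ≈ const (fromℕ (suc k)) · (f ↑ k · D f)
  D-↑ f zero    = ≈-trans (D-· f (const 1ℚ)) (≈-trans (∔-cong ≈-refl (·-cong ≈-refl (D-const 1ℚ)))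
    (SS.solve 2 (λ f d → d SS.:* SS.con 1ℚ SS.:+ f SS.:* SS.con 0ℚ SS.:= SS.con 1ℚ SS.:* (SS.con 1ℚ SS.:* d)) ≈-refl f (D f)))
  D-↑ f (suc k) = ≈-trans (D-· f (f ↑ suc k)) (≈-trans (∔-cong ≈-refl (·-cong ≈-refl (D-↑ f k)))
    (≈-trans (SS.solve 4 (λ f d p c → d SS.:* (f SS.:* p) SS.:+ f SS.:* (c SS.:* (p SS.:* d)) SS.:= (c SS.:+ SS.con 1ℚ) SS.:* ((f SS.:* p) SS.:* d)) ≈-refl f (D f) (f ↑ k) (const (fromℕ (suc k))))
      (·-cong (≈-trans (≈-sym (const-+ (fromℕ (suc k)) 1ℚ)) (mk≈ λ n → cong (λ c → const c n) (sym (fromℕ-suc (suc k))))) ≈-refl)))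

  D-↑-log : ∀ {f g} k → D f ≈ f · g → D (f ↑ k) ≈ (const (fromℕ k) · g) · f ↑ k
  D-↑-log {f} {g} zero    eq = ≈-trans (D-const 1ℚ) (SS.solve 1 (λ g → SS.con 0ℚ SS.:= (SS.con 0ℚ SS.:* g) SS.:* SS.con 1ℚ) ≈-refl g)
  D-↑-log {f} {g} (suc k) eq = ≈-trans (D-↑ f k) (≈-trans (·-cong ≈-refl (·-cong ≈-refl eq))
    (SS.solve 4 (λ c p f g → c SS.:* (p SS.:* (f SS.:* g)) SS.:= (c SS.:* g) SS.:* (f SS.:* p)) ≈-refl (const (fromℕ (suc k))) (f ↑ k) f g))

  -- If y vanishes up to degree n, then coefficient n + 1 of a · D y is (n + 1) times that of y,
  -- while g · y has none there because g starts in degree 1. Dividing by n + 1 continues the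
  -- induction.
  ode-zero : ∀ a g y → a 0 ≡ 1ℚ → g 0 ≡ 0ℚ → y 0 ≡ 0ℚ → a · D y ≈ g · y → y ≈ const 0ℚ
  ode-zero a g y a0 g0 y0 eq .at n = trans (below (suc n) n ℕP.≤-refl) (sym (const0-at n))
    where
    below : ∀ N n → n < N → y n ≡ 0ℚ
    below (suc N) zero    _         = y0
    below (suc N) (suc n) (s≤s n<N) = fromℕ-suc-cancel n (y (suc n)) (begin
      fromℕ (suc n) * y (suc n)     ≡⟨ sym (D-at y (suc n)) ⟩
      D y (suc n)                   ≡⟨ RS.solve 1 (λ x → x RS.:= RS.con 1ℚ RS.:* x RS.:+ RS.con 0ℚ) refl (D y (suc n)) ⟩
      1ℚ * D y (suc n) + 0ℚ         ≡⟨ cong₂ (λ u v → u * D y (suc n) + v) (sym a0) (sym (trans (·-comm-at n (tail a) (D y))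
                                         (·-zeroˡ-at (D y) (tail a) n λ i i≤n → trans (D-at y i) (trans (cong (fromℕ i *_) (IH i (s≤s i≤n))) (ℚP.*-zeroʳ (fromℕ i)))))) ⟩
      a 0 * D y (suc n) + (tail a · D y) n ≡⟨ sym (·-suc a (D y) n) ⟩
      (a · D y) (suc n)             ≡⟨ eq .at (suc n) ⟩
      (g · y) (suc n)               ≡⟨ ·-zeroʳ-at g y (suc n) g0 IH ⟩
      0ℚ ∎)
      where
      IH : ∀ i → i < suc n → y i ≡ 0ℚ
      IH i i≤n = below N i (ℕP.≤-trans i≤n n<N)

  difference-zero : ∀ {y z} → y ∔ (⊝ z) ≈ const 0ℚ → y ≈ z
  difference-zero {y} {z} eq = ≈-trans (SS.solve 2 (λ y z → y SS.:= (y SS.:- z) SS.:+ z) ≈-refl y z) (≈-trans (∔-cong eq ≈-refl) (∔-identityˡ z))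

  -- The substitute for manipulating products, cubes and exponentials directly: equal logarithmic
  -- derivatives and equal constant terms suffice.
  ode-unique : ∀ g y z → g 0 ≡ 0ℚ → y 0 ≡ z 0 → D y ≈ g · y → D z ≈ g · z → y ≈ z
  ode-unique g y z g0 y0 dy dz = difference-zero (ode-zero (const 1ℚ) g (y ∔ (⊝ z)) refl g0
    (trans (∔-at y (⊝ z) 0) (trans (cong₂ _+_ y0 (⊝-at z 0)) (ℚP.+-inverseʳ (z 0))))
    (≈-trans (one-· _) (≈-trans (D-∔ y (⊝ z)) (≈-trans (∔-cong dy (≈-trans (D-⊝ z) (⊝-cong dz)))
      (SS.solve 3 (λ g y z → g SS.:* y SS.:- g SS.:* z SS.:= g SS.:* (y SS.:- z)) ≈-refl g y z)))))

  -- Monomials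

  qPow-0 : qPow 0 ≈ const 1ℚ
  qPow-0 .at zero    = refl
  qPow-0 .at (suc n) = refl

  qPow-diag : ∀ k → qPow k k ≡ 1ℚ
  qPow-diag k with k ℕ.≟ k
  ... | yes _ = refl
  ... | no ¬p = contradiction refl ¬p

  qPow-off : ∀ k n → ¬ k ≡ n → qPow k n ≡ 0ℚ
  qPow-off k n k≢n with k ℕ.≟ n
  ... | yes p = contradiction p k≢n
  ... | no _  = refl

  qPow-tail : ∀ k → tail (qPow (suc k)) ≈ qPow k
  qPow-tail k .at n = go (k ℕ.≟ n)
    where
    go : Dec (k ≡ n) → qPow (suc k) (suc n) ≡ qPow k n
    go (yes refl) = trans (qPow-diag (suc k)) (sym (qPow-diag k))
    go (no k≢n)   = trans (qPow-off (suc k) (suc n) (λ eq → k≢n (ℕP.suc-injective eq))) (sym (qPow-off k n k≢n))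

  qPow-·-suc : ∀ k f n → (qPow (suc k) · f) (suc n) ≡ (qPow k · f) n
  qPow-·-suc k f n = trans (·-suc (qPow (suc k)) f n) (trans (cong₂ _+_ (ℚP.*-zeroˡ (f (suc n)))
    (·-cong≤ {g = f} n (λ i _ → qPow-tail k .at i) (λ _ _ → refl))) (ℚP.+-identityˡ _))

  qPow-·-+ : ∀ k f n → (qPow k · f) (k ℕ.+ n) ≡ f n
  qPow-·-+ zero    f n = ≈-trans (·-cong qPow-0 ≈-refl) (one-· f) .at n
  qPow-·-+ (suc k) f n = trans (qPow-·-suc k f (k ℕ.+ n)) (qPow-·-+ k f n)

  qPow-·-< : ∀ k f n → n < k → (qPow k · f) n ≡ 0ℚ
  qPow-·-< k f n n<k = ·-zeroˡ-at (qPow k) f n (λ i i≤n → qPow-off k i (ℕP.>⇒≢ (ℕP.≤-<-trans i≤n n<k)))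

  qPow-unique : ∀ k {f g} → (∀ n → n < k → g n ≡ 0ℚ) → (∀ n → g (k ℕ.+ n) ≡ f n) → g ≈ qPow k · f
  qPow-unique k {f} {g} low high .at n with ℕP.≤-<-connex k n
  ... | inj₁ k≤n = subst (λ m → g m ≡ (qPow k · f) m) (ℕP.m+[n∸m]≡n k≤n) (trans (high (n ∸ k)) (sym (qPow-·-+ k f (n ∸ k))))
  ... | inj₂ n<k = trans (low n n<k) (sym (qPow-·-< k f n n<k))

  qPow-+ : ∀ j k → qPow (j ℕ.+ k) ≈ qPow j · qPow k
  qPow-+ j k = qPow-unique j (λ n n<j → qPow-off (j ℕ.+ k) n (ℕP.>⇒≢ (ℕP.<-≤-trans n<j (ℕP.m≤m+n j k)))) high
    where
    high : ∀ n → qPow (j ℕ.+ k) (j ℕ.+ n) ≡ qPow k n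
    high n = go (k ℕ.≟ n)
      where
      go : Dec (k ≡ n) → qPow (j ℕ.+ k) (j ℕ.+ n) ≡ qPow k n
      go (yes refl) = trans (qPow-diag (j ℕ.+ k)) (sym (qPow-diag k))
      go (no k≢n)   = trans (qPow-off (j ℕ.+ k) (j ℕ.+ n) (λ eq → k≢n (ℕP.+-cancelˡ-≡ j k n eq))) (sym (qPow-off k n k≢n))

  D-qPow : ∀ k → D (qPow k) ≈ const (fromℕ k) · qPow k
  D-qPow k .at n = go (k ℕ.≟ n)
    where
    go : Dec (k ≡ n) → D (qPow k) n ≡ (const (fromℕ k) · qPow k) n
    go (yes refl) = trans (D-at (qPow k) k) (trans (cong (fromℕ k *_) (qPow-diag k)) (sym (trans (const-·-at (fromℕ k) (qPow k) k) (cong (fromℕ k *_) (qPow-diag k)))))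
    go (no k≢n)   = trans (trans (trans (D-at (qPow k) n) (cong (fromℕ n *_) (qPow-off k n k≢n))) (ℚP.*-zeroʳ (fromℕ n)))
      (sym (trans (const-·-at (fromℕ k) (qPow k) n) (trans (cong (fromℕ k *_) (qPow-off k n k≢n)) (ℚP.*-zeroʳ (fromℕ k)))))

  -- Composition Σ cₖ sᵏ for s(0) = 0

  opaque
    comp : Series → Series → Series
    comp s c n = Σ≤ n (λ k → c k * (s ↑ k) n)

    comp-at : ∀ s c n → comp s c n ≡ Σ≤ n (λ k → c k * (s ↑ k) n)
    comp-at s c n = refl

  deriv : Series → Series
  deriv c k = fromℕ (suc k) * c (suc k)

  ·-Σ<ʳ : ∀ N (c : ℕ → ℚ) (h : ℕ → Series) X n →
    (X · (λ i → Σ< N (λ k → c k * h k i))) n ≡ Σ< N (λ k → c k * (X · h k) n)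
  ·-Σ<ʳ zero    c h X n = trans (·-comm-at n X (λ _ → 0ℚ)) (·-zeroˡ-at (λ _ → 0ℚ) X n (λ _ _ → refl))
  ·-Σ<ʳ (suc N) c h X n = begin
    (X · (λ i → Σ< N (λ k → c k * h k i) + c N * h N i)) n
      ≡⟨ ·-cong≤ {X} n (λ _ _ → refl) (λ i _ → sym (trans (∔-at _ (const (c N) · h N) i) (cong (λ z → Σ< N (λ k → c k * h k i) + z) (const-·-at (c N) (h N) i)))) ⟩
    (X · ((λ i → Σ< N (λ k → c k * h k i)) ∔ const (c N) · h N)) n
      ≡⟨ trans (·-distribˡ X _ (const (c N) · h N) .at n) (∔-at _ (X · (const (c N) · h N)) n) ⟩
    (X · (λ i → Σ< N (λ k → c k * h k i))) n + (X · (const (c N) · h N)) n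
      ≡⟨ cong₂ _+_ (·-Σ<ʳ N c h X n) (trans (SS.solve 3 (λ x c h → x SS.:* (c SS.:* h) SS.:= c SS.:* (x SS.:* h)) ≈-refl X (const (c N)) (h N) .at n) (const-·-at (c N) (X · h N) n)) ⟩
    Σ< N (λ k → c k * (X · h k) n) + c N * (X · h N) n ∎

  module Composition (s : Series) (s0 : s 0 ≡ 0ℚ) where

    -- The power s^k has no terms below degree k, so any bound above n will do. A bound common to
    -- all degrees up to n is what lets a product distribute over the composition in `·-comp`.
    comp-truncate : ∀ c {N n} → n < N → comp s c n ≡ Σ< N (λ k → c k * (s ↑ k) n)
    comp-truncate c {N} {n} n<N = trans (comp-at s c n) (sym (Σ<-truncate _ n<N λ k n<k → trans (cong (c k *_) (↑-vanish s k n s0 n<k)) (ℚP.*-zeroʳ (c k))))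

    ·-comp : ∀ X c n → (X · comp s c) n ≡ Σ≤ n (λ k → c k * (X · s ↑ k) n)
    ·-comp X c n = trans (·-cong≤ {f = X} n (λ _ _ → refl) (λ i i≤n → comp-truncate c (s≤s i≤n))) (·-Σ<ʳ (suc n) c (s ↑_) X n)

    comp-cong : ∀ {c d} → c ≈ d → comp s c ≈ comp s d
    comp-cong {c} {d} p .at n = trans (comp-at s c n) (trans (Σ<-cong (suc n) λ k _ → cong (_* (s ↑ k) n) (p .at k)) (sym (comp-at s d n)))

    comp-∔ : ∀ c d → comp s (c ∔ d) ≈ comp s c ∔ comp s d
    comp-∔ c d .at n = begin
      comp s (c ∔ d) n                                              ≡⟨ comp-at s (c ∔ d) n ⟩
      Σ≤ n (λ k → (c ∔ d) k * (s ↑ k) n)                            ≡⟨ Σ<-cong (suc n) (λ k _ → trans (cong (_* (s ↑ k) n) (∔-at c d k)) (ℚP.*-distribʳ-+ ((s ↑ k) n) (c k) (d k))) ⟩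
      Σ≤ n (λ k → c k * (s ↑ k) n + d k * (s ↑ k) n)                ≡⟨ Σ<-+ (suc n) _ _ ⟩
      Σ≤ n (λ k → c k * (s ↑ k) n) + Σ≤ n (λ k → d k * (s ↑ k) n)   ≡⟨ sym (trans (∔-at (comp s c) (comp s d) n) (cong₂ _+_ (comp-at s c n) (comp-at s d n))) ⟩
      (comp s c ∔ comp s d) n ∎

    comp-const-· : ∀ x c → comp s (const x · c) ≈ const x · comp s c
    comp-const-· x c .at n = begin
      comp s (const x · c) n                  ≡⟨ comp-at s (const x · c) n ⟩
      Σ≤ n (λ k → (const x · c) k * (s ↑ k) n) ≡⟨ Σ<-cong (suc n) (λ k _ → trans (cong (_* (s ↑ k) n) (const-·-at x c k)) (ℚP.*-assoc x (c k) ((s ↑ k) n))) ⟩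
      Σ≤ n (λ k → x * (c k * (s ↑ k) n))       ≡⟨ Σ<-*ˡ (suc n) x _ ⟩
      x * Σ≤ n (λ k → c k * (s ↑ k) n)         ≡⟨ sym (trans (const-·-at x (comp s c) n) (cong (x *_) (comp-at s c n))) ⟩
      (const x · comp s c) n ∎

    comp-at-0 : ∀ c → comp s c 0 ≡ c 0
    comp-at-0 c = trans (comp-at s c 0) (trans (ℚP.+-identityˡ _) (ℚP.*-identityʳ (c 0)))

    comp-horner : ∀ c → comp s c ≈ const (c 0) ∔ s · comp s (tail c)
    comp-horner c .at zero    = trans (comp-at-0 c) (sym (trans (∔-at (const (c 0)) _ 0) (trans (cong (λ z → c 0 + z) (trans (·-at-0 s (comp s (tail c))) (trans (cong (_* comp s (tail c) 0) s0) (ℚP.*-zeroˡ (comp s (tail c) 0))))) (ℚP.+-identityʳ (c 0)))))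
    comp-horner c .at (suc n) = begin
      comp s c (suc n)
        ≡⟨ trans (comp-at s c (suc n)) (Σ<-front (suc n) _) ⟩
      c 0 * 0ℚ + Σ< (suc n) (λ k → c (suc k) * (s ↑ suc k) (suc n))
        ≡⟨ cong₂ _+_ (ℚP.*-zeroʳ (c 0)) (sym (Σ<-truncate {suc n} {suc (suc n)} _ (ℕP.n≤1+n (suc n)) λ k n<k →
             trans (cong (c (suc k) *_) (↑-vanish s (suc k) (suc n) s0 (s≤s n<k))) (ℚP.*-zeroʳ (c (suc k))))) ⟩
      0ℚ + Σ≤ (suc n) (λ k → c (suc k) * (s · s ↑ k) (suc n))
        ≡⟨ cong (λ z → 0ℚ + z) (sym (·-comp s (tail c) (suc n))) ⟩
      0ℚ + (s · comp s (tail c)) (suc n)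
        ≡⟨ sym (∔-at (const (c 0)) (s · comp s (tail c)) (suc n)) ⟩
      (const (c 0) ∔ s · comp s (tail c)) (suc n) ∎

    comp-shift : ∀ c → comp s (shift c) ≈ s · comp s c
    comp-shift c = ≈-trans (comp-horner (shift c)) (∔-identityˡ (s · comp s c))

    -- Horner's rule for both factors leaves a product with s outside; since s(0) = 0, coefficient n
    -- needs multiplicativity only in degrees below n, for `tail c` and d. Hence the induction on
    -- the degree with c and d left general.
    comp-· : ∀ c d → comp s (c · d) ≈ comp s c · comp s d
    comp-· c d .at n = below (suc n) c d n ℕP.≤-refl
      where
      below : ∀ N c d n → n < N → comp s (c · d) n ≡ (comp s c · comp s d) n
      below (suc N) c d n (s≤s n≤N) = begin
        comp s (c · d) n
          ≡⟨ trans (comp-horner (c · d) .at n) (∔-at _ (s · comp s (tail (c · d))) n) ⟩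
        const ((c · d) 0) n + (s · comp s (tail (c · d))) n
          ≡⟨ cong₂ _+_ (cong (λ x → const x n) (·-at-0 c d)) (·-congˡ< {s} n s0 inner) ⟩
        const (c 0 * d 0) n + (s · (const (c 0) · comp s (tail d) ∔ comp s (tail c) · comp s d)) n
          ≡⟨ sym (∔-at _ _ n) ⟩
        (const (c 0 * d 0) ∔ s · (const (c 0) · comp s (tail d) ∔ comp s (tail c) · comp s d)) n
          ≡⟨ ∔-cong (const-* (c 0) (d 0)) (·-cong (≈-refl {s}) (∔-cong ≈-refl (·-cong ≈-refl (comp-horner d)))) .at n ⟩
        _ ≡⟨ SS.solve 5 (λ c₀ d₀ s t u → (c₀ SS.:* d₀) SS.:+ s SS.:* (c₀ SS.:* t SS.:+ u SS.:* (d₀ SS.:+ s SS.:* t)) SS.:= (c₀ SS.:+ s SS.:* u) SS.:* (d₀ SS.:+ s SS.:* t))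
               ≈-refl (const (c 0)) (const (d 0)) s (comp s (tail d)) (comp s (tail c)) .at n ⟩
        _ ≡⟨ ·-cong (≈-sym (comp-horner c)) (≈-sym (comp-horner d)) .at n ⟩
        (comp s c · comp s d) n ∎
        where
        inner : ∀ i → i < n → comp s (tail (c · d)) i ≡ (const (c 0) · comp s (tail d) ∔ comp s (tail c) · comp s d) i
        inner i i<n = begin
          comp s (tail (c · d)) i
            ≡⟨ comp-cong {tail (c · d)} {const (c 0) · tail d ∔ tail c · d} (mk≈ λ k → trans (·-suc c d k) (sym (trans (∔-at _ (tail c · d) k) (cong (_+ (tail c · d) k) (const-·-at (c 0) (tail d) k))))) .at i ⟩
          comp s (const (c 0) · tail d ∔ tail c · d) i
            ≡⟨ trans (comp-∔ (const (c 0) · tail d) (tail c · d) .at i) (∔-at _ _ i) ⟩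
          comp s (const (c 0) · tail d) i + comp s (tail c · d) i
            ≡⟨ cong₂ _+_ (comp-const-· (c 0) (tail d) .at i) (below N (tail c) d i (ℕP.<-≤-trans i<n n≤N)) ⟩
          (const (c 0) · comp s (tail d)) i + (comp s (tail c) · comp s d) i
            ≡⟨ sym (∔-at _ _ i) ⟩
          (const (c 0) · comp s (tail d) ∔ comp s (tail c) · comp s d) i ∎

    comp-const : ∀ x → comp s (const x) ≈ const x
    comp-const x = ≈-trans (comp-horner (const x)) (≈-trans (∔-cong ≈-refl (·-cong ≈-refl
        (≈-trans (comp-cong {tail (const x)} {const 0ℚ · tail (const x)} (mk≈ λ k → sym (trans (const-·-at 0ℚ (tail (const x)) k) (ℚP.*-zeroˡ 0ℚ)))) (comp-const-· 0ℚ (tail (const x))))))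
      (SS.solve 3 (λ c s z → c SS.:+ s SS.:* (SS.con 0ℚ SS.:* z) SS.:= c) ≈-refl (const x) s (comp s (tail (const x)))))

    comp-↑ : ∀ c k → comp s (c ↑ k) ≈ comp s c ↑ k
    comp-↑ c zero    = comp-const 1ℚ
    comp-↑ c (suc k) = ≈-trans (comp-· c (c ↑ k)) (·-cong ≈-refl (comp-↑ c k))

    D-comp : ∀ c → D (comp s c) ≈ comp s (deriv c) · D s
    D-comp c .at n = begin
      D (comp s c) n
        ≡⟨ trans (D-at (comp s c) n) (cong (fromℕ n *_) (comp-at s c n)) ⟩
      fromℕ n * Σ≤ n (λ k → c k * (s ↑ k) n)
        ≡⟨ sym (Σ<-*ˡ (suc n) (fromℕ n) _) ⟩
      Σ< (suc n) (λ k → fromℕ n * (c k * (s ↑ k) n))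
        ≡⟨ Σ<-cong (suc n) (λ k _ → trans (RS.solve 3 (λ a b c → a RS.:* (b RS.:* c) RS.:= b RS.:* (a RS.:* c)) refl (fromℕ n) (c k) ((s ↑ k) n)) (cong (c k *_) (sym (D-at (s ↑ k) n)))) ⟩
      Σ< (suc n) (λ k → c k * D (s ↑ k) n)
        ≡⟨ Σ<-front n _ ⟩
      c 0 * D (const 1ℚ) n + Σ< n (λ k → c (suc k) * D (s ↑ suc k) n)
        ≡⟨ cong₂ _+_ (trans (cong (c 0 *_) (trans (D-const 1ℚ .at n) (const0-at n))) (ℚP.*-zeroʳ (c 0))) (Σ<-cong n λ k _ → step k) ⟩
      0ℚ + Σ< n (λ k → deriv c k * (D s · s ↑ k) n)
        -- The added term k = n is zero: D s has no constant term and s^n starts in degree n.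
        ≡⟨ trans (ℚP.+-comm 0ℚ (Σ< n (λ k → deriv c k * (D s · s ↑ k) n))) (cong (λ z → Σ< n (λ k → deriv c k * (D s · s ↑ k) n) + z) (sym (trans (cong (deriv c n *_) (·-zeroʳ-at (D s) (s ↑ n) n (D-at-0 s) (λ i i<n → ↑-vanish s n i s0 i<n))) (ℚP.*-zeroʳ (deriv c n))))) ⟩
      Σ≤ n (λ k → deriv c k * (D s · s ↑ k) n)
        ≡⟨ sym (·-comp (D s) (deriv c) n) ⟩
      (D s · comp s (deriv c)) n
        ≡⟨ ·-comm-at n (D s) (comp s (deriv c)) ⟩
      (comp s (deriv c) · D s) n ∎
      where
      step : ∀ k → c (suc k) * D (s ↑ suc k) n ≡ deriv c k * (D s · s ↑ k) n
      step k = trans (cong (c (suc k) *_) (trans (D-↑ s k .at n) (const-·-at (fromℕ (suc k)) (s ↑ k · D s) n)))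
        (trans (RS.solve 3 (λ a b x → a RS.:* (b RS.:* x) RS.:= (b RS.:* a) RS.:* x) refl (c (suc k)) (fromℕ (suc k)) ((s ↑ k · D s) n))
          (cong (deriv c k *_) (·-comm-at n (s ↑ k) (D s))))

    -- Here q d/dq acts on c(s) as the Euler operator of the variable s, times ρ. It is used with s
    -- = t, ρ = a² and with s = q^p, ρ = p.
    D-comp-log : ∀ c ρ → D s ≈ s · ρ → D (comp s c) ≈ comp s (D c) · ρ
    D-comp-log c ρ eq = ≈-trans (D-comp c) (≈-trans (·-cong ≈-refl eq)
      (≈-trans (SS.solve 3 (λ x s r → x SS.:* (s SS.:* r) SS.:= (s SS.:* x) SS.:* r) ≈-refl (comp s (deriv c)) s ρ)
        (·-cong (≈-trans (≈-sym (comp-shift (deriv c))) (comp-cong (mk≈ λ { zero → sym (D-at-0 c) ; (suc k) → sym (D-at c (suc k)) }))) ≈-refl)))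

  open Composition public

  -- Reciprocals and logarithms as compositions

  inv-comp : ∀ f → inv f ≈ comp (const (- 1ℚ) · (f ∔ (⊝ const 1ℚ))) (λ _ → 1ℚ)
  inv-comp f .at n = trans (Σ<-cong (suc n) λ k _ → trans (pow≈↑ k arg .at n) (sym (ℚP.*-identityˡ ((_ ↑ k) n)))) (sym (comp-at _ _ n))
    where
    arg : scale (- 1ℚ) (f ⊖ one) ≈ const (- 1ℚ) · (f ∔ (⊝ const 1ℚ))
    arg .at n = trans (cong (- 1ℚ *_) (⊖≈ (≈-refl {f}) one≈const .at n)) (sym (const-·-at (- 1ℚ) (f ∔ (⊝ const 1ℚ)) n))

  sub1-at-0 : ∀ f → f 0 ≡ 1ℚ → (f ∔ (⊝ const 1ℚ)) 0 ≡ 0ℚ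
  sub1-at-0 f f0 = trans (∔-at f _ 0) (cong₂ _+_ f0 (⊝-at (const 1ℚ) 0))

  inv-right : ∀ f → f 0 ≡ 1ℚ → f · inv f ≈ const 1ℚ
  inv-right f f0 = ≈-trans (·-cong (SS.solve 1 (λ f → f SS.:= SS.con 1ℚ SS.:- SS.con (- 1ℚ) SS.:* (f SS.:- SS.con 1ℚ)) ≈-refl f) (inv-comp f))
    (≈-trans (SS.solve 2 (λ s x → (SS.con 1ℚ SS.:- s) SS.:* x SS.:= x SS.:- s SS.:* x) ≈-refl s (comp s (λ _ → 1ℚ)))
    (≈-trans (∔-cong (comp-horner s s0 (λ _ → 1ℚ)) ≈-refl) (SS.solve 1 (λ y → (SS.con 1ℚ SS.:+ y) SS.:- y SS.:= SS.con 1ℚ) ≈-refl (s · comp s (λ _ → 1ℚ)))))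
    where
    s = const (- 1ℚ) · (f ∔ (⊝ const 1ℚ))
    s0 : s 0 ≡ 0ℚ
    s0 = trans (const-·-at (- 1ℚ) _ 0) (cong (- 1ℚ *_) (sub1-at-0 f f0))

  ·-cancelˡ : ∀ f {g h} → f 0 ≡ 1ℚ → f · g ≈ f · h → g ≈ h
  ·-cancelˡ f {g} {h} f0 eq = ≈-trans (lemma g) (≈-trans (·-cong ≈-refl eq) (≈-sym (lemma h)))
    where
    lemma : ∀ g → g ≈ inv f · (f · g)
    lemma g = ≈-sym (≈-trans (SS.solve 3 (λ a b c → a SS.:* (b SS.:* c) SS.:= (b SS.:* a) SS.:* c) ≈-refl (inv f) f g) (≈-trans (·-cong (inv-right f f0) ≈-refl) (one-· g)))

  logCoeff : ℕ → ℚ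
  logCoeff zero    = 0ℚ
  logCoeff (suc j) = ((- 1ℚ) ^ℚ j) * (+ 1 / suc j)

  logS-comp : ∀ f → logS f ≈ comp (f ∔ (⊝ const 1ℚ)) logCoeff
  logS-comp f .at n = sym (begin
    comp (f ∔ (⊝ const 1ℚ)) logCoeff n
      ≡⟨ trans (comp-at _ logCoeff n) (Σ<-front n _) ⟩
    0ℚ * const 1ℚ n + Σ< n (λ j → logCoeff (suc j) * ((f ∔ (⊝ const 1ℚ)) ↑ suc j) n)
      ≡⟨ trans (cong₂ _+_ (ℚP.*-zeroˡ (const 1ℚ n)) (Σ<-cong n λ j _ → cong (logCoeff (suc j) *_) (sym (pow≈↑ (suc j) (⊖≈ (≈-refl {f}) one≈const) .at n)))) (ℚP.+-identityˡ _) ⟩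
    logS f n ∎)

  -- The derivative of log(1 + s) has coefficients (-1)^k, whose tail is their own negative.
  -- Horner's rule then reads x = 1 - s x, so (1 + s) x = 1.
  D-logS : ∀ f → f 0 ≡ 1ℚ → f · D (logS f) ≈ D f
  D-logS f f0 = ≈-trans (·-cong (SS.solve 1 (λ f → f SS.:= SS.con 1ℚ SS.:+ (f SS.:- SS.con 1ℚ)) ≈-refl f) (≈-trans (D-cong (logS-comp f)) (D-comp s s0 logCoeff)))
    (≈-trans (SS.solve 3 (λ s x d → (SS.con 1ℚ SS.:+ s) SS.:* (x SS.:* d) SS.:= (x SS.:+ s SS.:* x) SS.:* d) ≈-refl s x (D s))
      (≈-trans (·-cong unit ≈-refl) (≈-trans (one-· (D s)) (≈-trans (D-∔ f _) (≈-trans (∔-cong ≈-refl (≈-trans (D-⊝ (const 1ℚ)) (⊝-cong (D-const 1ℚ))))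
        (SS.solve 1 (λ d → d SS.:- SS.con 0ℚ SS.:= d) ≈-refl (D f)))))))
    where
    s = f ∔ (⊝ const 1ℚ)
    s0 = sub1-at-0 f f0
    x = comp s (deriv logCoeff)
    alternating : ∀ k → deriv logCoeff k ≡ (- 1ℚ) ^ℚ k
    alternating k = trans (RS.solve 3 (λ a b c → a RS.:* (b RS.:* c) RS.:= (a RS.:* c) RS.:* b) refl (fromℕ (suc k)) ((- 1ℚ) ^ℚ k) (+ 1 / suc k))
      (trans (cong (_* ((- 1ℚ) ^ℚ k)) (suc*1/suc k)) (ℚP.*-identityˡ _))
    tail-deriv : tail (deriv logCoeff) ≈ const (- 1ℚ) · deriv logCoeff
    tail-deriv .at k = trans (alternating (suc k)) (sym (trans (const-·-at (- 1ℚ) (deriv logCoeff) k) (cong (- 1ℚ *_) (alternating k))))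
    unit : x ∔ s · x ≈ const 1ℚ
    unit = ≈-trans (∔-cong (≈-trans (comp-horner s s0 (deriv logCoeff)) (∔-cong ≈-refl (·-cong ≈-refl (≈-trans (comp-cong s s0 tail-deriv) (comp-const-· s s0 (- 1ℚ) (deriv logCoeff)))))) ≈-refl)
      (SS.solve 2 (λ s x → (SS.con 1ℚ SS.:+ s SS.:* (SS.con (- 1ℚ) SS.:* x)) SS.:+ s SS.:* x SS.:= SS.con 1ℚ) ≈-refl s x)

  -- Lambert series

  -- u m = q^m/(1 - q^m)
  u : ℕ → Series
  u m zero    = 0ℚ
  u m (suc n) with m ∣? suc n
  ... | yes _ = 1ℚ
  ... | no  _ = 0ℚ

  u-∣ : ∀ {m n} → m ∣ suc n → u m (suc n) ≡ 1ℚ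
  u-∣ {m} {n} d with m ∣? suc n
  ... | yes _ = refl
  ... | no ¬d = contradiction d ¬d

  u-∤ : ∀ {m n} → ¬ m ∣ n → u m n ≡ 0ℚ
  u-∤ {m} {zero}  ¬d = refl
  u-∤ {m} {suc n} ¬d with m ∣? suc n
  ... | yes d = contradiction d ¬d
  ... | no _  = refl

  u-< : ∀ {m n} → n < m → u m n ≡ 0ℚ
  u-< {m} {zero}  _   = refl
  u-< {m} {suc n} n<m = u-∤ (λ d → ℕP.<⇒≱ n<m (∣⇒≤ d))

  1-q^ : ℕ → Series
  1-q^ m = const 1ℚ ∔ (⊝ qPow m)

  1-q^-at-0 : ∀ m → 1-q^ (suc m) 0 ≡ 1ℚ
  1-q^-at-0 m = trans (∔-at (const 1ℚ) _ 0) (cong (λ z → 1ℚ + z) (trans (⊝-at (qPow (suc m)) 0) (cong -_ (qPow-off (suc m) 0 (λ ())))))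

  -- Divisibility by M is invariant under a shift by M, which gives u = q^M (1 + u); the closed form
  -- is this equation solved for u.
  u-geometric : ∀ m → 1-q^ (suc m) · u (suc m) ≈ qPow (suc m)
  u-geometric m = ≈-trans (·-cong (≈-refl {1-q^ M}) u≈) (≈-trans (SS.solve 2 (λ q u → (SS.con 1ℚ SS.:- q) SS.:* (q SS.:* (SS.con 1ℚ SS.:+ u)) SS.:= q SS.:* ((SS.con 1ℚ SS.:- q) SS.:* (SS.con 1ℚ SS.:+ u))) ≈-refl (qPow M) (u M))
    (≈-trans (·-cong ≈-refl (≈-trans (SS.solve 2 (λ q u → (SS.con 1ℚ SS.:- q) SS.:* (SS.con 1ℚ SS.:+ u) SS.:= (SS.con 1ℚ SS.:+ u) SS.:- q SS.:* (SS.con 1ℚ SS.:+ u)) ≈-refl (qPow M) (u M))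
      (≈-trans (∔-cong ≈-refl (⊝-cong (≈-sym u≈))) (SS.solve 1 (λ u → (SS.con 1ℚ SS.:+ u) SS.:- u SS.:= SS.con 1ℚ) ≈-refl (u M)))))
      (SS.solve 1 (λ q → q SS.:* SS.con 1ℚ SS.:= q) ≈-refl (qPow M))))
    where
    M = suc m
    u≈ : u M ≈ qPow M · (const 1ℚ ∔ u M)
    u≈ = qPow-unique M (λ n n<M → u-< n<M) high
      where
      high : ∀ n → u M (M ℕ.+ n) ≡ (const 1ℚ ∔ u M) n
      high zero    = trans (u-∣ {n = m ℕ.+ 0} (subst (M ∣_) (sym (ℕP.+-identityʳ M)) ∣-refl)) (sym (∔-at (const 1ℚ) (u M) 0))
      high (suc n) = trans (go (M ∣? suc n)) (sym (trans (∔-at (const 1ℚ) (u M) (suc n)) (ℚP.+-identityˡ _)))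
        where
        go : Dec (M ∣ suc n) → u M (M ℕ.+ suc n) ≡ u M (suc n)
        go (yes d) = trans (u-∣ {n = m ℕ.+ suc n} (∣m∣n⇒∣m+n ∣-refl d)) (sym (u-∣ d))
        go (no ¬d) = trans (u-∤ (λ d → ¬d (∣m+n∣m⇒∣n d ∣-refl))) (sym (u-∤ ¬d))

  -- With x = q^m and y = q^k and all denominators cleared, this is the identity 1 - xy = (1 - x)(1
  -- - y) + x(1 - y) + y(1 - x).
  u-· : ∀ m k → u (suc m) · u (suc k) ≈ u (suc m ℕ.+ suc k) · (const 1ℚ ∔ u (suc m) ∔ u (suc k))
  u-· m k = ·-cancelˡ (1-q^ M) (1-q^-at-0 m) (·-cancelˡ (1-q^ K) (1-q^-at-0 k) (·-cancelˡ (1-q^ (M ℕ.+ K)) (1-q^-at-0 (m ℕ.+ K)) cleared))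
    where
    M = suc m
    K = suc k
    w = u (M ℕ.+ K)
    cleared : 1-q^ (M ℕ.+ K) · (1-q^ K · (1-q^ M · (u M · u K))) ≈ 1-q^ (M ℕ.+ K) · (1-q^ K · (1-q^ M · (w · (const 1ℚ ∔ u M ∔ u K))))
    cleared =
      ≈-trans (SS.solve 5 (λ A B E u v → E SS.:* (B SS.:* (A SS.:* (u SS.:* v))) SS.:= E SS.:* ((A SS.:* u) SS.:* (B SS.:* v))) ≈-refl (1-q^ M) (1-q^ K) (1-q^ (M ℕ.+ K)) (u M) (u K))
      (≈-trans (·-cong (∔-cong ≈-refl (⊝-cong (qPow-+ M K))) (·-cong (u-geometric m) (u-geometric k)))
      (≈-trans (SS.solve 2 (λ x y → (SS.con 1ℚ SS.:- x SS.:* y) SS.:* (x SS.:* y) SS.:= (x SS.:* y) SS.:* ((SS.con 1ℚ SS.:- x) SS.:* (SS.con 1ℚ SS.:- y) SS.:+ x SS.:* (SS.con 1ℚ SS.:- y) SS.:+ y SS.:* (SS.con 1ℚ SS.:- x))) ≈-refl (qPow M) (qPow K))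
      (≈-trans (·-cong (≈-trans (≈-sym (qPow-+ M K)) (≈-sym (u-geometric (m ℕ.+ K)))) (∔-cong (∔-cong ≈-refl (·-cong (≈-sym (u-geometric m)) ≈-refl)) (·-cong (≈-sym (u-geometric k)) ≈-refl)))
        (SS.solve 6 (λ A B E u v w → (E SS.:* w) SS.:* (A SS.:* B SS.:+ (A SS.:* u) SS.:* B SS.:+ (B SS.:* v) SS.:* A) SS.:= E SS.:* (B SS.:* (A SS.:* (w SS.:* (SS.con 1ℚ SS.:+ u SS.:+ v))))) ≈-refl (1-q^ M) (1-q^ K) (1-q^ (M ℕ.+ K)) (u M) (u K) w))))

  -- Differentiating (1 - q^m) u = q^m. This is how derivatives of Lambert series enter the
  -- convolution identities: through the diagonal terms m = k.
  u-square : ∀ m → D (u (suc m)) ≈ const (fromℕ (suc m)) · (u (suc m) ∔ u (suc m) · u (suc m))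
  u-square m = ·-cancelˡ (1-q^ M) (1-q^-at-0 m) (≈-trans (SS.solve 2 (λ x y → x SS.:= (y SS.:+ x) SS.:- y) ≈-refl (1-q^ M · D (u M)) (D (1-q^ M) · u M))
    (≈-trans (∔-cong (≈-trans (≈-sym (D-· (1-q^ M) (u M))) (≈-trans (D-cong (u-geometric m)) (≈-trans (D-qPow M) (·-cong ≈-refl (≈-sym (u-geometric m)))))) (⊝-cong (·-cong D1-q ≈-refl)))
      (SS.solve 4 (λ A n q u → n SS.:* (A SS.:* u) SS.:- (SS.:- (n SS.:* q)) SS.:* u SS.:= n SS.:* (A SS.:* u SS.:+ q SS.:* u)) ≈-refl (1-q^ M) (const (fromℕ M)) (qPow M) (u M) ⟨≈⟩
        (≈-trans (·-cong ≈-refl (∔-cong ≈-refl (·-cong (≈-sym (u-geometric m)) ≈-refl)))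
          (SS.solve 3 (λ A n u → n SS.:* (A SS.:* u SS.:+ (A SS.:* u) SS.:* u) SS.:= A SS.:* (n SS.:* (u SS.:+ u SS.:* u))) ≈-refl (1-q^ M) (const (fromℕ M)) (u M))))))
    where
    M = suc m
    _⟨≈⟩_ = ≈-trans
    D1-q : D (1-q^ M) ≈ ⊝ (const (fromℕ M) · qPow M)
    D1-q = ≈-trans (D-∔ (const 1ℚ) _) (≈-trans (∔-cong (D-const 1ℚ) (≈-trans (D-⊝ (qPow M)) (⊝-cong (D-qPow M)))) (∔-identityˡ _))

  -- 𝓛 φ = Σ φ(m) q^m/(1 - q^m)
  𝓛 : (ℕ → ℚ) → Series
  𝓛 φ n = Σ< n (λ i → φ (suc i) * u (suc i) n)

  𝓛-truncate : ∀ φ {n N} → n ≤ N → 𝓛 φ n ≡ Σ< N (λ i → φ (suc i) * u (suc i) n)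
  𝓛-truncate φ n≤N = sym (Σ<-truncate _ n≤N λ j n≤j → trans (cong (φ (suc j) *_) (u-< (s≤s n≤j))) (ℚP.*-zeroʳ (φ (suc j))))

  𝓛-cong : ∀ {φ ψ} → (∀ m → φ (suc m) ≡ ψ (suc m)) → 𝓛 φ ≈ 𝓛 ψ
  𝓛-cong eq .at n = Σ<-cong n λ i _ → cong (_* u (suc i) n) (eq i)

  𝓛-∔ : ∀ φ ψ → 𝓛 (λ m → φ m + ψ m) ≈ 𝓛 φ ∔ 𝓛 ψ
  𝓛-∔ φ ψ .at n = trans (Σ<-cong n λ i _ → ℚP.*-distribʳ-+ (u (suc i) n) (φ (suc i)) (ψ (suc i))) (trans (Σ<-+ n _ _) (sym (∔-at (𝓛 φ) (𝓛 ψ) n)))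

  𝓛-const-· : ∀ c φ → 𝓛 (λ m → c * φ m) ≈ const c · 𝓛 φ
  𝓛-const-· c φ .at n = trans (Σ<-cong n λ i _ → ℚP.*-assoc c (φ (suc i)) (u (suc i) n)) (trans (Σ<-*ˡ n c _) (sym (const-·-at c (𝓛 φ) n)))

  -- Products of two Lambert series

  doubleSum : ℕ → (ℕ → ℕ → ℚ) → ℚ
  doubleSum n Φ = Σ< n (λ i → Σ< n (λ j → Φ (suc i) (suc j) * (u (suc i) · u (suc j)) n))

  -- Since `u m` starts in degree m, both factors may be cut off at m = n before they are
  -- multiplied.
  𝓛-·-𝓛 : ∀ φ ψ n → (𝓛 φ · 𝓛 ψ) n ≡ doubleSum n (λ m k → φ m * ψ k)
  𝓛-·-𝓛 φ ψ n = begin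
    (𝓛 φ · 𝓛 ψ) n
      ≡⟨ ·-cong≤ n (λ _ i≤n → 𝓛-truncate φ i≤n) (λ _ i≤n → 𝓛-truncate ψ i≤n) ⟩
    ((λ i → Σ< n (λ k → φ (suc k) * u (suc k) i)) · (λ i → Σ< n (λ k → ψ (suc k) * u (suc k) i))) n
      ≡⟨ ·-comm-at n _ _ ⟩
    ((λ i → Σ< n (λ k → ψ (suc k) * u (suc k) i)) · (λ i → Σ< n (λ k → φ (suc k) * u (suc k) i))) n
      ≡⟨ ·-Σ<ʳ n (λ k → φ (suc k)) (λ k → u (suc k)) _ n ⟩
    Σ< n (λ k → φ (suc k) * ((λ i → Σ< n (λ k → ψ (suc k) * u (suc k) i)) · u (suc k)) n)
      ≡⟨ Σ<-cong n (λ k _ → trans (cong (φ (suc k) *_) (trans (·-comm-at n _ (u (suc k))) (·-Σ<ʳ n (λ k → ψ (suc k)) (λ k → u (suc k)) (u (suc k)) n)))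
           (trans (sym (Σ<-*ˡ n (φ (suc k)) _)) (Σ<-cong n λ j _ → sym (ℚP.*-assoc (φ (suc k)) (ψ (suc j)) _)))) ⟩
    doubleSum n (λ m k → φ m * ψ k) ∎

  doubleSum-+ : ∀ n Φ Ψ → doubleSum n (λ m k → Φ m k + Ψ m k) ≡ doubleSum n Φ + doubleSum n Ψ
  doubleSum-+ n Φ Ψ = trans (Σ<-cong n λ i _ → trans (Σ<-cong n λ j _ → ℚP.*-distribʳ-+ _ (Φ (suc i) (suc j)) (Ψ (suc i) (suc j))) (Σ<-+ n _ _)) (Σ<-+ n _ _)

  u-·-< : ∀ m k n → n < m ℕ.+ k → (u m · u k) n ≡ 0ℚ
  u-·-< m k n n<m+k = trans (·-def (u m) (u k) n) (Σ<-zero (suc n) term)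
    where
    term : ∀ i → i < suc n → u m i * u k (n ∸ i) ≡ 0ℚ
    term i i≤n with ℕP.≤-<-connex m i
    ... | inj₂ i<m = trans (cong (_* u k (n ∸ i)) (u-< i<m)) (ℚP.*-zeroˡ (u k (n ∸ i)))
    ... | inj₁ m≤i = trans (cong (u m i *_) (u-< (ℕP.+-cancelˡ-< m _ _ (ℕP.≤-<-trans (ℕP.+-monoˡ-≤ (n ∸ i) m≤i) (subst (_< m ℕ.+ k) (sym (ℕP.m+[n∸m]≡n (ℕP.≤-pred i≤n))) n<m+k))))) (ℚP.*-zeroʳ (u m i))

  -- `u-·` gives three terms; exchanging m and k brings the third to the shape of the second, and
  -- everything is collected by N = m + k. Indices are shifted by one: `suc I` is N, `suc i` is m,
  -- and so `I ∸ i` is k.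
  doubleSum-expand : ∀ n (g : ℕ → ℕ → ℚ) → doubleSum n g ≡
    Σ< n (λ I → u (suc I) n * Σ< I (λ i → g (suc i) (I ∸ i))) +
    Σ< n (λ I → Σ< I (λ i → (g (suc i) (I ∸ i) + g (I ∸ i) (suc i)) * (u (suc I) · u (suc i)) n))
  doubleSum-expand n g = begin
    doubleSum n g
      ≡⟨ Σ<-cong n (λ i _ → trans (Σ<-cong n λ j _ → expand i j) (Σ<-+ n _ _)) ⟩
    Σ< n (λ i → Σ< n (λ j → g (suc i) (suc j) * (w i j + (u (suc i ℕ.+ suc j) · u (suc i)) n)) + Σ< n (λ j → g (suc i) (suc j) * (u (suc i ℕ.+ suc j) · u (suc j)) n))
      ≡⟨ Σ<-+ n _ _ ⟩
    Σ< n (λ i → Σ< n (λ j → g (suc i) (suc j) * (w i j + (u (suc i ℕ.+ suc j) · u (suc i)) n))) + Σ< n (λ i → Σ< n (λ j → g (suc i) (suc j) * (u (suc i ℕ.+ suc j) · u (suc j)) n))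
      ≡⟨ cong (λ z → Σ< n (λ i → Σ< n (λ j → g (suc i) (suc j) * (w i j + (u (suc i ℕ.+ suc j) · u (suc i)) n))) + z) (trans (Σ<-swap n n _) (Σ<-cong n λ i _ → Σ<-cong n λ j _ → cong (λ N → g (suc j) (suc i) * (u N · u (suc i)) n) (ℕP.+-comm (suc j) (suc i)))) ⟩
    Σ< n (λ i → Σ< n (λ j → g (suc i) (suc j) * (w i j + (u (suc i ℕ.+ suc j) · u (suc i)) n))) + Σ< n (λ i → Σ< n (λ j → g (suc j) (suc i) * (u (suc i ℕ.+ suc j) · u (suc i)) n))
      ≡⟨ trans (sym (Σ<-+ n _ _)) (Σ<-cong n λ i _ → trans (sym (Σ<-+ n _ _)) (Σ<-cong n λ j _ → collect i j)) ⟩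
    Σ< n (λ i → Σ< n (λ j → f i (i ℕ.+ suc j)))
      -- Pairs with m + k > n contribute nothing, since every term contains `u (m + k)`; the square
      -- becomes a triangle.
      ≡⟨ Σ<-cong n (λ i i<n → Σ<-truncate _ (ℕP.m∸n≤m n (suc i)) (vanish i i<n)) ⟩
    Σ< n (λ i → Σ< (n ∸ suc i) (λ j → f i (i ℕ.+ suc j)))
      ≡⟨ Σ<-triangle n f ⟩
    Σ< n (λ I → Σ< I (λ i → f i I))
      ≡⟨ Σ<-cong n (λ I _ → trans (Σ<-+ I _ _) (cong (_+ Σ< I (λ i → (g (suc i) (I ∸ i) + g (I ∸ i) (suc i)) * (u (suc I) · u (suc i)) n)) (Σ<-*ˡ I (u (suc I) n) _))) ⟩
    Σ< n (λ I → u (suc I) n * Σ< I (λ i → g (suc i) (I ∸ i)) + Σ< I (λ i → (g (suc i) (I ∸ i) + g (I ∸ i) (suc i)) * (u (suc I) · u (suc i)) n))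
      ≡⟨ Σ<-+ n _ _ ⟩
    _ ∎
    where
    w : ℕ → ℕ → ℚ
    w i j = u (suc i ℕ.+ suc j) n
    f : ℕ → ℕ → ℚ
    f i I = u (suc I) n * g (suc i) (I ∸ i) + (g (suc i) (I ∸ i) + g (I ∸ i) (suc i)) * (u (suc I) · u (suc i)) n
    expand : ∀ i j → g (suc i) (suc j) * (u (suc i) · u (suc j)) n ≡
      g (suc i) (suc j) * (w i j + (u (suc i ℕ.+ suc j) · u (suc i)) n) + g (suc i) (suc j) * (u (suc i ℕ.+ suc j) · u (suc j)) n
    expand i j = trans (cong (g (suc i) (suc j) *_) (trans (u-· i j .at n) (trans
        (SS.solve 3 (λ w a b → w SS.:* (SS.con 1ℚ SS.:+ a SS.:+ b) SS.:= (w SS.:+ w SS.:* a) SS.:+ w SS.:* b) ≈-refl (u (suc i ℕ.+ suc j)) (u (suc i)) (u (suc j)) .at n)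
        (trans (∔-at _ (u (suc i ℕ.+ suc j) · u (suc j)) n) (cong (_+ (u (suc i ℕ.+ suc j) · u (suc j)) n) (∔-at _ (u (suc i ℕ.+ suc j) · u (suc i)) n))))))
      (ℚP.*-distribˡ-+ (g (suc i) (suc j)) _ _)
    I∸i : ∀ i j → i ℕ.+ suc j ∸ i ≡ suc j
    I∸i i j = ℕP.m+n∸m≡n i (suc j)
    collect : ∀ i j → g (suc i) (suc j) * (w i j + (u (suc i ℕ.+ suc j) · u (suc i)) n) + g (suc j) (suc i) * (u (suc i ℕ.+ suc j) · u (suc i)) n ≡ f i (i ℕ.+ suc j)
    collect i j = trans (RS.solve 4 (λ a b w x → a RS.:* (w RS.:+ x) RS.:+ b RS.:* x RS.:= w RS.:* a RS.:+ (a RS.:+ b) RS.:* x) refl (g (suc i) (suc j)) (g (suc j) (suc i)) (w i j) ((u (suc i ℕ.+ suc j) · u (suc i)) n))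
      (cong (λ k → w i j * g (suc i) k + (g (suc i) k + g k (suc i)) * (u (suc i ℕ.+ suc j) · u (suc i)) n) (sym (I∸i i j)))
    vanish : ∀ i → i < n → ∀ j → n ∸ suc i ≤ j → f i (i ℕ.+ suc j) ≡ 0ℚ
    vanish i i<n j le = trans (cong₂ (λ a b → a * g (suc i) _ + (g (suc i) _ + g _ (suc i)) * b) (u-< big) (u-·-< (suc (i ℕ.+ suc j)) (suc i) n (ℕP.<-≤-trans big (ℕP.m≤m+n _ _))))
      (RS.solve 2 (λ a b → RS.con 0ℚ RS.:* a RS.:+ b RS.:* RS.con 0ℚ RS.:= RS.con 0ℚ) refl (g (suc i) (i ℕ.+ suc j ∸ i)) (g (suc i) (i ℕ.+ suc j ∸ i) + g (i ℕ.+ suc j ∸ i) (suc i)))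
      where
      big : n < suc (i ℕ.+ suc j)
      big = s≤s (subst (n ≤_) (sym (ℕP.+-suc i j)) (ℕP.≤-trans (ℕP.m≤n+m∸n n (suc i)) (ℕP.+-monoʳ-≤ (suc i) le)))

  u-square-at : ∀ m n → fromℕ (suc m) * (u (suc m) · u (suc m)) n ≡ (fromℕ n - fromℕ (suc m)) * u (suc m) n
  u-square-at m n = begin
    M * (u (suc m) · u (suc m)) n
      ≡⟨ RS.solve 3 (λ M a x → M RS.:* x RS.:= M RS.:* (a RS.:+ x) RS.:- M RS.:* a) refl M (u (suc m) n) ((u (suc m) · u (suc m)) n) ⟩
    M * (u (suc m) n + (u (suc m) · u (suc m)) n) - M * u (suc m) n
      ≡⟨ cong (_- M * u (suc m) n) (trans (cong (M *_) (sym (∔-at _ _ n))) (trans (sym (const-·-at M _ n)) (trans (sym (u-square m .at n)) (D-at (u (suc m)) n)))) ⟩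
    fromℕ n * u (suc m) n - M * u (suc m) n
      ≡⟨ RS.solve 3 (λ N M a → N RS.:* a RS.:- M RS.:* a RS.:= (N RS.:- M) RS.:* a) refl (fromℕ n) M (u (suc m) n) ⟩
    (fromℕ n - M) * u (suc m) n ∎
    where M = fromℕ (suc m)

  -- Expanding Σ g(m,k) u_m u_k by u_m u_k = u_{m+k} (1 + u_m + u_k) gives one linear relation between the products
  -- u_m u_N for every auxiliary g; it evaluates Σ Φ(m,k) u_m u_k when g matches Φ in this sense. G m N is g(m, N - m).
  convolution : ∀ (Φ G : ℕ → ℕ → ℚ) (δ w : ℕ → ℚ) →
    (∀ m k → Φ m (m ℕ.+ k) + Φ (m ℕ.+ k) m ≡ G m (m ℕ.+ (m ℕ.+ k)) + G (m ℕ.+ k) (m ℕ.+ (m ℕ.+ k)) - (G m (m ℕ.+ k) + G k (m ℕ.+ k))) →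
    (∀ m → Φ m m ≡ G m (m ℕ.+ m) + fromℕ m * δ m) →
    (∀ N → Σ< N (λ i → G (suc i) (suc N)) ≡ w (suc N) + fromℕ (suc N) * δ (suc N)) →
    ∀ n → doubleSum n Φ ≡ (D (𝓛 δ) ∔ 𝓛 w) n
  convolution Φ G δ w off diag col n = begin
    doubleSum n Φ
      ≡⟨ Σ<-split n _ ⟩
    Σ< n (λ i → Φ (suc i) (suc i) * W i i) + Σ< n (λ I → Σ< I (λ i → Φ (suc I) (suc i) * W I i + Φ (suc i) (suc I) * W i I))
      ≡⟨ cong₂ _+_ (trans (Σ<-cong n λ i _ → diagTerm i) (Σ<-+ n _ _)) (trans (Σ<-cong n λ I _ → trans (Σ<-cong I λ i i<I → offTerm I i i<I) (Σ<-+ I _ _)) (Σ<-+ n _ _)) ⟩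
    (gd + dd) + (go + Σ< n (λ I → Σ< I (λ i → - 1ℚ * ((g (suc i) (I ∸ i) + g (I ∸ i) (suc i)) * W I i))))
      ≡⟨ cong (λ z → (gd + dd) + (go + z)) (trans (Σ<-cong n λ I _ → Σ<-*ˡ I (- 1ℚ) _) (Σ<-*ˡ n (- 1ℚ) _)) ⟩
    (gd + dd) + (go + - 1ℚ * ge)
      ≡⟨ RS.solve 4 (λ gd dd go ge → (gd RS.:+ dd) RS.:+ (go RS.:+ RS.con (- 1ℚ) RS.:* ge) RS.:= dd RS.:+ ((gd RS.:+ go) RS.:- ge)) refl gd dd go ge ⟩
    dd + ((gd + go) - ge)
      -- The decisive cancellation: `gd + go` is the whole double sum of g, and its expansion is
      -- `cc + ge`.
      ≡⟨ cong (λ z → dd + (z - ge)) (trans (sym (Σ<-split n _)) (doubleSum-expand n g)) ⟩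
    dd + ((cc + ge) - ge)
      ≡⟨ RS.solve 3 (λ dd cc ge → dd RS.:+ ((cc RS.:+ ge) RS.:- ge) RS.:= dd RS.:+ cc) refl dd cc ge ⟩
    dd + cc
      ≡⟨ trans (sym (Σ<-+ n _ _)) (trans (Σ<-cong n λ i _ → final i) (Σ<-+ n _ _)) ⟩
    Σ< n (λ i → fromℕ n * (δ (suc i) * u (suc i) n)) + 𝓛 w n
      ≡⟨ sym (trans (∔-at _ (𝓛 w) n) (cong (_+ 𝓛 w n) (trans (D-at (𝓛 δ) n) (sym (Σ<-*ˡ n (fromℕ n) _))))) ⟩
    (D (𝓛 δ) ∔ 𝓛 w) n ∎
    where
    g : ℕ → ℕ → ℚ
    g m k = G m (m ℕ.+ k)
    W : ℕ → ℕ → ℚ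
    W i j = (u (suc i) · u (suc j)) n
    gd = Σ< n (λ i → g (suc i) (suc i) * W i i)
    go = Σ< n (λ I → Σ< I (λ i → g (suc I) (suc i) * W I i + g (suc i) (suc I) * W i I))
    ge = Σ< n (λ I → Σ< I (λ i → (g (suc i) (I ∸ i) + g (I ∸ i) (suc i)) * W I i))
    cc = Σ< n (λ I → u (suc I) n * Σ< I (λ i → g (suc i) (I ∸ i)))
    dd = Σ< n (λ i → δ (suc i) * ((fromℕ n - fromℕ (suc i)) * u (suc i) n))
    diagTerm : ∀ i → Φ (suc i) (suc i) * W i i ≡ g (suc i) (suc i) * W i i + δ (suc i) * ((fromℕ n - fromℕ (suc i)) * u (suc i) n)
    diagTerm i = trans (cong (_* W i i) (diag (suc i)))
      (trans (RS.solve 4 (λ g M d W → (g RS.:+ M RS.:* d) RS.:* W RS.:= g RS.:* W RS.:+ d RS.:* (M RS.:* W)) refl (g (suc i) (suc i)) (fromℕ (suc i)) (δ (suc i)) (W i i))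
        (cong (λ z → g (suc i) (suc i) * W i i + δ (suc i) * z) (u-square-at i n)))
    offTerm : ∀ I i → i < I → Φ (suc I) (suc i) * W I i + Φ (suc i) (suc I) * W i I ≡
      (g (suc I) (suc i) * W I i + g (suc i) (suc I) * W i I) + - 1ℚ * ((g (suc i) (I ∸ i) + g (I ∸ i) (suc i)) * W I i)
    offTerm I i i<I = trans (cong (λ z → Φ (suc I) (suc i) * W I i + Φ (suc i) (suc I) * z) Wsym)
      (trans (RS.solve 3 (λ a b w → a RS.:* w RS.:+ b RS.:* w RS.:= (b RS.:+ a) RS.:* w) refl (Φ (suc I) (suc i)) (Φ (suc i) (suc I)) (W I i))
        (trans (cong (_* W I i) key)
          (trans (RS.solve 5 (λ a b c d w → (a RS.:+ b RS.:- (c RS.:+ d)) RS.:* w RS.:= (b RS.:* w RS.:+ a RS.:* w) RS.:+ RS.con (- 1ℚ) RS.:* ((c RS.:+ d) RS.:* w)) refl (g (suc i) (suc I)) (g (suc I) (suc i)) (g (suc i) (I ∸ i)) (g (I ∸ i) (suc i)) (W I i))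
            (cong (λ z → (g (suc I) (suc i) * W I i + g (suc i) (suc I) * z) + - 1ℚ * ((g (suc i) (I ∸ i) + g (I ∸ i) (suc i)) * W I i)) (sym Wsym)))))
      where
      Wsym : W i I ≡ W I i
      Wsym = ·-comm-at n (u (suc i)) (u (suc I))
      N≡ : suc i ℕ.+ (I ∸ i) ≡ suc I
      N≡ = cong suc (ℕP.m+[n∸m]≡n (ℕP.<⇒≤ i<I))
      -- The condition `off` at m = suc i and k = I ∸ i, so that m + k = suc I is the larger of the
      -- two indices.
      key : Φ (suc i) (suc I) + Φ (suc I) (suc i) ≡ g (suc i) (suc I) + g (suc I) (suc i) - (g (suc i) (I ∸ i) + g (I ∸ i) (suc i))
      key = trans (subst (λ N → Φ (suc i) N + Φ N (suc i) ≡ G (suc i) (suc i ℕ.+ N) + G N (suc i ℕ.+ N) - (G (suc i) N + G (I ∸ i) N)) N≡ (off (suc i) (I ∸ i)))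
        (cong₂ (λ a b → g (suc i) (suc I) + G (suc I) a - b) (ℕP.+-comm (suc i) (suc I)) (cong₂ (λ a b → G (suc i) a + G (I ∸ i) b) (sym N≡) (trans (sym N≡) (ℕP.+-comm (suc i) (I ∸ i)))))
    -- The diagonal leaves (n - m) δ(m) instead of n δ(m); the summand m δ(m) in the column sum
    -- makes up the difference, which is why `col` has this form.
    final : ∀ i → δ (suc i) * ((fromℕ n - fromℕ (suc i)) * u (suc i) n) + u (suc i) n * Σ< i (λ j → g (suc j) (i ∸ j)) ≡ fromℕ n * (δ (suc i) * u (suc i) n) + w (suc i) * u (suc i) n
    final i = trans (cong (λ z → δ (suc i) * ((fromℕ n - fromℕ (suc i)) * u (suc i) n) + u (suc i) n * z)
        (trans (Σ<-cong i λ j j<i → cong (λ N → G (suc j) (suc N)) (ℕP.m+[n∸m]≡n (ℕP.<⇒≤ j<i))) (col i)))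
      (RS.solve 5 (λ d N M a w → d RS.:* ((N RS.:- M) RS.:* a) RS.:+ a RS.:* (w RS.:+ M RS.:* d) RS.:= N RS.:* (d RS.:* a) RS.:+ w RS.:* a) refl (δ (suc i)) (fromℕ n) (fromℕ (suc i)) (u (suc i) n) (w (suc i)))

module _ where

  open import Data.Rational using (_*_)

  -- Weights depending on residues modulo 3

  data Residue : Set where
    r₀ r₁ r₂ : Residue

  next : Residue → Residue
  next r₀ = r₁
  next r₁ = r₂
  next r₂ = r₀

  infixr 6 _⊞_
  _⊞_ : Residue → Residue → Residue
  r₀ ⊞ s = s
  r₁ ⊞ s = next s
  r₂ ⊞ s = next (next s)

  res : ℕ → Residue
  res zero    = r₀
  res (suc n) = next (res n)

  next-⊞ : ∀ r s → next r ⊞ s ≡ next (r ⊞ s)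
  next-⊞ r₀ s  = refl
  next-⊞ r₁ s  = refl
  next-⊞ r₂ r₀ = refl
  next-⊞ r₂ r₁ = refl
  next-⊞ r₂ r₂ = refl

  res-+ : ∀ m n → res (m ℕ.+ n) ≡ res m ⊞ res n
  res-+ zero    n = refl
  res-+ (suc m) n = trans (cong next (res-+ m n)) (sym (next-⊞ (res m) (res n)))

  -- With ω a primitive cube root of unity and i√3 = ω - ω², 𝕙(m) = ωᵐ + ω⁻ᵐ and i√3 𝕩(m) = ωᵐ - ω⁻ᵐ.
  𝕩 𝕙 : Residue → ℚ
  𝕩 r₀ = 0ℚ
  𝕩 r₁ = 1ℚ
  𝕩 r₂ = - 1ℚ
  𝕙 r₀ = + 2 / 1
  𝕙 r₁ = - 1ℚ
  𝕙 r₂ = - 1ℚ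

  χ₃-% : ∀ m n → m % 3 ≡ n % 3 → χ₃ m ≡ χ₃ n
  χ₃-% m n eq with m % 3 | n % 3 | eq
  ... | zero              | .zero              | refl = refl
  ... | suc zero          | .(suc zero)        | refl = refl
  ... | suc (suc zero)    | .(suc (suc zero))  | refl = refl
  ... | suc (suc (suc k)) | .(suc (suc (suc k))) | refl = refl

  χ₃-res : ∀ n → χ₃ n ≡ 𝕩 (res n)
  χ₃-res 0 = refl
  χ₃-res 1 = refl
  χ₃-res 2 = refl
  χ₃-res (suc (suc (suc n))) = trans (χ₃-% (3 ℕ.+ n) n (trans (cong (_% 3) (ℕP.+-comm 3 n)) ([m+n]%n≡m%n n 3)))
    (trans (χ₃-res n) (cong 𝕩 (sym (cycle (res n)))))
    where
    cycle : ∀ r → next (next (next r)) ≡ r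
    cycle r₀ = refl
    cycle r₁ = refl
    cycle r₂ = refl

  -- Weights and kernels as syntax for the ring solver

  open RS using (Polynomial; con; var; _:+_; _:*_; _:-_; ⟦_⟧; ⟦_⟧↓; prove)

  data Character : Set where
    𝟏 𝛘 𝐡 : Character

  value : Character → Residue → ℚ
  value 𝟏 _ = 1ℚ
  value 𝛘 r = 𝕩 r
  value 𝐡 r = 𝕙 r

  -- (c , θ , i) stands for the weight c mⁱ θ(m), and term c θ i η j for the kernel c mⁱ θ(m) Nʲ η(N).

  Weight : Set
  Weight = List (ℚ × Character × ℕ)

  data Term : Set where
    term : ℚ → Character → ℕ → Character → ℕ → Term

  Kernel : Set
  Kernel = List Term

  moment : Residue → ℚ → Character → ℕ → ℚ
  moment r m θ zero    = value θ r
  moment r m θ (suc i) = m * moment r m θ i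

  -- The functions with subscript ₚ mirror the evaluated ones as solver expressions. With concrete
  -- residues every character value is a constant, so that only a polynomial in m and N remains.
  momentₚ : ∀ {n} → Residue → Polynomial n → Character → ℕ → Polynomial n
  momentₚ r m θ zero    = con (value θ r)
  momentₚ r m θ (suc i) = m :* momentₚ r m θ i

  weightAt : Weight → Residue → ℚ → ℚ
  weightAt []                r m = 0ℚ
  weightAt ((c , θ , i) ∷ w) r m = c * moment r m θ i + weightAt w r m

  weightₚ : Weight → Residue → ∀ {n} → Polynomial n → Polynomial n
  weightₚ []                r m = con 0ℚ
  weightₚ ((c , θ , i) ∷ w) r m = con c :* momentₚ r m θ i :+ weightₚ w r m

  kernelAt : Kernel → Residue → ℚ → Residue → ℚ → ℚ
  kernelAt []                    r m s N = 0ℚ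
  kernelAt (term c θ i η j ∷ K) r m s N = c * (moment r m θ i * moment s N η j) + kernelAt K r m s N

  kernelₚ : Kernel → ∀ {n} → Residue → Polynomial n → Residue → Polynomial n → Polynomial n
  kernelₚ []                    r m s N = con 0ℚ
  kernelₚ (term c θ i η j ∷ K) r m s N = con c :* (momentₚ r m θ i :* momentₚ s N η j) :+ kernelₚ K r m s N

  -- Σ_{1 ≤ m ≤ n} mⁱ θ(m) for i ≤ 3 (junk for i > 3)
  momentSum : ∀ {n} → Residue → Polynomial n → Character → ℕ → Polynomial n
  momentSum r n 𝟏 0 = n
  momentSum r n 𝟏 1 = con (+ 1 / 2) :* (n :+ n :* n)
  momentSum r n 𝟏 2 = con (+ 1 / 6) :* n :+ con (+ 1 / 2) :* (n :* n) :+ con (+ 1 / 3) :* (n :* (n :* n))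
  momentSum r n 𝟏 3 = con (+ 1 / 4) :* (n :* n) :+ con (+ 1 / 2) :* (n :* (n :* n)) :+ con (+ 1 / 4) :* (n :* (n :* (n :* n)))
  momentSum r n 𝛘 0 = con (+ 1 / 3 + (+ 1 / 2) * 𝕩 r - (+ 1 / 6) * 𝕙 r)
  momentSum r n 𝛘 1 = con ((+ 1 / 3) * 𝕩 r) :+ con ((+ 1 / 2) * 𝕩 r - (+ 1 / 6) * 𝕙 r) :* n
  momentSum r n 𝛘 2 = con ((+ 1 / 9) * 𝕙 r - + 2 / 9) :+ con ((+ 2 / 3) * 𝕩 r) :* n :+ con ((+ 1 / 2) * 𝕩 r - (+ 1 / 6) * 𝕙 r) :* (n :* n)
  momentSum r n 𝛘 3 = con (- (+ 1 / 3) * 𝕩 r) :+ con ((+ 1 / 3) * 𝕙 r) :* n :+ con (𝕩 r) :* (n :* n) :+ con ((+ 1 / 2) * 𝕩 r - (+ 1 / 6) * 𝕙 r) :* (n :* (n :* n))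
  momentSum r n 𝐡 0 = con ((+ 1 / 2) * 𝕩 r + (+ 1 / 2) * 𝕙 r - 1ℚ)
  momentSum r n 𝐡 1 = con ((+ 1 / 3) * 𝕙 r - + 2 / 3) :+ con ((+ 1 / 2) * 𝕩 r + (+ 1 / 2) * 𝕙 r) :* n
  momentSum r n 𝐡 2 = con (- (+ 1 / 3) * 𝕩 r) :+ con ((+ 2 / 3) * 𝕙 r) :* n :+ con ((+ 1 / 2) * 𝕩 r + (+ 1 / 2) * 𝕙 r) :* (n :* n)
  momentSum r n 𝐡 3 = con (+ 2 / 3 - (+ 1 / 3) * 𝕙 r) :- con (𝕩 r) :* n :+ con (𝕙 r) :* (n :* n) :+ con ((+ 1 / 2) * 𝕩 r + (+ 1 / 2) * 𝕙 r) :* (n :* (n :* n))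
  momentSum r n _ _ = con 0ℚ


  sumAt : Kernel → Residue → ℚ → Residue → ℚ → ℚ
  sumAt []                    r n s N = 0ℚ
  sumAt (term c θ i η j ∷ K) r n s N = c * (⟦ momentSum r (var zero) θ i ⟧ (n ∷ []) * moment s N η j) + sumAt K r n s N

  sumₚ : Kernel → ∀ {n} → Residue → Polynomial n → Residue → Polynomial n → Polynomial n
  sumₚ []                    r n s N = con 0ℚ
  sumₚ (term c θ i η j ∷ K) r n s N = con c :* (momentSum r n θ i :* momentₚ s N η j) :+ sumₚ K r n s N

  module _ {n} (ρ : Vec ℚ n) where

    momentₚ-sound : ∀ r (m : Polynomial n) θ i → ⟦ momentₚ r m θ i ⟧ ρ ≡ moment r (⟦ m ⟧ ρ) θ i
    momentₚ-sound r m θ zero    = refl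
    momentₚ-sound r m θ (suc i) = cong (⟦ m ⟧ ρ *_) (momentₚ-sound r m θ i)

    weightₚ-sound : ∀ w r (m : Polynomial n) → ⟦ weightₚ w r m ⟧ ρ ≡ weightAt w r (⟦ m ⟧ ρ)
    weightₚ-sound []                r m = refl
    weightₚ-sound ((c , θ , i) ∷ w) r m = cong₂ (λ a b → c * a + b) (momentₚ-sound r m θ i) (weightₚ-sound w r m)

    kernelₚ-sound : ∀ K r (m : Polynomial n) s N → ⟦ kernelₚ K r m s N ⟧ ρ ≡ kernelAt K r (⟦ m ⟧ ρ) s (⟦ N ⟧ ρ)
    kernelₚ-sound []                    r m s N = refl
    kernelₚ-sound (term c θ i η j ∷ K) r m s N = cong₂ (λ a b → c * a + b) (cong₂ _*_ (momentₚ-sound r m θ i) (momentₚ-sound s N η j)) (kernelₚ-sound K r m s N)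

    momentSum-subst : ∀ r (m : Polynomial n) θ i → ⟦ momentSum r m θ i ⟧ ρ ≡ ⟦ momentSum r (var zero) θ i ⟧ (⟦ m ⟧ ρ ∷ [])
    momentSum-subst r m 𝟏 0 = refl
    momentSum-subst r m 𝟏 1 = refl
    momentSum-subst r m 𝟏 2 = refl
    momentSum-subst r m 𝟏 3 = refl
    momentSum-subst r m 𝟏 (suc (suc (suc (suc i)))) = refl
    momentSum-subst r m 𝛘 0 = refl
    momentSum-subst r m 𝛘 1 = refl
    momentSum-subst r m 𝛘 2 = refl
    momentSum-subst r m 𝛘 3 = refl
    momentSum-subst r m 𝛘 (suc (suc (suc (suc i)))) = refl
    momentSum-subst r m 𝐡 0 = refl
    momentSum-subst r m 𝐡 1 = refl
    momentSum-subst r m 𝐡 2 = refl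
    momentSum-subst r m 𝐡 3 = refl
    momentSum-subst r m 𝐡 (suc (suc (suc (suc i)))) = refl

    sumₚ-sound : ∀ K r (m : Polynomial n) s N → ⟦ sumₚ K r m s N ⟧ ρ ≡ sumAt K r (⟦ m ⟧ ρ) s (⟦ N ⟧ ρ)
    sumₚ-sound []                    r m s N = refl
    sumₚ-sound (term c θ i η j ∷ K) r m s N = cong₂ (λ a b → c * a + b) (cong₂ _*_ (momentSum-subst r m θ i) (momentₚ-sound s N η j)) (sumₚ-sound K r m s N)

  v₀ : ∀ {n} → Polynomial (suc n)
  v₀ = var zero

  v₁ : ∀ {n} → Polynomial (suc (suc n))
  v₁ = var (suc zero)

  -- The hypotheses of `convolution`, as decidable polynomial identities in each residue class;
  -- G is summed over m by telescoping.
  record Certificate (Φ G : Kernel) (δ w : Weight) : Set where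
    field
      off : ∀ r s m k → let t = r ⊞ s in
        ⟦ kernelₚ Φ r v₀ t (v₀ :+ v₁) :+ kernelₚ Φ t (v₀ :+ v₁) r v₀ ⟧↓ (m ∷ k ∷ []) ≡
        ⟦ kernelₚ G r v₀ (r ⊞ t) (v₀ :+ (v₀ :+ v₁)) :+ kernelₚ G t (v₀ :+ v₁) (r ⊞ t) (v₀ :+ (v₀ :+ v₁))
          :- (kernelₚ G r v₀ t (v₀ :+ v₁) :+ kernelₚ G s v₁ t (v₀ :+ v₁)) ⟧↓ (m ∷ k ∷ [])
      diag : ∀ r m →
        ⟦ kernelₚ Φ r v₀ r v₀ ⟧↓ (m ∷ []) ≡ ⟦ kernelₚ G r v₀ (r ⊞ r) (v₀ :+ v₀) :+ v₀ :* weightₚ δ r v₀ ⟧↓ (m ∷ [])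
      -- `start` and `step` justify the closed forms of `momentSum` for exactly those moments that
      -- occur in `G`; no general summation formula is proved.
      start : ∀ s N → ⟦ sumₚ G r₀ (con 0ℚ) s v₀ ⟧↓ (N ∷ []) ≡ ⟦ con {1} 0ℚ ⟧↓ (N ∷ [])
      step : ∀ r s n N →
        ⟦ sumₚ G (next r) (v₀ :+ con 1ℚ) s v₁ ⟧↓ (n ∷ N ∷ []) ≡ ⟦ sumₚ G r v₀ s v₁ :+ kernelₚ G (next r) (v₀ :+ con 1ℚ) s v₁ ⟧↓ (n ∷ N ∷ [])
      close : ∀ r n →
        ⟦ sumₚ G r v₀ (next r) (v₀ :+ con 1ℚ) ⟧↓ (n ∷ []) ≡
        ⟦ weightₚ w (next r) (v₀ :+ con 1ℚ) :+ (v₀ :+ con 1ℚ) :* weightₚ δ (next r) (v₀ :+ con 1ℚ) ⟧↓ (n ∷ [])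

  -- From certificates to identities of series

  momentAt : Character → ℕ → ℕ → ℚ
  momentAt θ i m = moment (res m) (fromℕ m) θ i

  𝓜 : Character → ℕ → Series
  𝓜 θ i = 𝓛 (momentAt θ i)

  linear : Weight → Series
  linear []                = const 0ℚ
  linear ((c , θ , i) ∷ w) = const c · 𝓜 θ i ∔ linear w

  quadratic : Kernel → Series
  quadratic []                    = const 0ℚ
  quadratic (term c θ i η j ∷ K) = const c · (𝓜 θ i · 𝓜 η j) ∔ quadratic K

  linear-𝓛 : ∀ w → 𝓛 (λ m → weightAt w (res m) (fromℕ m)) ≈ linear w
  linear-𝓛 []                = mk≈ λ n → trans (Σ<-zero n λ i _ → ℚP.*-zeroˡ (u (suc i) n)) (sym (const0-at n))
  linear-𝓛 ((c , θ , i) ∷ w) = ≈-trans (𝓛-∔ (λ m → c * momentAt θ i m) (λ m → weightAt w (res m) (fromℕ m))) (∔-cong (𝓛-const-· c (momentAt θ i)) (linear-𝓛 w))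

  quadratic-doubleSum : ∀ K n → quadratic K n ≡ doubleSum n (λ m k → kernelAt K (res m) (fromℕ m) (res k) (fromℕ k))
  quadratic-doubleSum []                    n = trans (const0-at n) (sym (Σ<-zero n λ i _ → Σ<-zero n λ j _ → ℚP.*-zeroˡ ((u (suc i) · u (suc j)) n)))
  quadratic-doubleSum (term c θ i η j ∷ K) n = begin
    (const c · (𝓜 θ i · 𝓜 η j) ∔ quadratic K) n
      ≡⟨ trans (∔-at _ (quadratic K) n) (cong₂ _+_ (≈-trans (≈-sym (·-assoc (const c) (𝓜 θ i) (𝓜 η j))) (·-cong (≈-sym (𝓛-const-· c (momentAt θ i))) ≈-refl) .at n) (quadratic-doubleSum K n)) ⟩
    (𝓛 (λ m → c * momentAt θ i m) · 𝓜 η j) n + doubleSum n (λ m k → kernelAt K (res m) (fromℕ m) (res k) (fromℕ k))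
      ≡⟨ cong (_+ doubleSum n rest) (trans (𝓛-·-𝓛 (λ m → c * momentAt θ i m) (momentAt η j) n) (Σ<-cong n λ a _ → Σ<-cong n λ b _ → cong (_* (u (suc a) · u (suc b)) n) (ℚP.*-assoc c (momentAt θ i (suc a)) (momentAt η j (suc b))))) ⟩
    doubleSum n (λ m k → c * (momentAt θ i m * momentAt η j k)) + doubleSum n rest
      ≡⟨ sym (doubleSum-+ n (λ m k → c * (momentAt θ i m * momentAt η j k)) rest) ⟩
    doubleSum n (λ m k → kernelAt (term c θ i η j ∷ K) (res m) (fromℕ m) (res k) (fromℕ k)) ∎
    where
    rest : ℕ → ℕ → ℚ
    rest m k = kernelAt K (res m) (fromℕ m) (res k) (fromℕ k)

  -- The residue and the value of m + k are those of m and k combined by `⊞` and +, so each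
  -- hypothesis of `convolution` is an instance of a field of the certificate, carried from normal
  -- forms to values by `prove`. The column sums follow by induction from `start` and `step`.
  quadratic-linear : ∀ {Φ G δ w} → Certificate Φ G δ w → quadratic Φ ≈ D (linear δ) ∔ linear w
  quadratic-linear {Φ} {G} {δ} {w} cert = ≈-trans (mk≈ λ n → trans (quadratic-doubleSum Φ n)
      (convolution (eval Φ) (eval G) (λ m → weightAt δ (res m) (fromℕ m)) (λ m → weightAt w (res m) (fromℕ m)) off′ diag′ col n))
    (∔-cong (D-cong (linear-𝓛 δ)) (linear-𝓛 w))
    where
    open Certificate cert
    eval : Kernel → ℕ → ℕ → ℚ
    eval K m k = kernelAt K (res m) (fromℕ m) (res k) (fromℕ k)
    eval-cong : ∀ K {r s m k} a b → res a ≡ r → res b ≡ s → fromℕ a ≡ m → fromℕ b ≡ k → eval K a b ≡ kernelAt K r m s k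
    eval-cong K a b refl refl refl refl = refl
    off′ : ∀ m k → eval Φ m (m ℕ.+ k) + eval Φ (m ℕ.+ k) m ≡
      eval G m (m ℕ.+ (m ℕ.+ k)) + eval G (m ℕ.+ k) (m ℕ.+ (m ℕ.+ k)) - (eval G m (m ℕ.+ k) + eval G k (m ℕ.+ k))
    off′ m k = trans (cong₂ _+_ (trans (eval-cong Φ m N refl rN refl fN) (sym (kernelₚ-sound ρ Φ _ v₀ _ (v₀ :+ v₁)))) (trans (eval-cong Φ N m rN refl fN refl) (sym (kernelₚ-sound ρ Φ _ (v₀ :+ v₁) _ v₀))))
      (trans (prove ρ (kernelₚ Φ r v₀ rs (v₀ :+ v₁) :+ kernelₚ Φ rs (v₀ :+ v₁) r v₀)
        (kernelₚ G r v₀ (r ⊞ rs) (v₀ :+ (v₀ :+ v₁)) :+ kernelₚ G rs (v₀ :+ v₁) (r ⊞ rs) (v₀ :+ (v₀ :+ v₁)) :- (kernelₚ G r v₀ rs (v₀ :+ v₁) :+ kernelₚ G s v₁ rs (v₀ :+ v₁)))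
        (off r s (fromℕ m) (fromℕ k)))
      (sym (cong₂ _-_ (cong₂ _+_ (trans (eval-cong G m M refl rM refl fM) (sym (kernelₚ-sound ρ G _ v₀ _ (v₀ :+ (v₀ :+ v₁))))) (trans (eval-cong G N M rN rM fN fM) (sym (kernelₚ-sound ρ G _ (v₀ :+ v₁) _ (v₀ :+ (v₀ :+ v₁))))))
        (cong₂ _+_ (trans (eval-cong G m N refl rN refl fN) (sym (kernelₚ-sound ρ G _ v₀ _ (v₀ :+ v₁)))) (trans (eval-cong G k N refl rN refl fN) (sym (kernelₚ-sound ρ G _ v₁ _ (v₀ :+ v₁))))))))
      where
      r = res m
      s = res k
      rs = r ⊞ s
      N = m ℕ.+ k
      M = m ℕ.+ (m ℕ.+ k)
      ρ = fromℕ m ∷ fromℕ k ∷ []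
      rN : res N ≡ rs
      rN = res-+ m k
      fN : fromℕ N ≡ fromℕ m + fromℕ k
      fN = fromℕ-homo-+ m k
      rM : res M ≡ r ⊞ rs
      rM = trans (res-+ m N) (cong (r ⊞_) rN)
      fM : fromℕ M ≡ fromℕ m + (fromℕ m + fromℕ k)
      fM = trans (fromℕ-homo-+ m N) (cong (λ z → fromℕ m + z) fN)
    diag′ : ∀ m → eval Φ m m ≡ eval G m (m ℕ.+ m) + fromℕ m * weightAt δ (res m) (fromℕ m)
    diag′ m = trans (sym (kernelₚ-sound ρ Φ _ v₀ _ v₀))
      (trans (prove ρ (kernelₚ Φ r v₀ r v₀) (kernelₚ G r v₀ (r ⊞ r) (v₀ :+ v₀) :+ v₀ :* weightₚ δ r v₀) (diag r (fromℕ m)))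
        (cong₂ _+_ (trans (kernelₚ-sound ρ G _ v₀ _ (v₀ :+ v₀)) (sym (eval-cong G m (m ℕ.+ m) refl (res-+ m m) refl (fromℕ-homo-+ m m)))) (cong (fromℕ m *_) (weightₚ-sound ρ δ _ v₀))))
      where
      r = res m
      ρ = fromℕ m ∷ []
    telescope : ∀ n N → Σ< n (λ i → eval G (suc i) N) ≡ sumAt G (res n) (fromℕ n) (res N) (fromℕ N)
    telescope zero    N = sym (trans (sym (sumₚ-sound ρ G r₀ (con 0ℚ) s v₀)) (prove ρ (sumₚ G r₀ (con 0ℚ) s v₀) (con 0ℚ) (start s (fromℕ N))))
      where
      s = res N
      ρ = fromℕ N ∷ []
    telescope (suc n) N = trans (cong₂ _+_ (telescope n N) (eval-cong G (suc n) N refl refl (fromℕ-suc n) refl))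
      (trans (sym (cong₂ _+_ (sumₚ-sound ρ G r v₀ s v₁) (kernelₚ-sound ρ G (next r) (v₀ :+ con 1ℚ) s v₁)))
      (trans (sym (prove ρ (sumₚ G (next r) (v₀ :+ con 1ℚ) s v₁) (sumₚ G r v₀ s v₁ :+ kernelₚ G (next r) (v₀ :+ con 1ℚ) s v₁) (step r s (fromℕ n) (fromℕ N))))
      (trans (sumₚ-sound ρ G (next r) (v₀ :+ con 1ℚ) s v₁) (cong (λ x → sumAt G (next r) x s (fromℕ N)) (sym (fromℕ-suc n))))))
      where
      r = res n
      s = res N
      ρ = fromℕ n ∷ fromℕ N ∷ []
    col : ∀ N → Σ< N (λ i → eval G (suc i) (suc N)) ≡ weightAt w (res (suc N)) (fromℕ (suc N)) + fromℕ (suc N) * weightAt δ (res (suc N)) (fromℕ (suc N))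
    col N = trans (telescope N (suc N)) (subst (λ x → sumAt G r (fromℕ N) (next r) x ≡ weightAt w (next r) x + x * weightAt δ (next r) x) (sym (fromℕ-suc N))
      (trans (sym (sumₚ-sound ρ G r v₀ (next r) (v₀ :+ con 1ℚ)))
      (trans (prove ρ (sumₚ G r v₀ (next r) (v₀ :+ con 1ℚ)) (weightₚ w (next r) (v₀ :+ con 1ℚ) :+ (v₀ :+ con 1ℚ) :* weightₚ δ (next r) (v₀ :+ con 1ℚ)) (close r (fromℕ N)))
        (cong₂ _+_ (weightₚ-sound ρ w (next r) (v₀ :+ con 1ℚ)) (cong ((fromℕ N + 1ℚ) *_) (weightₚ-sound ρ δ (next r) (v₀ :+ con 1ℚ)))))))
      where
      r = res N
      ρ = fromℕ N ∷ []

-- The five convolution identities and their certificates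

module _ where

  open import Data.Rational using (_*_)

  -- For a² = P. The names give the modular weight; `Φ` and `G` have degree two less in their
  -- arguments, and the coefficients of `G` solve the linear system imposed by `off`. Then `diag`
  -- determines `δ` and `close` determines `w`.
  weight2 : Certificate
    (term (+ 1 / 1) 𝛘 0 𝛘 0 ∷ [])
    (term (+ 2 / 9) 𝟏 0 𝟏 0 ∷ term (- (+ 1 / 9)) 𝟏 0 𝐡 0 ∷ term (- (+ 2 / 3)) 𝛘 0 𝛘 0 ∷ [])
    ([])
    ((+ 2 / 9 , 𝟏 , 1) ∷ (- (+ 1 / 9) , 𝐡 , 1) ∷ (- (+ 1 / 3) , 𝛘 , 0) ∷ [])
  weight2 = record
    { off   = λ { r₀ r₀ _ _ → refl ; r₀ r₁ _ _ → refl ; r₀ r₂ _ _ → refl ; r₁ r₀ _ _ → refl ; r₁ r₁ _ _ → refl ; r₁ r₂ _ _ → refl ; r₂ r₀ _ _ → refl ; r₂ r₁ _ _ → refl ; r₂ r₂ _ _ → refl }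
    ; diag  = λ { r₀ _ → refl ; r₁ _ → refl ; r₂ _ → refl }
    ; start = λ { r₀ _ → refl ; r₁ _ → refl ; r₂ _ → refl }
    ; step  = λ { r₀ r₀ _ _ → refl ; r₀ r₁ _ _ → refl ; r₀ r₂ _ _ → refl ; r₁ r₀ _ _ → refl ; r₁ r₁ _ _ → refl ; r₁ r₂ _ _ → refl ; r₂ r₀ _ _ → refl ; r₂ r₁ _ _ → refl ; r₂ r₂ _ _ → refl }
    ; close = λ { r₀ _ → refl ; r₁ _ → refl ; r₂ _ → refl }
    }

  -- For 3 Da = aZ - e: the only product of two Lambert series in aZ is -18 times this `Φ`.
  weight3 : Certificate
    (term (+ 1 / 1) 𝛘 0 𝐡 1 ∷ [])
    (term (+ 1 / 2) 𝟏 0 𝛘 1 ∷ term (+ 1 / 1) 𝛘 1 𝟏 0 ∷ [])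
    ((- (+ 1 / 1) , 𝛘 , 0) ∷ [])
    ((- (+ 1 / 6) , 𝐡 , 1) ∷ (+ 1 / 3 , 𝛘 , 0) ∷ (+ 1 / 2 , 𝛘 , 2) ∷ [])
  weight3 = record
    { off   = λ { r₀ r₀ _ _ → refl ; r₀ r₁ _ _ → refl ; r₀ r₂ _ _ → refl ; r₁ r₀ _ _ → refl ; r₁ r₁ _ _ → refl ; r₁ r₂ _ _ → refl ; r₂ r₀ _ _ → refl ; r₂ r₁ _ _ → refl ; r₂ r₂ _ _ → refl }
    ; diag  = λ { r₀ _ → refl ; r₁ _ → refl ; r₂ _ → refl }
    ; start = λ { r₀ _ → refl ; r₁ _ → refl ; r₂ _ → refl }
    ; step  = λ { r₀ r₀ _ _ → refl ; r₀ r₁ _ _ → refl ; r₀ r₂ _ _ → refl ; r₁ r₀ _ _ → refl ; r₁ r₁ _ _ → refl ; r₁ r₂ _ _ → refl ; r₂ r₀ _ _ → refl ; r₂ r₁ _ _ → refl ; r₂ r₂ _ _ → refl }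
    ; close = λ { r₀ _ → refl ; r₁ _ → refl ; r₂ _ → refl }
    }

  -- For 3 DZ = Z² - ae: `Φ` is the quadratic part of Z² - ae divided by 9, which explains the 6 in
  -- front of the second term.
  weight4 : Certificate
    (term (+ 1 / 1) 𝐡 1 𝐡 1 ∷ term (+ 6 / 1) 𝛘 0 𝛘 2 ∷ [])
    (term (+ 1 / 4) 𝐡 0 𝐡 2 ∷ term (+ 1 / 2) 𝐡 2 𝐡 0 ∷ term (- (+ 3 / 4)) 𝛘 0 𝛘 2 ∷ term (- (+ 3 / 2)) 𝛘 2 𝛘 0 ∷ [])
    ((- (+ 1 / 1) , 𝐡 , 1) ∷ [])
    ((+ 2 / 3 , 𝐡 , 1) ∷ (+ 2 / 3 , 𝛘 , 0) ∷ (- (+ 1 / 1) , 𝛘 , 2) ∷ [])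
  weight4 = record
    { off   = λ { r₀ r₀ _ _ → refl ; r₀ r₁ _ _ → refl ; r₀ r₂ _ _ → refl ; r₁ r₀ _ _ → refl ; r₁ r₁ _ _ → refl ; r₁ r₂ _ _ → refl ; r₂ r₀ _ _ → refl ; r₂ r₁ _ _ → refl ; r₂ r₂ _ _ → refl }
    ; diag  = λ { r₀ _ → refl ; r₁ _ → refl ; r₂ _ → refl }
    ; start = λ { r₀ _ → refl ; r₁ _ → refl ; r₂ _ → refl }
    ; step  = λ { r₀ r₀ _ _ → refl ; r₀ r₁ _ _ → refl ; r₀ r₂ _ _ → refl ; r₁ r₀ _ _ → refl ; r₁ r₁ _ _ → refl ; r₁ r₂ _ _ → refl ; r₂ r₀ _ _ → refl ; r₂ r₁ _ _ → refl ; r₂ r₂ _ _ → refl }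
    ; close = λ { r₀ _ → refl ; r₁ _ → refl ; r₂ _ → refl }
    }

  -- For De = Ze - C: the quadratic part of Ze is 27 times this `Φ`, and the weight `𝛘 , 4` in the
  -- result is the Lambert series of C.
  weight5 : Certificate
    (term (+ 1 / 1) 𝐡 1 𝛘 2 ∷ [])
    (term (+ 1 / 9) 𝟏 0 𝛘 3 ∷ term (+ 2 / 9) 𝐡 0 𝛘 3 ∷ term (- (+ 1 / 3)) 𝐡 2 𝛘 1 ∷ term (+ 1 / 9) 𝐡 3 𝛘 0 ∷ term (- (+ 1 / 3)) 𝛘 1 𝟏 2 ∷ term (+ 1 / 3) 𝛘 3 𝟏 0 ∷ [])
    ((- (+ 1 / 3) , 𝛘 , 2) ∷ [])
    ((+ 1 / 3 , 𝛘 , 2) ∷ (+ 1 / 9 , 𝐡 , 1) ∷ (+ 1 / 9 , 𝛘 , 4) ∷ [])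
  weight5 = record
    { off   = λ { r₀ r₀ _ _ → refl ; r₀ r₁ _ _ → refl ; r₀ r₂ _ _ → refl ; r₁ r₀ _ _ → refl ; r₁ r₁ _ _ → refl ; r₁ r₂ _ _ → refl ; r₂ r₀ _ _ → refl ; r₂ r₁ _ _ → refl ; r₂ r₂ _ _ → refl }
    ; diag  = λ { r₀ _ → refl ; r₁ _ → refl ; r₂ _ → refl }
    ; start = λ { r₀ _ → refl ; r₁ _ → refl ; r₂ _ → refl }
    ; step  = λ { r₀ r₀ _ _ → refl ; r₀ r₁ _ _ → refl ; r₀ r₂ _ _ → refl ; r₁ r₀ _ _ → refl ; r₁ r₁ _ _ → refl ; r₁ r₂ _ _ → refl ; r₂ r₀ _ _ → refl ; r₂ r₁ _ _ → refl ; r₂ r₂ _ _ → refl }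
    ; close = λ { r₀ _ → refl ; r₁ _ → refl ; r₂ _ → refl }
    }

  -- For C = Pe: the quadratic part of Pe is -36 times this `Φ`. No derivative occurs in this
  -- identity, so `δ` is empty.
  weight5′ : Certificate
    (term (+ 2 / 1) 𝟏 1 𝛘 2 ∷ term (- (+ 1 / 1)) 𝐡 1 𝛘 2 ∷ [])
    (term (- (+ 1 / 4)) 𝟏 0 𝛘 3 ∷ term (+ 1 / 2) 𝟏 2 𝛘 1 ∷ term (+ 1 / 1) 𝐡 1 𝛘 2 ∷ term (- (+ 1 / 1)) 𝐡 2 𝛘 1 ∷ [])
    ([])
    ((+ 2 / 9 , 𝟏 , 1) ∷ (- (+ 1 / 9) , 𝐡 , 1) ∷ (- (+ 1 / 4) , 𝛘 , 2) ∷ (- (+ 1 / 12) , 𝛘 , 4) ∷ [])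
  weight5′ = record
    { off   = λ { r₀ r₀ _ _ → refl ; r₀ r₁ _ _ → refl ; r₀ r₂ _ _ → refl ; r₁ r₀ _ _ → refl ; r₁ r₁ _ _ → refl ; r₁ r₂ _ _ → refl ; r₂ r₀ _ _ → refl ; r₂ r₁ _ _ → refl ; r₂ r₂ _ _ → refl }
    ; diag  = λ { r₀ _ → refl ; r₁ _ → refl ; r₂ _ → refl }
    ; start = λ { r₀ _ → refl ; r₁ _ → refl ; r₂ _ → refl }
    ; step  = λ { r₀ r₀ _ _ → refl ; r₀ r₁ _ _ → refl ; r₀ r₂ _ _ → refl ; r₁ r₀ _ _ → refl ; r₁ r₁ _ _ → refl ; r₁ r₂ _ _ → refl ; r₂ r₀ _ _ → refl ; r₂ r₁ _ _ → refl ; r₂ r₂ _ _ → refl }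
    ; close = λ { r₀ _ → refl ; r₁ _ → refl ; r₂ _ → refl }
    }


  -- The Eisenstein series of level 3

  a₃ P₃ Z₃ e₃ C₃ : Series
  a₃ = const 1ℚ ∔ const (fromℕ 6) · 𝓜 𝛘 0
  P₃ = const 1ℚ ∔ const (fromℕ 4) · (const (fromℕ 2) · 𝓜 𝟏 1 ∔ (⊝ 𝓜 𝐡 1))
  Z₃ = const 1ℚ ∔ const (- fromℕ 3) · 𝓜 𝐡 1
  e₃ = const 1ℚ ∔ const (- fromℕ 9) · 𝓜 𝛘 2
  C₃ = const 1ℚ ∔ const (fromℕ 3) · 𝓜 𝛘 4

  D-affine : ∀ c f → D (const 1ℚ ∔ const c · f) ≈ const c · D f
  D-affine c f = ≈-trans (D-∔ (const 1ℚ) (const c · f)) (≈-trans (∔-cong (D-const 1ℚ) (D-const-· c f)) (∔-identityˡ _))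

  D-single : ∀ c f → D (const c · f ∔ const 0ℚ) ≈ const c · D f
  D-single c f = ≈-trans (D-cong (≈-trans (∔-comm _ (const 0ℚ)) (∔-identityˡ _))) (D-const-· c f)

  -- The solver cannot use an equation f = g as a hypothesis, so the difference f - g is inserted
  -- with a multiplier. In each use the multiplier is the one for which the products of Lambert
  -- series balance.
  by-multiple : ∀ c {f g l r} → f ≈ g → l ≈ r ∔ const c · (f ∔ (⊝ g)) → l ≈ r
  by-multiple c {f} {g} {l} {r} f≈g eq = ≈-trans eq (≈-trans (∔-cong ≈-refl (·-cong ≈-refl (∔-cong f≈g ≈-refl)))
    (SS.solve 3 (λ c g r → r SS.:+ c SS.:* (g SS.:- g) SS.:= r) ≈-refl (const c) g r))

  module Identities where
    open SS using (solve; con; _:+_; _:*_; _:-_; :-_; _:=_)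

    # -# 1/# -1/# : ∀ {n} → ℕ → SS.Polynomial n
    # k    = con (fromℕ k)
    -# k   = con (- fromℕ k)
    1/# k  = con (+ 1 / suc (k ℕ.∸ 1))
    -1/# k = con (- (+ 1 / suc (k ℕ.∸ 1)))

    a₃²≈P₃ : a₃ · a₃ ≈ P₃
    a₃²≈P₃ = by-multiple (fromℕ 36) (≈-trans (quadratic-linear weight2) (∔-cong (D-const 0ℚ) ≈-refl))
      (solve 3 (λ x m h → (# 1 :+ # 6 :* x) :* (# 1 :+ # 6 :* x) :=
        # 1 :+ # 4 :* (# 2 :* m :+ (:- h)) :+ # 36 :* (# 1 :* (x :* x) :+ # 0 :-
          (# 0 :+ (con (+ 2 / 9) :* m :+ (-1/# 9 :* h :+ (-1/# 3 :* x :+ # 0)))))) ≈-refl (𝓜 𝛘 0) (𝓜 𝟏 1) (𝓜 𝐡 1))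

    3Da₃ : const (fromℕ 3) · D a₃ ≈ a₃ · Z₃ ∔ (⊝ e₃)
    3Da₃ = ≈-trans (·-cong ≈-refl (D-affine (fromℕ 6) (𝓜 𝛘 0))) (by-multiple (fromℕ 18) (≈-trans (quadratic-linear weight3) (∔-cong (D-single (- 1ℚ) (𝓜 𝛘 0)) ≈-refl))
      (solve 4 (λ x dx h y → # 3 :* (# 6 :* dx) :=
        (# 1 :+ # 6 :* x) :* (# 1 :+ -# 3 :* h) :+ (:- (# 1 :+ -# 9 :* y)) :+ # 18 :* (# 1 :* (x :* h) :+ # 0 :-
          (-# 1 :* dx :+ (-1/# 6 :* h :+ (1/# 3 :* x :+ (1/# 2 :* y :+ # 0)))))) ≈-refl (𝓜 𝛘 0) (D (𝓜 𝛘 0)) (𝓜 𝐡 1) (𝓜 𝛘 2)))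

    3DZ₃ : const (fromℕ 3) · D Z₃ ≈ Z₃ · Z₃ ∔ (⊝ (a₃ · e₃))
    3DZ₃ = ≈-trans (·-cong ≈-refl (D-affine (- fromℕ 3) (𝓜 𝐡 1))) (by-multiple (- fromℕ 9) (≈-trans (quadratic-linear weight4) (∔-cong (D-single (- 1ℚ) (𝓜 𝐡 1)) ≈-refl))
      (solve 4 (λ x h dh y → # 3 :* (-# 3 :* dh) :=
        (# 1 :+ -# 3 :* h) :* (# 1 :+ -# 3 :* h) :+ (:- ((# 1 :+ # 6 :* x) :* (# 1 :+ -# 9 :* y))) :+ -# 9 :* (# 1 :* (h :* h) :+ (# 6 :* (x :* y) :+ # 0) :-
          (-# 1 :* dh :+ (con (+ 2 / 3) :* h :+ (con (+ 2 / 3) :* x :+ (-# 1 :* y :+ # 0)))))) ≈-refl (𝓜 𝛘 0) (𝓜 𝐡 1) (D (𝓜 𝐡 1)) (𝓜 𝛘 2)))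

    De₃ : D e₃ ≈ Z₃ · e₃ ∔ (⊝ C₃)
    De₃ = ≈-trans (D-affine (- fromℕ 9) (𝓜 𝛘 2)) (by-multiple (- fromℕ 27) (≈-trans (quadratic-linear weight5) (∔-cong (D-single (- (+ 1 / 3)) (𝓜 𝛘 2)) ≈-refl))
      (solve 4 (λ h y dy z → -# 9 :* dy :=
        (# 1 :+ -# 3 :* h) :* (# 1 :+ -# 9 :* y) :+ (:- (# 1 :+ # 3 :* z)) :+ -# 27 :* (# 1 :* (h :* y) :+ # 0 :-
          (-1/# 3 :* dy :+ (1/# 3 :* y :+ (1/# 9 :* h :+ (1/# 9 :* z :+ # 0)))))) ≈-refl (𝓜 𝐡 1) (𝓜 𝛘 2) (D (𝓜 𝛘 2)) (𝓜 𝛘 4)))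

    C₃≈P₃e₃ : C₃ ≈ P₃ · e₃
    C₃≈P₃e₃ = by-multiple (fromℕ 36) (≈-trans (quadratic-linear weight5′) (∔-cong (D-const 0ℚ) ≈-refl))
      (solve 4 (λ m h y z → # 1 :+ # 3 :* z :=
        (# 1 :+ # 4 :* (# 2 :* m :+ (:- h))) :* (# 1 :+ -# 9 :* y) :+ # 36 :* (# 2 :* (m :* y) :+ (-# 1 :* (h :* y) :+ # 0) :-
          (# 0 :+ (con (+ 2 / 9) :* m :+ (-1/# 9 :* h :+ (-1/# 4 :* y :+ (-1/# 12 :* z :+ # 0))))))) ≈-refl (𝓜 𝟏 1) (𝓜 𝐡 1) (𝓜 𝛘 2) (𝓜 𝛘 4))

  open Identities using (a₃²≈P₃; 3Da₃; 3DZ₃; De₃; C₃≈P₃e₃) public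

module _ where

  open import Data.Rational using (_*_)

  -- The given series C and t

  -- The summand of divisorSum is local to its definition, so its name is inferred from the use.
  mutual
    divisorSum-𝓛 : ∀ n g → divisorSum n g ≡ 𝓛 g n
    divisorSum-𝓛 zero    g = refl
    divisorSum-𝓛 (suc n) g = Σ<-cong (suc n) (λ i _ → divisorTerm n g i)

    divisorTerm : ∀ n (g : ℕ → ℚ) i → _ ≡ g (suc i) * u (suc i) (suc n)
    divisorTerm n g i with suc i ∣? suc n
    ... | yes _ = sym (ℚP.*-identityʳ (g (suc i)))
    ... | no _  = sym (ℚP.*-zeroʳ (g (suc i)))

  C≈C₃ : C ≈ C₃
  C≈C₃ .at zero    = sym (trans (∔-at (const 1ℚ) _ 0) (cong (λ z → 1ℚ + z) (trans (const-·-at (fromℕ 3) (𝓜 𝛘 4) 0) refl)))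
  C≈C₃ .at (suc n) = sym (trans (∔-at (const 1ℚ) _ (suc n)) (trans (ℚP.+-identityˡ _) (trans (const-·-at (fromℕ 3) (𝓜 𝛘 4) (suc n))
    (cong (fromℕ 3 *_) (trans (𝓛-cong {momentAt 𝛘 4} {λ d → χ₃ d * (fromℕ d ^ℚ 4)} weights .at (suc n)) (sym (divisorSum-𝓛 (suc n) (λ d → χ₃ d * (fromℕ d ^ℚ 4)))))))))
    where
    weights : ∀ m → momentAt 𝛘 4 (suc m) ≡ χ₃ (suc m) * (fromℕ (suc m) ^ℚ 4)
    weights m = trans (RS.solve 2 (λ m x → m RS.:* (m RS.:* (m RS.:* (m RS.:* x))) RS.:= x RS.:* (m RS.:* (m RS.:* (m RS.:* (m RS.:* RS.con 1ℚ))))) refl (fromℕ (suc m)) (𝕩 (res (suc m))))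
      (cong (_* (fromℕ (suc m) ^ℚ 4)) (sym (χ₃-res (suc m))))

  -- Logarithmic derivatives and the infinite product t

  D-inv : ∀ {f g} → f 0 ≡ 1ℚ → D f ≈ f · g → D (inv f) ≈ inv f · (⊝ g)
  D-inv {f} {g} f0 eq = ·-cancelˡ f f0 (≈-trans (SS.solve 2 (λ a b → a SS.:= (b SS.:+ a) SS.:- b) ≈-refl (f · D (inv f)) (D f · inv f))
    (≈-trans (∔-cong (≈-trans (≈-sym (D-· f (inv f))) (≈-trans (D-cong (inv-right f f0)) (D-const 1ℚ))) (⊝-cong (·-cong eq ≈-refl)))
      (SS.solve 3 (λ f i g → SS.con 0ℚ SS.:- (f SS.:* g) SS.:* i SS.:= f SS.:* (i SS.:* (SS.:- g))) ≈-refl f (inv f) g)))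

  D-·-log : ∀ {f g φ ψ} → D f ≈ f · φ → D g ≈ g · ψ → D (f · g) ≈ (f · g) · (φ ∔ ψ)
  D-·-log {f} {g} {φ} {ψ} p q = ≈-trans (D-· f g) (≈-trans (∔-cong (·-cong p ≈-refl) (·-cong ≈-refl q))
    (SS.solve 4 (λ f g a b → (f SS.:* a) SS.:* g SS.:+ f SS.:* (g SS.:* b) SS.:= (f SS.:* g) SS.:* (a SS.:+ b)) ≈-refl f g φ ψ))

  1-q^≈ : ∀ m → one ⊖ qPow m ≈ 1-q^ m
  1-q^≈ m = ⊖≈ one≈const ≈-refl

  D-1-q^ : ∀ m → D (1-q^ (suc m)) ≈ 1-q^ (suc m) · (const (- fromℕ (suc m)) · u (suc m))
  D-1-q^ m = ≈-trans (D-∔ (const 1ℚ) _) (≈-trans (∔-cong (D-const 1ℚ) (≈-trans (D-⊝ (qPow (suc m))) (⊝-cong (≈-trans (D-qPow (suc m)) (·-cong ≈-refl (≈-sym (u-geometric m)))))))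
    (≈-trans (SS.solve 3 (λ n e u → SS.con 0ℚ SS.:- n SS.:* (e SS.:* u) SS.:= e SS.:* ((SS.:- n) SS.:* u)) ≈-refl (const (fromℕ (suc m))) (1-q^ (suc m)) (u (suc m)))
      (·-cong ≈-refl (·-cong (≈-sym (const-neg (fromℕ (suc m)))) ≈-refl))))

  tFactorLog : ℕ → Series
  tFactorLog m = const (fromℕ 12) · (const (- fromℕ (3 ℕ.* m)) · u (3 ℕ.* m)) ∔ const (fromℕ 12) · (⊝ (const (- fromℕ m) · u m))

  tFactor≈ : ∀ m → tFactor m ≈ 1-q^ (3 ℕ.* m) ↑ 12 · inv (one ⊖ qPow m) ↑ 12
  tFactor≈ m = ⊗≈· (pow≈↑ 12 (1-q^≈ (3 ℕ.* m))) (pow≈↑ 12 ≈-refl)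

  D-tFactor : ∀ m → D (tFactor (suc m)) ≈ tFactor (suc m) · tFactorLog (suc m)
  D-tFactor m = ≈-trans (D-cong (tFactor≈ (suc m))) (≈-trans
    (D-·-log (≈-trans (D-↑-log 12 (D-1-q^ (m ℕ.+ 2 ℕ.* suc m))) (·-comm _ _))
      (≈-trans (D-↑-log 12 (D-inv (trans (1-q^≈ (suc m) .at 0) (1-q^-at-0 m)) (≈-trans (D-cong (1-q^≈ (suc m))) (≈-trans (D-1-q^ m) (·-cong (≈-sym (1-q^≈ (suc m))) ≈-refl))))) (·-comm _ _)))
    (·-cong (≈-sym (tFactor≈ (suc m))) ≈-refl))

  -- The relation f = 1 + O(q^k), which controls when a partial product becomes stationary in a
  -- given degree.
  record UnitMod (k : ℕ) (f : Series) : Set where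
    constructor unitMod
    field agree : ∀ i → i < k → f i ≡ const 1ℚ i
  open UnitMod

  UnitMod-cong : ∀ {k f g} → f ≈ g → UnitMod k g → UnitMod k f
  UnitMod-cong p a .agree i i<k = trans (p .at i) (a .agree i i<k)

  UnitMod-·-at : ∀ {k f} g → UnitMod k f → ∀ i → i < k → (f · g) i ≡ g i
  UnitMod-·-at {k} {f} g a i i<k = trans (·-cong≤ {g = g} i (λ j j≤i → a .agree j (ℕP.≤-<-trans j≤i i<k)) (λ _ _ → refl)) (one-· g .at i)

  UnitMod-· : ∀ {k f g} → UnitMod k f → UnitMod k g → UnitMod k (f · g)
  UnitMod-· {g = g} a b .agree i i<k = trans (UnitMod-·-at g a i i<k) (b .agree i i<k)

  UnitMod-↑ : ∀ {k f} n → UnitMod k f → UnitMod k (f ↑ n)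
  UnitMod-↑ zero    a = unitMod λ _ _ → refl
  UnitMod-↑ (suc n) a = UnitMod-· a (UnitMod-↑ n a)

  UnitMod-inv : ∀ {k f} → f 0 ≡ 1ℚ → UnitMod k f → UnitMod k (inv f)
  UnitMod-inv {f = f} f0 a .agree i i<k = trans (sym (UnitMod-·-at (inv f) a i i<k)) (inv-right f f0 .at i)

  UnitMod-1-q^ : ∀ {k} m → k ≤ m → UnitMod k (1-q^ m)
  UnitMod-1-q^ m k≤m .agree i i<k = trans (∔-at (const 1ℚ) _ i) (trans (cong (λ z → const 1ℚ i + z) (trans (⊝-at (qPow m) i) (cong -_ (qPow-off m i (ℕP.>⇒≢ (ℕP.<-≤-trans i<k k≤m)))))) (ℚP.+-identityʳ _))

  UnitMod-tFactor : ∀ m → UnitMod (suc m) (tFactor (suc m))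
  UnitMod-tFactor m = UnitMod-cong (tFactor≈ (suc m)) (UnitMod-· (UnitMod-↑ 12 (UnitMod-1-q^ (3 ℕ.* suc m) (ℕP.m≤m+n (suc m) _)))
    (UnitMod-↑ 12 (UnitMod-inv (trans (1-q^≈ (suc m) .at 0) (1-q^-at-0 m)) (UnitMod-cong (1-q^≈ (suc m)) (UnitMod-1-q^ (suc m) ℕP.≤-refl)))))

  finProd-suc : ∀ N → finProd tFactor (suc N) ≈ finProd tFactor N · tFactor (suc N)
  finProd-suc N = ⊗≈· ≈-refl ≈-refl

  -- Factors beyond the n-th are 1 + O(q^(n+1)). Hence all coefficients up to n of `infProd`, each
  -- of which comes from a different finite product, can be read off a single one.
  finProd-stable : ∀ k n {i} → i ≤ n → finProd tFactor (k ℕ.+ n) i ≡ finProd tFactor n i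
  finProd-stable zero    n i≤n = refl
  finProd-stable (suc k) n {i} i≤n = trans (finProd-suc (k ℕ.+ n) .at i) (trans (·-comm-at i (finProd tFactor (k ℕ.+ n)) (tFactor (suc (k ℕ.+ n))))
    (trans (UnitMod-·-at (finProd tFactor (k ℕ.+ n)) (UnitMod-tFactor (k ℕ.+ n)) i (s≤s (ℕP.≤-trans i≤n (ℕP.m≤n+m n k)))) (finProd-stable k n i≤n)))

  s₃ : Series
  s₃ = infProd tFactor

  s₃-finProd : ∀ {i n} → i ≤ n → s₃ i ≡ finProd tFactor n i
  s₃-finProd {i} {n} i≤n = trans (sym (finProd-stable (n ∸ i) i ℕP.≤-refl)) (cong (λ k → finProd tFactor k i) (ℕP.m∸n+n≡m i≤n))

  logSum : ℕ → Series
  logSum zero    = const 0ℚ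
  logSum (suc N) = logSum N ∔ tFactorLog (suc N)

  D-finProd : ∀ N → D (finProd tFactor N) ≈ finProd tFactor N · logSum N
  D-finProd zero    = ≈-trans (D-cong one≈const) (≈-trans (D-const 1ℚ) (≈-trans (SS.solve 0 (SS.con 0ℚ SS.:= SS.con 1ℚ SS.:* SS.con 0ℚ) ≈-refl) (·-cong (≈-sym one≈const) ≈-refl)))
  D-finProd (suc N) = ≈-trans (D-cong (finProd-suc N)) (≈-trans (D-·-log (D-finProd N) (D-tFactor N)) (·-cong (≈-sym (finProd-suc N)) ≈-refl))

  -- The function 1 + 𝕙 is three times the indicator of the multiples of 3.
  Σ<-multiples : ∀ n (f : ℕ → ℚ) → Σ< n (λ i → fromℕ 3 * f (3 ℕ.* suc i)) ≡ Σ< (n ℕ.* 3) (λ i → (1ℚ + 𝕙 (res (suc i))) * f (suc i))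
  Σ<-multiples zero    f = refl
  Σ<-multiples (suc n) f = trans (cong₂ _+_ (Σ<-multiples n f) (cong (λ k → fromℕ 3 * f k) (ℕP.*-comm 3 (suc n))))
    (trans (RS.solve 4 (λ a x y z → a RS.:+ RS.con (fromℕ 3) RS.:* z RS.:= ((a RS.:+ RS.con 0ℚ RS.:* x) RS.:+ RS.con 0ℚ RS.:* y) RS.:+ RS.con (fromℕ 3) RS.:* z) refl (Σ< (n ℕ.* 3) _) (f (suc (n ℕ.* 3))) (f (2 ℕ.+ n ℕ.* 3)) (f (3 ℕ.+ n ℕ.* 3)))
      (cong (λ r → ((Σ< (n ℕ.* 3) _ + (1ℚ + 𝕙 (next r)) * f (suc (n ℕ.* 3))) + (1ℚ + 𝕙 (next (next r))) * f (2 ℕ.+ n ℕ.* 3)) + (1ℚ + 𝕙 (next (next (next r)))) * f (3 ℕ.+ n ℕ.* 3)) (sym (res-*3 n))))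
    where
    res-*3 : ∀ n → res (n ℕ.* 3) ≡ r₀
    res-*3 zero    = refl
    res-*3 (suc n) = cong (λ r → next (next (next r))) (res-*3 n)

  Σ<-multiples-truncated : ∀ n (f : ℕ → ℚ) → (∀ j → n < j → f j ≡ 0ℚ) → Σ< n (λ i → fromℕ 3 * f (3 ℕ.* suc i)) ≡ Σ< n (λ i → (1ℚ + 𝕙 (res (suc i))) * f (suc i))
  Σ<-multiples-truncated n f z = trans (Σ<-multiples n f) (Σ<-truncate _ (ℕP.m≤m*n n 3) (λ j n≤j → trans (cong ((1ℚ + 𝕙 (res (suc j))) *_) (z (suc j) (s≤s n≤j))) (ℚP.*-zeroʳ (1ℚ + 𝕙 (res (suc j))))))

  -- This is 12 m for m prime to 3 and 0 otherwise, since 2 - 𝕙 takes the values 3 and 0.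
  wP : ℕ → ℚ
  wP m = fromℕ 4 * (fromℕ 2 * momentAt 𝟏 1 m + - 1ℚ * momentAt 𝐡 1 m)

  P₃≈𝓛 : P₃ ≈ const 1ℚ ∔ 𝓛 wP
  P₃≈𝓛 = ∔-cong ≈-refl (≈-sym (≈-trans (𝓛-const-· (fromℕ 4) (λ m → fromℕ 2 * momentAt 𝟏 1 m + - 1ℚ * momentAt 𝐡 1 m))
    (·-cong ≈-refl (≈-trans (𝓛-∔ (λ m → fromℕ 2 * momentAt 𝟏 1 m) (λ m → - 1ℚ * momentAt 𝐡 1 m))
      (∔-cong (𝓛-const-· (fromℕ 2) (momentAt 𝟏 1)) (≈-trans (𝓛-const-· (- 1ℚ) (momentAt 𝐡 1)) (SS.solve 1 (λ x → SS.con (- 1ℚ) SS.:* x SS.:= SS.:- x) ≈-refl (𝓜 𝐡 1))))))))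

  logSum-at : ∀ N i → logSum N i ≡ Σ< N (λ m → fromℕ 12 * (fromℕ (suc m) * u (suc m) i) + - fromℕ 4 * (fromℕ 3 * (fromℕ (3 ℕ.* suc m) * u (3 ℕ.* suc m) i)))
  logSum-at zero    i = const0-at i
  logSum-at (suc N) i = trans (∔-at (logSum N) (tFactorLog (suc N)) i) (cong₂ _+_ (logSum-at N i) (begin
    tFactorLog (suc N) i
      ≡⟨ SS.solve 4 (λ m v k w → SS.con (fromℕ 12) SS.:* (k SS.:* w) SS.:+ SS.con (fromℕ 12) SS.:* (SS.:- (m SS.:* v)) SS.:= SS.con (fromℕ 12) SS.:* (SS.con (- 1ℚ) SS.:* (m SS.:* v)) SS.:+ SS.con (fromℕ 12) SS.:* (k SS.:* w)) ≈-refl (const (- M)) (u (suc N)) (const (- K)) (u (3 ℕ.* suc N)) .at i ⟩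
    (const (fromℕ 12) · (const (- 1ℚ) · (const (- M) · u (suc N))) ∔ const (fromℕ 12) · (const (- K) · u (3 ℕ.* suc N))) i
      ≡⟨ trans (∔-at _ _ i) (cong₂ _+_ (trans (const-·-at (fromℕ 12) _ i) (cong (fromℕ 12 *_) (trans (const-·-at (- 1ℚ) _ i) (cong (- 1ℚ *_) (const-·-at (- M) (u (suc N)) i)))))
           (trans (const-·-at (fromℕ 12) _ i) (cong (fromℕ 12 *_) (const-·-at (- K) (u (3 ℕ.* suc N)) i)))) ⟩
    fromℕ 12 * (- 1ℚ * (- M * u (suc N) i)) + fromℕ 12 * (- K * u (3 ℕ.* suc N) i)
      ≡⟨ RS.solve 4 (λ M v K w → RS.con (fromℕ 12) RS.:* (RS.con (- 1ℚ) RS.:* ((RS.:- M) RS.:* v)) RS.:+ RS.con (fromℕ 12) RS.:* ((RS.:- K) RS.:* w) RS.:= RS.con (fromℕ 12) RS.:* (M RS.:* v) RS.:+ RS.con (- fromℕ 4) RS.:* (RS.con (fromℕ 3) RS.:* (K RS.:* w))) refl M (u (suc N) i) K (u (3 ℕ.* suc N) i) ⟩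
    fromℕ 12 * (M * u (suc N) i) + - fromℕ 4 * (fromℕ 3 * (K * u (3 ℕ.* suc N) i)) ∎))
    where
    M = fromℕ (suc N)
    K = fromℕ (3 ℕ.* suc N)

  -- The numerator of t contributes -12 (3m) u_(3m), and `Σ<-multiples-truncated` turns the sum of
  -- these into one with weights -4 (1 + 𝕙(m)) m. Together with 12 m from the denominator this is 4
  -- (2 - 𝕙(m)) m.
  logSum-𝓛 : ∀ {n i} → i ≤ n → logSum n i ≡ 𝓛 wP i
  logSum-𝓛 {n} {i} i≤n = begin
    logSum n i
      ≡⟨ trans (logSum-at n i) (trans (Σ<-+ n _ _) (cong₂ _+_ (refl {x = Σ< n A₁}) (Σ<-*ˡ n (- fromℕ 4) _))) ⟩
    Σ< n A₁ + - fromℕ 4 * Σ< n (λ m → fromℕ 3 * (fromℕ (3 ℕ.* suc m) * u (3 ℕ.* suc m) i))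
      ≡⟨ cong (λ z → Σ< n A₁ + - fromℕ 4 * z) (Σ<-multiples-truncated n (λ k → fromℕ k * u k i) (λ j n<j → trans (cong (fromℕ j *_) (u-< (ℕP.≤-<-trans i≤n n<j))) (ℚP.*-zeroʳ (fromℕ j)))) ⟩
    Σ< n A₁ + - fromℕ 4 * Σ< n (λ m → (1ℚ + 𝕙 (res (suc m))) * (fromℕ (suc m) * u (suc m) i))
      ≡⟨ trans (cong (λ z → Σ< n A₁ + z) (sym (Σ<-*ˡ n (- fromℕ 4) _))) (sym (Σ<-+ n _ _)) ⟩
    Σ< n (λ m → A₁ m + - fromℕ 4 * ((1ℚ + 𝕙 (res (suc m))) * (fromℕ (suc m) * u (suc m) i)))
      ≡⟨ Σ<-cong n (λ m _ → RS.solve 3 (λ M h v → RS.con (fromℕ 12) RS.:* (M RS.:* v) RS.:+ RS.con (- fromℕ 4) RS.:* ((RS.con 1ℚ RS.:+ h) RS.:* (M RS.:* v)) RS.:= (RS.con (fromℕ 4) RS.:* (RS.con (fromℕ 2) RS.:* (M RS.:* RS.con 1ℚ) RS.:+ RS.con (- 1ℚ) RS.:* (M RS.:* h))) RS.:* v) refl (fromℕ (suc m)) (𝕙 (res (suc m))) (u (suc m) i)) ⟩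
    Σ< n (λ m → wP (suc m) * u (suc m) i)
      ≡⟨ sym (𝓛-truncate wP i≤n) ⟩
    𝓛 wP i ∎
    where
    A₁ : ℕ → ℚ
    A₁ m = fromℕ 12 * (fromℕ (suc m) * u (suc m) i)

  D-s₃ : D s₃ ≈ s₃ · 𝓛 wP
  D-s₃ .at n = trans (D-at s₃ n) (trans (sym (D-at (finProd tFactor n) n)) (trans (D-finProd n .at n)
    (·-cong≤ n (λ i i≤n → sym (s₃-finProd i≤n)) (λ i i≤n → logSum-𝓛 i≤n))))

  s₃-at-0 : s₃ 0 ≡ 1ℚ
  s₃-at-0 = refl

  t≈q·s₃ : t ≈ qPow 1 · s₃
  t≈q·s₃ = ⊗≈· ≈-refl ≈-refl

  t-at-0 : t 0 ≡ 0ℚ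
  t-at-0 = trans (t≈q·s₃ .at 0) (qPow-·-< 1 s₃ 0 (s≤s z≤n))

  D-t : D t ≈ t · P₃
  D-t = ≈-trans (D-cong t≈q·s₃) (≈-trans (D-·-log (D-qPow 1 ⟨≈⟩ ·-comm _ _) D-s₃) (·-cong (≈-sym t≈q·s₃) (≈-sym P₃≈𝓛)))
    where _⟨≈⟩_ = ≈-trans

  -- The hypergeometric parametrisation

  ·-at-1 : ∀ f g → (f · g) 1 ≡ f 0 * g 1 + f 1 * g 0
  ·-at-1 f g = trans (·-suc f g 0) (cong (λ z → f 0 * g 1 + z) (·-at-0 (tail f) g))

  affine-at-0 : ∀ c f → f 0 ≡ 0ℚ → (const 1ℚ ∔ const c · f) 0 ≡ 1ℚ
  affine-at-0 c f f0 = trans (∔-at (const 1ℚ) _ 0) (cong (λ z → 1ℚ + z) (trans (const-·-at c f 0) (trans (cong (c *_) f0) (ℚP.*-zeroʳ c))))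

  affine-at-1 : ∀ c f → (const 1ℚ ∔ const c · f) 1 ≡ c * f 1
  affine-at-1 c f = trans (∔-at (const 1ℚ) _ 1) (trans (ℚP.+-identityˡ _) (const-·-at c f 1))

  a₃-at-0 : a₃ 0 ≡ 1ℚ
  a₃-at-0 = affine-at-0 (fromℕ 6) (𝓜 𝛘 0) refl

  Z₃-at-0 : Z₃ 0 ≡ 1ℚ
  Z₃-at-0 = affine-at-0 (- fromℕ 3) (𝓜 𝐡 1) refl

  e₃-at-0 : e₃ 0 ≡ 1ℚ
  e₃-at-0 = affine-at-0 (- fromℕ 9) (𝓜 𝛘 2) refl

  P₃-at-0 : P₃ 0 ≡ 1ℚ
  P₃-at-0 = trans (sym (a₃²≈P₃ .at 0)) (trans (·-at-0 a₃ a₃) (cong₂ _*_ a₃-at-0 a₃-at-0))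

  equal-difference : ∀ {f g} → f ≈ g → f ∔ (⊝ g) ≈ const 0ℚ
  equal-difference {f} {g} p = ≈-trans (∔-cong p ≈-refl) (SS.solve 1 (λ g → g SS.:- g SS.:= SS.con 0ℚ) ≈-refl g)

  -- By Borwein's identity a³ = b³ + c³ this is c³.
  y₃ : Series
  y₃ = a₃ · (a₃ · a₃) ∔ (⊝ e₃)

  -- Since C = Pe = a² e, the inhomogeneous term of `De₃` is itself a multiple of e, so e acquires a
  -- logarithmic derivative.
  De₃-log : D e₃ ≈ (Z₃ ∔ (⊝ (a₃ · a₃))) · e₃
  De₃-log = ≈-trans De₃ (≈-trans (∔-cong ≈-refl (⊝-cong (≈-trans C₃≈P₃e₃ (·-cong (≈-sym a₃²≈P₃) ≈-refl))))
    (SS.solve 3 (λ a z e → z SS.:* e SS.:- (a SS.:* a) SS.:* e SS.:= (z SS.:- a SS.:* a) SS.:* e) ≈-refl a₃ Z₃ e₃))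

  -- In 3 a² Da - De = a² (aZ - e) - (Z - a²) e the two terms a² e cancel.
  Dy₃ : D y₃ ≈ Z₃ · y₃
  Dy₃ = ≈-trans (D-∔ (a₃ · (a₃ · a₃)) (⊝ e₃)) (≈-trans (∔-cong (≈-trans (D-· a₃ (a₃ · a₃)) (∔-cong ≈-refl (·-cong ≈-refl (D-· a₃ a₃)))) (≈-trans (D-⊝ e₃) (⊝-cong De₃-log)))
    (≈-trans (SS.solve 4 (λ a d z e → d SS.:* (a SS.:* a) SS.:+ a SS.:* (d SS.:* a SS.:+ a SS.:* d) SS.:- (z SS.:- a SS.:* a) SS.:* e SS.:= (a SS.:* a) SS.:* (SS.con (fromℕ 3) SS.:* d) SS.:- (z SS.:- a SS.:* a) SS.:* e) ≈-refl a₃ (D a₃) Z₃ e₃)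
    (≈-trans (∔-cong (·-cong ≈-refl 3Da₃) ≈-refl)
      (SS.solve 3 (λ a z e → (a SS.:* a) SS.:* (a SS.:* z SS.:- e) SS.:- (z SS.:- a SS.:* a) SS.:* e SS.:= z SS.:* (a SS.:* (a SS.:* a) SS.:- e)) ≈-refl a₃ Z₃ e₃))))

  q-cancel : ∀ {f g} → qPow 1 · f ≈ qPow 1 · g → f ≈ g
  q-cancel {f} {g} p .at n = trans (sym (qPow-·-+ 1 f n)) (trans (p .at (suc n)) (qPow-·-+ 1 g n))

  D-q· : ∀ f → D (qPow 1 · f) ≈ qPow 1 · (f ∔ D f)
  D-q· f = ≈-trans (D-· (qPow 1) f) (≈-trans (∔-cong (·-cong (D-qPow 1) ≈-refl) ≈-refl)
    (SS.solve 3 (λ q f d → (SS.con 1ℚ SS.:* q) SS.:* f SS.:+ q SS.:* d SS.:= q SS.:* (f SS.:+ d)) ≈-refl (qPow 1) f (D f)))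

  -- Both sides are q times a solution of D f = (Z - 1) f.
  y₃≈27te : y₃ ≈ const (fromℕ 27) · (t · e₃)
  y₃≈27te = ≈-trans y≈qy′ (≈-trans (·-cong ≈-refl (ode-unique (Z₃ ∔ (⊝ const 1ℚ)) (tail y₃) (const (fromℕ 27) · (s₃ · e₃)) (sub1-at-0 Z₃ Z₃-at-0) start Dy′ Dse))
    (≈-trans (SS.solve 3 (λ q s e → q SS.:* (SS.con (fromℕ 27) SS.:* (s SS.:* e)) SS.:= SS.con (fromℕ 27) SS.:* ((q SS.:* s) SS.:* e)) ≈-refl (qPow 1) s₃ e₃)
      (·-cong ≈-refl (·-cong (≈-sym t≈q·s₃) ≈-refl))))
    where
    y0 : y₃ 0 ≡ 0ℚ
    y0 = trans (∔-at _ (⊝ e₃) 0) (cong₂ _+_ (trans (·-at-0 a₃ (a₃ · a₃)) (cong₂ _*_ a₃-at-0 (trans (·-at-0 a₃ a₃) (cong₂ _*_ a₃-at-0 a₃-at-0)))) (trans (⊝-at e₃ 0) (cong -_ e₃-at-0)))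
    y≈qy′ : y₃ ≈ qPow 1 · tail y₃
    y≈qy′ = qPow-unique 1 (λ { zero _ → y0 ; (suc n) (s≤s ()) }) (λ n → refl)
    Dy′ : D (tail y₃) ≈ (Z₃ ∔ (⊝ const 1ℚ)) · tail y₃
    Dy′ = ≈-trans (SS.solve 2 (λ y d → d SS.:= (y SS.:+ d) SS.:- y) ≈-refl (tail y₃) (D (tail y₃)))
      (≈-trans (∔-cong (q-cancel (≈-trans (≈-sym (D-q· (tail y₃))) (≈-trans (D-cong (≈-sym y≈qy′)) (≈-trans Dy₃ (≈-trans (·-cong ≈-refl y≈qy′)
          (SS.solve 3 (λ z q y → z SS.:* (q SS.:* y) SS.:= q SS.:* (z SS.:* y)) ≈-refl Z₃ (qPow 1) (tail y₃))))))) ≈-refl)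
        (SS.solve 2 (λ z y → z SS.:* y SS.:- y SS.:= (z SS.:- SS.con 1ℚ) SS.:* y) ≈-refl Z₃ (tail y₃)))
    wP≈ : 𝓛 wP ≈ a₃ · a₃ ∔ (⊝ const 1ℚ)
    wP≈ = ≈-trans (SS.solve 1 (λ w → w SS.:= (SS.con 1ℚ SS.:+ w) SS.:- SS.con 1ℚ) ≈-refl (𝓛 wP)) (∔-cong (≈-trans (≈-sym P₃≈𝓛) (≈-sym a₃²≈P₃)) ≈-refl)
    Dse : D (const (fromℕ 27) · (s₃ · e₃)) ≈ (Z₃ ∔ (⊝ const 1ℚ)) · (const (fromℕ 27) · (s₃ · e₃))
    Dse = ≈-trans (D-const-· (fromℕ 27) (s₃ · e₃)) (≈-trans (·-cong ≈-refl (D-·-log (≈-trans D-s₃ (·-cong ≈-refl wP≈)) (≈-trans De₃-log (·-comm _ e₃))))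
      (SS.solve 4 (λ s e a z → SS.con (fromℕ 27) SS.:* ((s SS.:* e) SS.:* ((a SS.:* a SS.:- SS.con 1ℚ) SS.:+ (z SS.:- a SS.:* a))) SS.:= (z SS.:- SS.con 1ℚ) SS.:* (SS.con (fromℕ 27) SS.:* (s SS.:* e))) ≈-refl s₃ e₃ a₃ Z₃))
    a1 : a₃ 1 ≡ fromℕ 6
    a1 = affine-at-1 (fromℕ 6) (𝓜 𝛘 0)
    -- The constant 27 is the coefficient of q in a³ - e: a contributes 3 · 6 and e contributes 9.
    start : tail y₃ 0 ≡ (const (fromℕ 27) · (s₃ · e₃)) 0
    start = trans (trans (∔-at _ (⊝ e₃) 1) (cong₂ _+_ (trans (·-at-1 a₃ (a₃ · a₃)) (cong₂ _+_
        (cong₂ _*_ a₃-at-0 (trans (·-at-1 a₃ a₃) (cong₂ _+_ (cong₂ _*_ a₃-at-0 a1) (cong₂ _*_ a1 a₃-at-0))))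
        (cong₂ _*_ a1 (trans (·-at-0 a₃ a₃) (cong₂ _*_ a₃-at-0 a₃-at-0))))) (trans (⊝-at e₃ 1) (cong -_ (affine-at-1 (- fromℕ 9) (𝓜 𝛘 2))))))
      (sym (trans (const-·-at (fromℕ 27) (s₃ · e₃) 0) (cong (fromℕ 27 *_) (trans (·-at-0 s₃ e₃) (cong (s₃ 0 *_) e₃-at-0)))))

  twist : ℚ → Series → Series
  twist r f n = (r ^ℚ n) * f n

  twist-· : ∀ r f g → twist r (f · g) ≈ twist r f · twist r g
  twist-· r f g .at n = trans (cong ((r ^ℚ n) *_) (·-def f g n)) (trans (sym (Σ<-*ˡ (suc n) (r ^ℚ n) _)) (trans (Σ<-cong (suc n) step) (sym (·-def (twist r f) (twist r g) n))))
    where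
    ^ℚ-+ : ∀ m k → r ^ℚ (m ℕ.+ k) ≡ (r ^ℚ m) * (r ^ℚ k)
    ^ℚ-+ zero    k = sym (ℚP.*-identityˡ (r ^ℚ k))
    ^ℚ-+ (suc m) k = trans (cong (r *_) (^ℚ-+ m k)) (sym (ℚP.*-assoc r (r ^ℚ m) (r ^ℚ k)))
    step : ∀ i → i < suc n → (r ^ℚ n) * (f i * g (n ∸ i)) ≡ twist r f i * twist r g (n ∸ i)
    step i i≤n = trans (cong (λ k → (r ^ℚ k) * (f i * g (n ∸ i))) (sym (ℕP.m+[n∸m]≡n (ℕP.≤-pred i≤n))))
      (trans (cong (_* (f i * g (n ∸ i))) (^ℚ-+ i (n ∸ i)))
        (RS.solve 4 (λ a b x y → (a RS.:* b) RS.:* (x RS.:* y) RS.:= (a RS.:* x) RS.:* (b RS.:* y)) refl (r ^ℚ i) (r ^ℚ (n ∸ i)) (f i) (g (n ∸ i))))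

  twist-↑ : ∀ r f k → twist r (f ↑ k) ≈ twist r f ↑ k
  twist-↑ r f zero    .at zero    = refl
  twist-↑ r f zero    .at (suc n) = ℚP.*-zeroʳ (r ^ℚ suc n)
  twist-↑ r f (suc k) = ≈-trans (twist-· r f (f ↑ k)) (·-cong ≈-refl (twist-↑ r f k))

  -- Φ(t) = ₂F₁(1/3,1/3;1;-27t)
  Φ : Series
  Φ = twist (- fromℕ 27) F

  F-suc : ∀ k → fromℕ (suc k) * (fromℕ (suc k) * F (suc k)) ≡ (fromℕ k + + 1 / 3) * ((fromℕ k + + 1 / 3) * F k)
  F-suc k = trans
    (RS.solve 5 (λ n p x f i → n RS.:* (n RS.:* ((p RS.:* (RS.con (+ 1 / 3) RS.:+ x)) RS.:* (p RS.:* (RS.con (+ 1 / 3) RS.:+ x)) RS.:* ((f RS.:* i) RS.:* (f RS.:* i)))) RS.:=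
      (n RS.:* i) RS.:* ((n RS.:* i) RS.:* ((x RS.:+ RS.con (+ 1 / 3)) RS.:* ((x RS.:+ RS.con (+ 1 / 3)) RS.:* (p RS.:* p RS.:* (f RS.:* f)))))) refl
      (fromℕ (suc k)) (poch (+ 1 / 3) k) (fromℕ k) (invFact k) (+ 1 / suc k))
    (trans (cong (λ z → z * (z * X)) (suc*1/suc k)) (RS.solve 1 (λ x → RS.con 1ℚ RS.:* (RS.con 1ℚ RS.:* x) RS.:= x) refl X))
    where X = (fromℕ k + + 1 / 3) * ((fromℕ k + + 1 / 3) * F k)

  -- With θ the Euler operator of the variable t, this is θ² = -27 t (θ + 1/3)² applied to `Φ`;
  -- `shift` is multiplication by t.
  hypergeometric : D (D Φ) ≈ shift (const (- fromℕ 27) · (D (D Φ) ∔ const (+ 2 / 3) · D Φ ∔ const (+ 1 / 9) · Φ))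
  hypergeometric .at zero    = D-at-0 (D Φ)
  hypergeometric .at (suc k) = begin
    D (D Φ) (suc k)
      ≡⟨ trans (D-at (D Φ) (suc k)) (cong (fromℕ (suc k) *_) (D-at Φ (suc k))) ⟩
    n * (n * ((r * (r ^ℚ k)) * F (suc k)))
      ≡⟨ RS.solve 4 (λ n r p f → n RS.:* (n RS.:* ((r RS.:* p) RS.:* f)) RS.:= r RS.:* (p RS.:* (n RS.:* (n RS.:* f)))) refl n r (r ^ℚ k) (F (suc k)) ⟩
    r * ((r ^ℚ k) * (n * (n * F (suc k))))
      ≡⟨ cong (λ z → r * ((r ^ℚ k) * z)) (F-suc k) ⟩
    r * ((r ^ℚ k) * ((x + + 1 / 3) * ((x + + 1 / 3) * F k)))
      ≡⟨ RS.solve 4 (λ r p x f → r RS.:* (p RS.:* ((x RS.:+ RS.con (+ 1 / 3)) RS.:* ((x RS.:+ RS.con (+ 1 / 3)) RS.:* f))) RS.:= r RS.:* (x RS.:* (x RS.:* (p RS.:* f)) RS.:+ RS.con (+ 2 / 3) RS.:* (x RS.:* (p RS.:* f)) RS.:+ RS.con (+ 1 / 9) RS.:* (p RS.:* f))) refl r (r ^ℚ k) x (F k) ⟩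
    r * (x * (x * Φ k) + (+ 2 / 3) * (x * Φ k) + (+ 1 / 9) * Φ k)
      ≡⟨ sym (trans (const-·-at r _ k) (cong (r *_) (trans (∔-at _ (const (+ 1 / 9) · Φ) k) (cong₂ _+_ (trans (∔-at (D (D Φ)) _ k)
           (cong₂ _+_ (trans (D-at (D Φ) k) (cong (x *_) (D-at Φ k))) (trans (const-·-at (+ 2 / 3) (D Φ) k) (cong ((+ 2 / 3) *_) (D-at Φ k))))) (const-·-at (+ 1 / 9) Φ k))))) ⟩
    (const r · (D (D Φ) ∔ const (+ 2 / 3) · D Φ ∔ const (+ 1 / 9) · Φ)) k ∎
    where
    n = fromℕ (suc k)
    x = fromℕ k
    r = - fromℕ 27

  -- `b₃` is defined as the hypergeometric function at -27t, not as a theta function; only `e₃≈b₃³`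
  -- identifies it. The primes are t d/dt applied before the substitution of t(q).
  b₃ b₃′ b₃″ : Series
  b₃  = comp t Φ
  b₃′ = comp t (D Φ)
  b₃″ = comp t (D (D Φ))

  t-log : D t ≈ t · (a₃ · a₃)
  t-log = ≈-trans D-t (·-cong ≈-refl (≈-sym a₃²≈P₃))

  Db₃ : D b₃ ≈ b₃′ · (a₃ · a₃)
  Db₃ = D-comp-log t t-at-0 Φ (a₃ · a₃) t-log

  Db₃′ : D b₃′ ≈ b₃″ · (a₃ · a₃)
  Db₃′ = D-comp-log t t-at-0 (D Φ) (a₃ · a₃) t-log

  b₃″-hypergeometric : b₃″ ≈ t · (const (- fromℕ 27) · (b₃″ ∔ const (+ 2 / 3) · b₃′ ∔ const (+ 1 / 9) · b₃))
  b₃″-hypergeometric = ≈-trans (comp-cong t t-at-0 hypergeometric) (≈-trans (comp-shift t t-at-0 _) (·-cong ≈-refl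
    (≈-trans (comp-const-· t t-at-0 _ _) (·-cong ≈-refl (≈-trans (comp-∔ t t-at-0 _ _) (∔-cong (≈-trans (comp-∔ t t-at-0 _ _) (∔-cong ≈-refl (comp-const-· t t-at-0 _ _))) (comp-const-· t t-at-0 _ _)))))))

  -- Multiply the hypergeometric equation by e and write y for 27te: the leading factor e (1 + 27t)
  -- becomes e + y = a³, and t disappears from the equation.
  a³b₃″ : a₃ · (a₃ · a₃) · b₃″ ≈ ⊝ (y₃ · (const (+ 2 / 3) · b₃′ ∔ const (+ 1 / 9) · b₃))
  a³b₃″ = ≈-trans (SS.solve 6 (λ a e t g₂ g₁ g → let S = g₂ SS.:+ SS.con (+ 2 / 3) SS.:* g₁ SS.:+ SS.con (+ 1 / 9) SS.:* g ; y = a SS.:* (a SS.:* a) SS.:- e in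
      a SS.:* (a SS.:* a) SS.:* g₂ SS.:= (SS.:- (y SS.:* (SS.con (+ 2 / 3) SS.:* g₁ SS.:+ SS.con (+ 1 / 9) SS.:* g)))
        SS.:+ (e SS.:* (g₂ SS.:- t SS.:* (SS.con (- fromℕ 27) SS.:* S)) SS.:+ S SS.:* (y SS.:- SS.con (fromℕ 27) SS.:* (t SS.:* e)))) ≈-refl a₃ e₃ t b₃″ b₃′ b₃)
    (≈-trans (∔-cong ≈-refl (∔-cong (·-cong ≈-refl (equal-difference b₃″-hypergeometric)) (·-cong ≈-refl (equal-difference y₃≈27te))))
      (SS.solve 3 (λ x e s → x SS.:+ (e SS.:* SS.con 0ℚ SS.:+ s SS.:* SS.con 0ℚ) SS.:= x) ≈-refl _ e₃ _))

  -- M₃ = 3 D log b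
  M₃ : Series
  M₃ = Z₃ ∔ (⊝ (a₃ · a₃))

  -- The second order equation of b₃ factors through the operator 3 D - M₃, so this defect satisfies a
  -- first order homogeneous equation and vanishes.
  defect : Series
  defect = const (fromℕ 3) · (b₃′ · (a₃ · a₃)) ∔ (⊝ (M₃ · b₃))

  M₃-at-0 : M₃ 0 ≡ 0ℚ
  M₃-at-0 = trans (∔-at Z₃ _ 0) (cong₂ _+_ Z₃-at-0 (trans (⊝-at (a₃ · a₃) 0) (cong -_ (trans (·-at-0 a₃ a₃) (cong₂ _*_ a₃-at-0 a₃-at-0)))))

  D-defect : const (fromℕ 3) · D defect ≈ M₃ · defect
  D-defect = ≈-trans (·-cong ≈-refl expanded) (≈-trans
    (SS.solve 8 (λ a da z dz e g g₁ g₂ → let M = z SS.:- a SS.:* a in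
      SS.con (fromℕ 3) SS.:* (SS.con (fromℕ 3) SS.:* (g₂ SS.:* (a SS.:* a) SS.:* (a SS.:* a) SS.:+ g₁ SS.:* (da SS.:* a SS.:+ a SS.:* da)) SS.:- ((dz SS.:- (da SS.:* a SS.:+ a SS.:* da)) SS.:* g SS.:+ M SS.:* (g₁ SS.:* (a SS.:* a))))
      SS.:= M SS.:* (SS.con (fromℕ 3) SS.:* (g₁ SS.:* (a SS.:* a)) SS.:- M SS.:* g)
        -- The three multipliers are the coefficients of 3 Da, 3 DZ and a³b″ in the left hand side;
        -- replacing these by their values leaves M · `defect`.
        SS.:+ ((SS.con (fromℕ 6) SS.:* (a SS.:* g₁) SS.:+ SS.con (fromℕ 2) SS.:* (a SS.:* g)) SS.:* (SS.con (fromℕ 3) SS.:* da SS.:- (a SS.:* z SS.:- e))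
        SS.:+ (SS.:- g) SS.:* (SS.con (fromℕ 3) SS.:* dz SS.:- (z SS.:* z SS.:- a SS.:* e))
        SS.:+ (SS.con (fromℕ 9) SS.:* a) SS.:* (a SS.:* (a SS.:* a) SS.:* g₂ SS.:- (SS.:- ((a SS.:* (a SS.:* a) SS.:- e) SS.:* (SS.con (+ 2 / 3) SS.:* g₁ SS.:+ SS.con (+ 1 / 9) SS.:* g))))))
      ≈-refl a₃ (D a₃) Z₃ (D Z₃) e₃ b₃ b₃′ b₃″)
    (≈-trans (∔-cong ≈-refl (∔-cong (∔-cong (·-cong ≈-refl (equal-difference 3Da₃)) (·-cong ≈-refl (equal-difference 3DZ₃))) (·-cong ≈-refl (equal-difference a³b₃″))))
      (SS.solve 4 (λ x m₁ m₂ m₃ → x SS.:+ (m₁ SS.:* SS.con 0ℚ SS.:+ m₂ SS.:* SS.con 0ℚ SS.:+ m₃ SS.:* SS.con 0ℚ) SS.:= x) ≈-refl _ _ _ _)))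
    where
    Daa : D (a₃ · a₃) ≈ D a₃ · a₃ ∔ a₃ · D a₃
    Daa = D-· a₃ a₃
    DM : D M₃ ≈ D Z₃ ∔ (⊝ (D a₃ · a₃ ∔ a₃ · D a₃))
    DM = ≈-trans (D-∔ Z₃ _) (∔-cong ≈-refl (≈-trans (D-⊝ _) (⊝-cong Daa)))
    expanded : D defect ≈ const (fromℕ 3) · (b₃″ · (a₃ · a₃) · (a₃ · a₃) ∔ b₃′ · (D a₃ · a₃ ∔ a₃ · D a₃)) ∔ (⊝ ((D Z₃ ∔ (⊝ (D a₃ · a₃ ∔ a₃ · D a₃))) · b₃ ∔ M₃ · (b₃′ · (a₃ · a₃))))
    expanded = ≈-trans (D-∔ _ _) (∔-cong (≈-trans (D-const-· _ _) (·-cong ≈-refl (≈-trans (D-· _ _) (∔-cong (·-cong Db₃′ ≈-refl) (·-cong ≈-refl Daa)))))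
      (≈-trans (D-⊝ _) (⊝-cong (≈-trans (D-· _ _) (∔-cong (·-cong DM ≈-refl) (·-cong ≈-refl Db₃))))))

  defect≈0 : defect ≈ const 0ℚ
  defect≈0 = ode-zero (const 1ℚ) (const (+ 1 / 3) · M₃) defect refl
    (trans (const-·-at (+ 1 / 3) M₃ 0) (cong ((+ 1 / 3) *_) M₃-at-0))
    (trans (∔-at _ _ 0) (cong₂ _+_ (trans (const-·-at (fromℕ 3) _ 0) (cong (fromℕ 3 *_) (trans (·-at-0 b₃′ _) (trans (cong (_* (a₃ · a₃) 0) (trans (comp-at-0 t t-at-0 (D Φ)) (D-at-0 Φ))) (ℚP.*-zeroˡ ((a₃ · a₃) 0))))))
      (trans (⊝-at (M₃ · b₃) 0) (cong -_ (trans (·-at-0 M₃ b₃) (trans (cong (_* b₃ 0) M₃-at-0) (ℚP.*-zeroˡ (b₃ 0))))))))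
    (≈-trans (SS.solve 1 (λ d → SS.con 1ℚ SS.:* d SS.:= SS.con (+ 1 / 3) SS.:* (SS.con (fromℕ 3) SS.:* d)) ≈-refl (D defect)) (≈-trans (·-cong ≈-refl D-defect) (≈-sym (·-assoc _ _ _))))

  Db₃-log : D b₃ ≈ b₃ · (const (+ 1 / 3) · M₃)
  Db₃-log = ≈-trans Db₃ (≈-trans (SS.solve 3 (λ x m g → x SS.:= SS.con (+ 1 / 3) SS.:* (SS.con (fromℕ 3) SS.:* x SS.:- m SS.:* g) SS.:+ g SS.:* (SS.con (+ 1 / 3) SS.:* m)) ≈-refl (b₃′ · (a₃ · a₃)) M₃ b₃)
    (≈-trans (∔-cong (·-cong ≈-refl defect≈0) ≈-refl) (SS.solve 1 (λ x → SS.con (+ 1 / 3) SS.:* SS.con 0ℚ SS.:+ x SS.:= x) ≈-refl _)))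

  -- Both sides have logarithmic derivative `M₃` and constant term 1.
  e₃≈b₃³ : e₃ ≈ b₃ ↑ 3
  e₃≈b₃³ = ode-unique M₃ e₃ (b₃ ↑ 3) M₃-at-0 (trans e₃-at-0 (sym (↑-at-0 b₃ 3 (comp-at-0 t t-at-0 Φ)))) De₃-log
    (≈-trans (D-↑-log 3 Db₃-log) (·-cong (SS.solve 1 (λ m → SS.con (fromℕ 3) SS.:* (SS.con (+ 1 / 3) SS.:* m) SS.:= m) ≈-refl M₃) ≈-refl))

  C-parametrised : C ≈ P₃ · comp t (Φ ↑ 3)
  C-parametrised = ≈-trans C≈C₃ (≈-trans C₃≈P₃e₃ (·-cong ≈-refl (≈-trans e₃≈b₃³ (≈-sym (comp-↑ t t-at-0 Φ 3)))))

  sign : ℕ → ℚ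
  sign n = (- 1ℚ) ^ℚ n

  Φ³-at : ∀ n → (Φ ↑ 3) n ≡ sign n * A n
  Φ³-at n = trans (sym (twist-↑ (- fromℕ 27) F 3 .at n)) (trans (cong₂ _*_ (power n) (sym (pow≈↑ {F} 3 ≈-refl .at n))) (ℚP.*-assoc (sign n) (fromℕ 27 ^ℚ n) (pow F 3 n)))
    where
    power : ∀ n → (- fromℕ 27) ^ℚ n ≡ sign n * (fromℕ 27 ^ℚ n)
    power zero    = refl
    power (suc n) = trans (cong (- fromℕ 27 *_) (power n)) (RS.solve 2 (λ s x → RS.con (- fromℕ 27) RS.:* (s RS.:* x) RS.:= (RS.con (- 1ℚ) RS.:* s) RS.:* (RS.con (fromℕ 27) RS.:* x)) refl (sign n) (fromℕ 27 ^ℚ n))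

  -- Lagrange inversion: v₃ = q/t

  v₃ : Series
  v₃ = inv s₃

  D-v₃ : D v₃ ≈ v₃ · (⊝ 𝓛 wP)
  D-v₃ = D-inv s₃-at-0 D-s₃

  ↑-+ : ∀ f j k → f ↑ (j ℕ.+ k) ≈ f ↑ j · f ↑ k
  ↑-+ f zero    k = ≈-sym (one-· (f ↑ k))
  ↑-+ f (suc j) k = ≈-trans (·-cong ≈-refl (↑-+ f j k)) (≈-sym (·-assoc f (f ↑ j) (f ↑ k)))

  one-↑ : ∀ k → const 1ℚ ↑ k ≈ const 1ℚ
  one-↑ zero    = ≈-refl
  one-↑ (suc k) = ≈-trans (one-· _) (one-↑ k)

  qPow-↑ : ∀ k → qPow 1 ↑ k ≈ qPow k
  qPow-↑ zero    = ≈-sym qPow-0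
  qPow-↑ (suc k) = ≈-trans (·-cong ≈-refl (qPow-↑ k)) (≈-sym (qPow-+ 1 k))

  -- With j for `suc j`: P (q/t)^j dq/q^(j+1) is the exact differential dt/t^(j+1) and has no
  -- residue. Formally j P v^j = j v^j - D(v^j), and D multiplies coefficient j by j.
  residue-zero : ∀ j → (P₃ · v₃ ↑ suc j) (suc j) ≡ 0ℚ
  residue-zero j = fromℕ-suc-cancel j _ (begin
    fromℕ (suc j) * (P₃ · v₃ ↑ suc j) (suc j)
      ≡⟨ sym (const-·-at (fromℕ (suc j)) _ (suc j)) ⟩
    (const (fromℕ (suc j)) · (P₃ · v₃ ↑ suc j)) (suc j)
      ≡⟨ ≈-trans (·-cong ≈-refl (·-cong P₃≈𝓛 ≈-refl)) (SS.solve 3 (λ c w v → c SS.:* ((SS.con 1ℚ SS.:+ w) SS.:* v) SS.:= c SS.:* v SS.:- (c SS.:* (SS.:- w)) SS.:* v) ≈-refl (const (fromℕ (suc j))) (𝓛 wP) (v₃ ↑ suc j)) .at (suc j) ⟩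
    (const (fromℕ (suc j)) · v₃ ↑ suc j ∔ (⊝ ((const (fromℕ (suc j)) · (⊝ 𝓛 wP)) · v₃ ↑ suc j))) (suc j)
      ≡⟨ trans (∔-at _ _ (suc j)) (cong₂ _+_ (trans (const-·-at (fromℕ (suc j)) _ (suc j)) (sym (D-at (v₃ ↑ suc j) (suc j)))) (trans (⊝-at _ (suc j)) (cong -_ (sym (D-↑-log (suc j) D-v₃ .at (suc j)))))) ⟩
    D (v₃ ↑ suc j) (suc j) - D (v₃ ↑ suc j) (suc j)
      ≡⟨ ℚP.+-inverseʳ (D (v₃ ↑ suc j) (suc j)) ⟩
    0ℚ ∎)

  -- Since t v = q, the power t^k absorbs k of the factors v and leaves q^k.
  shifted-term : ∀ k j → ((v₃ ↑ (k ℕ.+ j) · P₃) · t ↑ k) (k ℕ.+ j) ≡ (P₃ · v₃ ↑ j) j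
  shifted-term k j = trans (eq .at (k ℕ.+ j)) (qPow-·-+ k (P₃ · v₃ ↑ j) j)
    where
    vs : v₃ ↑ k · s₃ ↑ k ≈ const 1ℚ
    vs = ≈-trans (≈-sym (↑-· v₃ s₃ k)) (≈-trans (↑-cong k (≈-trans (·-comm v₃ s₃) (inv-right s₃ s₃-at-0))) (one-↑ k))
    eq : (v₃ ↑ (k ℕ.+ j) · P₃) · t ↑ k ≈ qPow k · (P₃ · v₃ ↑ j)
    eq = ≈-trans (·-cong (·-cong (↑-+ v₃ k j) ≈-refl) (≈-trans (↑-cong k t≈q·s₃) (≈-trans (↑-· (qPow 1) s₃ k) (·-cong (qPow-↑ k) ≈-refl))))
      (≈-trans (SS.solve 5 (λ x y p q s → ((x SS.:* y) SS.:* p) SS.:* (q SS.:* s) SS.:= (x SS.:* s) SS.:* (q SS.:* (p SS.:* y))) ≈-refl (v₃ ↑ k) (v₃ ↑ j) P₃ (qPow k) (s₃ ↑ k))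
        (≈-trans (·-cong vs ≈-refl) (one-· _)))

  -- In the expansion of C v^n in powers t^k the terms k < n are killed by `residue-zero` with
  -- exponent n - k, the term k = n contributes P(0) = 1, and later powers start beyond degree n.
  lagrange : ∀ n → (C · v₃ ↑ n) n ≡ sign n * A n
  lagrange n = begin
    (C · v₃ ↑ n) n
      ≡⟨ ≈-trans (·-cong C-parametrised ≈-refl) (SS.solve 3 (λ p c v → (p SS.:* c) SS.:* v SS.:= (v SS.:* p) SS.:* c) ≈-refl P₃ (comp t (Φ ↑ 3)) (v₃ ↑ n)) .at n ⟩
    ((v₃ ↑ n · P₃) · comp t (Φ ↑ 3)) n
      ≡⟨ ·-comp t t-at-0 (v₃ ↑ n · P₃) (Φ ↑ 3) n ⟩
    Σ< n (λ k → (Φ ↑ 3) k * ((v₃ ↑ n · P₃) · t ↑ k) n) + (Φ ↑ 3) n * ((v₃ ↑ n · P₃) · t ↑ n) n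
      ≡⟨ cong₂ _+_ (Σ<-zero n λ k k<n → trans (cong ((Φ ↑ 3) k *_) (early k k<n)) (ℚP.*-zeroʳ ((Φ ↑ 3) k))) (cong ((Φ ↑ 3) n *_) last) ⟩
    0ℚ + (Φ ↑ 3) n * 1ℚ
      ≡⟨ trans (ℚP.+-identityˡ _) (trans (ℚP.*-identityʳ _) (Φ³-at n)) ⟩
    sign n * A n ∎
    where
    early : ∀ k → k < n → ((v₃ ↑ n · P₃) · t ↑ k) n ≡ 0ℚ
    early k k<n = subst (λ m → ((v₃ ↑ m · P₃) · t ↑ k) m ≡ 0ℚ) (trans (cong (k ℕ.+_) (sym (ℕP.+-∸-assoc 1 k<n))) (ℕP.m+[n∸m]≡n (ℕP.<⇒≤ k<n)))
      (trans (shifted-term k (suc (n ∸ suc k))) (residue-zero (n ∸ suc k)))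
    last : ((v₃ ↑ n · P₃) · t ↑ n) n ≡ 1ℚ
    last = subst (λ m → ((v₃ ↑ m · P₃) · t ↑ n) m ≡ 1ℚ) (ℕP.+-identityʳ n)
      (trans (shifted-term n 0) (trans (·-at-0 P₃ (const 1ℚ)) (cong (_* 1ℚ) P₃-at-0)))

module _ where

  open import Data.Rational using (_*_)

  -- Localisation at a prime

  fromℤ-injective : ∀ {i j} → fromℤ i ≡ fromℤ j → i ≡ j
  fromℤ-injective {i} {j} eq with ℚᵘP.≃-trans (ℚᵘP.≃-sym (ℚP.toℚᵘ-fromℚᵘ (ℚᵘ.mkℚᵘ i 0))) (ℚᵘP.≃-trans (ℚᵘP.≃-reflexive (cong ℚ.toℚᵘ eq)) (ℚP.toℚᵘ-fromℚᵘ (ℚᵘ.mkℚᵘ j 0)))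
  ... | ℚᵘ.*≡* e = trans (sym (ℤP.*-identityʳ i)) (trans e (ℤP.*-identityʳ j))

  *-denominator : ∀ x → x * fromℕ (↧ₙ x) ≡ fromℤ (↥ x)
  *-denominator x@(mkℚ n d _) = ℚP.toℚᵘ-injective (ℚᵘP.≃-trans (ℚP.toℚᵘ-homo-* x (fromℕ (suc d)))
    (ℚᵘP.≃-trans (ℚᵘP.*-congˡ {ℚᵘ.mkℚᵘ n d} (ℚP.toℚᵘ-fromℚᵘ (ℚᵘ.mkℚᵘ (+ suc d) 0)))
      (ℚᵘP.≃-trans (ℚᵘ.*≡* (trans (ℤP.*-identityʳ _) (cong (λ k → n ℤ.* + suc k) (sym (ℕP.*-identityʳ d))))) (ℚᵘP.≃-sym (ℚP.toℚᵘ-fromℚᵘ (ℚᵘ.mkℚᵘ n 0))))))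

  fromℕ-nonzero-cancel : ∀ {n x y} → ¬ n ≡ 0 → fromℕ n * x ≡ fromℕ n * y → x ≡ y
  fromℕ-nonzero-cancel {zero}  n≢0 _ = contradiction refl n≢0
  fromℕ-nonzero-cancel {suc n} {x} {y} _ eq = sub-zero (fromℕ-suc-cancel n (x - y)
    (trans (RS.solve 3 (λ n x y → n RS.:* (x RS.:- y) RS.:= n RS.:* x RS.:- n RS.:* y) refl (fromℕ (suc n)) x y) (trans (cong (_- fromℕ (suc n) * y) eq) (ℚP.+-inverseʳ (fromℕ (suc n) * y)))))

  module NS = Data.Nat.Solver.+-*-Solver

  module Localisation (p : ℕ) (p-prime : Prime p) where

    p≢1 : ¬ p ≡ 1
    p≢1 refl with ℕ.NonTrivial.nonTrivial (prime⇒nonTrivial p-prime)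
    ... | ()

    p≢0 : ¬ p ≡ 0
    p≢0 refl with ℕ.NonTrivial.nonTrivial (prime⇒nonTrivial p-prime)
    ... | ()

    p∤1 : ¬ p ∣ 1
    p∤1 d = p≢1 (∣1⇒≡1 d)

    p∤* : ∀ {m n} → ¬ p ∣ m → ¬ p ∣ n → ¬ p ∣ m ℕ.* n
    p∤* {m} {n} ¬m ¬n d with euclidsLemma m n p-prime d
    ... | inj₁ e = ¬m e
    ... | inj₂ e = ¬n e

    p^≢0 : ∀ k → ¬ p ℕ.^ k ≡ 0
    p^≢0 k eq = p≢0 (ℕP.m^n≡0⇒m≡0 p k eq)

    p^∣-cancel : ∀ k m {n} → ¬ p ∣ n → p ℕ.^ k ∣ m ℕ.* n → p ℕ.^ k ∣ m
    p^∣-cancel zero    m ¬n _ = 1∣ m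
    p^∣-cancel (suc k) m {n} ¬n d with euclidsLemma m n p-prime (∣-trans (m∣m*n (p ℕ.^ k)) d)
    ... | inj₂ e = contradiction e ¬n
    ... | inj₁ (divides m′ refl) = subst (p ℕ.^ suc k ∣_) (ℕP.*-comm p m′) (*-monoʳ-∣ p (p^∣-cancel k m′ ¬n
            (*-cancelˡ-∣ p {{ℕ.≢-nonZero p≢0}} (subst (p ℕ.* p ℕ.^ k ∣_) (trans (cong (ℕ._* n) (ℕP.*-comm m′ p)) (ℕP.*-assoc p m′ n)) d))))

    -- V k x: x ∈ pᵏ ℤ₍ₚ₎
    record V (k : ℕ) (x : ℚ) : Set where
      constructor mkV
      field
        numer : ℤ
        denom : ℕ
        p∤denom : ¬ p ∣ denom
        equation : x * fromℕ denom ≡ fromℕ (p ℕ.^ k) * fromℤ numer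

    V-subst : ∀ {k x y} → x ≡ y → V k x → V k y
    V-subst refl v = v

    V-ℤ : ∀ a → V 0 (fromℤ a)
    V-ℤ a = mkV a 1 p∤1 (ℚP.*-comm (fromℤ a) 1ℚ)

    V-ℕ : ∀ n → V 0 (fromℕ n)
    V-ℕ n = V-ℤ (+ n)

    V-p^ : ∀ k → V k (fromℕ (p ℕ.^ k))
    V-p^ k = mkV (+ 1) 1 p∤1 refl

    V-p : V 1 (fromℕ p)
    V-p = V-subst (cong fromℕ (ℕP.*-identityʳ p)) (V-p^ 1)

    V-0 : ∀ {k} → V k 0ℚ
    V-0 {k} = mkV (+ 0) 1 p∤1 (sym (ℚP.*-zeroʳ (fromℕ (p ℕ.^ k))))

    V-+ : ∀ {k x y} → V k x → V k y → V k (x + y)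
    V-+ {k} {x} {y} (mkV a b ¬b e) (mkV a′ b′ ¬b′ e′) = mkV (a ℤ.* + b′ ℤ.+ a′ ℤ.* + b) (b ℕ.* b′) (p∤* ¬b ¬b′) (begin
      (x + y) * fromℕ (b ℕ.* b′)
        ≡⟨ cong ((x + y) *_) (fromℕ-homo-* b b′) ⟩
      (x + y) * (fromℕ b * fromℕ b′)
        ≡⟨ RS.solve 4 (λ x y b b′ → (x RS.:+ y) RS.:* (b RS.:* b′) RS.:= (x RS.:* b) RS.:* b′ RS.:+ (y RS.:* b′) RS.:* b) refl x y (fromℕ b) (fromℕ b′) ⟩
      (x * fromℕ b) * fromℕ b′ + (y * fromℕ b′) * fromℕ b
        ≡⟨ cong₂ (λ u v → u * fromℕ b′ + v * fromℕ b) e e′ ⟩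
      (P * fromℤ a) * fromℕ b′ + (P * fromℤ a′) * fromℕ b
        ≡⟨ RS.solve 5 (λ P a b a′ b′ → (P RS.:* a) RS.:* b′ RS.:+ (P RS.:* a′) RS.:* b RS.:= P RS.:* (a RS.:* b′ RS.:+ a′ RS.:* b)) refl P (fromℤ a) (fromℕ b) (fromℤ a′) (fromℕ b′) ⟩
      P * (fromℤ a * fromℕ b′ + fromℤ a′ * fromℕ b)
        ≡⟨ cong (P *_) (sym (trans (fromℤ-homo-+ (a ℤ.* + b′) (a′ ℤ.* + b)) (cong₂ _+_ (fromℤ-homo-* a (+ b′)) (fromℤ-homo-* a′ (+ b))))) ⟩
      P * fromℤ (a ℤ.* + b′ ℤ.+ a′ ℤ.* + b) ∎)
      where P = fromℕ (p ℕ.^ k)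

    V-* : ∀ {j k x y} → V j x → V k y → V (j ℕ.+ k) (x * y)
    V-* {j} {k} {x} {y} (mkV a b ¬b e) (mkV a′ b′ ¬b′ e′) = mkV (a ℤ.* a′) (b ℕ.* b′) (p∤* ¬b ¬b′) (begin
      (x * y) * fromℕ (b ℕ.* b′)
        ≡⟨ cong ((x * y) *_) (fromℕ-homo-* b b′) ⟩
      (x * y) * (fromℕ b * fromℕ b′)
        ≡⟨ RS.solve 4 (λ x y b b′ → (x RS.:* y) RS.:* (b RS.:* b′) RS.:= (x RS.:* b) RS.:* (y RS.:* b′)) refl x y (fromℕ b) (fromℕ b′) ⟩
      (x * fromℕ b) * (y * fromℕ b′)
        ≡⟨ cong₂ _*_ e e′ ⟩
      (P * fromℤ a) * (Q * fromℤ a′)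
        ≡⟨ RS.solve 4 (λ P a Q a′ → (P RS.:* a) RS.:* (Q RS.:* a′) RS.:= (P RS.:* Q) RS.:* (a RS.:* a′)) refl P (fromℤ a) Q (fromℤ a′) ⟩
      (P * Q) * (fromℤ a * fromℤ a′)
        ≡⟨ cong₂ _*_ (sym (trans (cong fromℕ (ℕP.^-distribˡ-+-* p j k)) (fromℕ-homo-* (p ℕ.^ j) (p ℕ.^ k)))) (sym (fromℤ-homo-* a a′)) ⟩
      fromℕ (p ℕ.^ (j ℕ.+ k)) * fromℤ (a ℤ.* a′) ∎)
      where
      P = fromℕ (p ℕ.^ j)
      Q = fromℕ (p ℕ.^ k)

    V-weaken : ∀ {j k x} → j ≤ k → V k x → V j x
    V-weaken {j} {k} {x} j≤k (mkV a b ¬b e) = mkV (+ (p ℕ.^ (k ∸ j)) ℤ.* a) b ¬b (trans e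
      (trans (cong (_* fromℤ a) (trans (cong (λ i → fromℕ (p ℕ.^ i)) (sym (ℕP.m+[n∸m]≡n j≤k))) (trans (cong fromℕ (ℕP.^-distribˡ-+-* p j (k ∸ j))) (fromℕ-homo-* (p ℕ.^ j) (p ℕ.^ (k ∸ j))))))
        (trans (ℚP.*-assoc (fromℕ (p ℕ.^ j)) (fromℕ (p ℕ.^ (k ∸ j))) (fromℤ a)) (cong (fromℕ (p ℕ.^ j) *_) (sym (fromℤ-homo-* (+ (p ℕ.^ (k ∸ j))) a))))))

    V-*ˡ : ∀ {k x y} → V 0 x → V k y → V k (x * y)
    V-*ˡ = V-*

    V-neg : ∀ {k x} → V k x → V k (- x)
    V-neg {k} {x} v = V-subst (RS.solve 1 (λ x → RS.con (- 1ℚ) RS.:* x RS.:= RS.:- x) refl x) (V-*ˡ (V-ℤ (ℤ.- + 1)) v)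

    V-Σ : ∀ {k} n {f : ℕ → ℚ} → (∀ i → i < n → V k (f i)) → V k (Σ< n f)
    V-Σ zero    v = V-0
    V-Σ (suc n) v = V-+ (V-Σ n (λ i i<n → v i (ℕP.m<n⇒m<1+n i<n))) (v n ℕP.≤-refl)

    V-cancel-unit : ∀ {k x} n → ¬ p ∣ n → V k (fromℕ n * x) → V k x
    V-cancel-unit {k} {x} n ¬n (mkV a b ¬b e) = mkV a (n ℕ.* b) (p∤* ¬n ¬b)
      (trans (cong (x *_) (fromℕ-homo-* n b)) (trans (RS.solve 3 (λ x n b → x RS.:* (n RS.:* b) RS.:= (n RS.:* x) RS.:* b) refl x (fromℕ n) (fromℕ b)) e))

    V-cancel-p^ : ∀ {k x} j → V (j ℕ.+ k) (fromℕ (p ℕ.^ j) * x) → V k x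
    V-cancel-p^ {k} {x} j (mkV a b ¬b e) = mkV a b ¬b (fromℕ-nonzero-cancel (p^≢0 j) (trans (sym (ℚP.*-assoc (fromℕ (p ℕ.^ j)) x (fromℕ b))) (trans e
      (trans (cong (_* fromℤ a) (trans (cong fromℕ (ℕP.^-distribˡ-+-* p j k)) (fromℕ-homo-* (p ℕ.^ j) (p ℕ.^ k)))) (ℚP.*-assoc (fromℕ (p ℕ.^ j)) (fromℕ (p ℕ.^ k)) (fromℤ a))))))

    -- `V` admits any denominator prime to p, so that sums and products need no reduction; here
    -- lowest terms are recovered. Cross multiplication gives ↥x · b = p^k a · ↧x with p not
    -- dividing b. So p^k divides the numerator, and p dividing ↧x would force p to divide ↥x,
    -- against coprimality.
    V⇒InPowZp : ∀ {k x} → V k x → InPowZp p k x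
    V⇒InPowZp {k} {x} (mkV a b ¬b e) = p^∣-cancel k ∣ ↥ x ∣ ¬b (subst (p ℕ.^ k ∣_) (sym cross) (∣m⇒∣m*n (↧ₙ x) (m∣m*n ∣ a ∣))) , p∤↧
      where
      crossℤ : ↥ x ℤ.* + b ≡ (+ (p ℕ.^ k) ℤ.* a) ℤ.* + ↧ₙ x
      crossℤ = fromℤ-injective (begin
        fromℤ (↥ x ℤ.* + b)                          ≡⟨ fromℤ-homo-* (↥ x) (+ b) ⟩
        fromℤ (↥ x) * fromℕ b                        ≡⟨ cong (_* fromℕ b) (sym (*-denominator x)) ⟩
        (x * fromℕ (↧ₙ x)) * fromℕ b                 ≡⟨ RS.solve 3 (λ x d b → (x RS.:* d) RS.:* b RS.:= (x RS.:* b) RS.:* d) refl x (fromℕ (↧ₙ x)) (fromℕ b) ⟩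
        (x * fromℕ b) * fromℕ (↧ₙ x)                 ≡⟨ cong (_* fromℕ (↧ₙ x)) e ⟩
        (fromℕ (p ℕ.^ k) * fromℤ a) * fromℕ (↧ₙ x)   ≡⟨ sym (trans (fromℤ-homo-* (+ (p ℕ.^ k) ℤ.* a) (+ ↧ₙ x)) (cong (_* fromℕ (↧ₙ x)) (fromℤ-homo-* (+ (p ℕ.^ k)) a))) ⟩
        fromℤ ((+ (p ℕ.^ k) ℤ.* a) ℤ.* + ↧ₙ x) ∎)
      cross : ∣ ↥ x ∣ ℕ.* b ≡ (p ℕ.^ k ℕ.* ∣ a ∣) ℕ.* ↧ₙ x
      cross = trans (sym (ℤP.abs-* (↥ x) (+ b))) (trans (cong ∣_∣ crossℤ) (trans (ℤP.abs-* (+ (p ℕ.^ k) ℤ.* a) (+ ↧ₙ x)) (cong (ℕ._* ↧ₙ x) (ℤP.abs-* (+ (p ℕ.^ k)) a))))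
      coprime : ∀ y → Coprimality.Coprime ∣ ↥ y ∣ (↧ₙ y)
      coprime (mkℚ n d c) = Coprimality.recompute c
      p∤↧ : ¬ p ∣ ↧ₙ x
      p∤↧ d = [ (λ d′ → p≢1 (coprime x (d′ , d))) , ¬b ]′ (euclidsLemma ∣ ↥ x ∣ b p-prime (subst (p ∣_) (sym cross) (∣n⇒∣m*n (p ℕ.^ k ℕ.* ∣ a ∣) d)))

    InPowZp⇒V : ∀ {k x} → InPowZp p k x → V k x
    InPowZp⇒V {k} {x} (d , ¬d) with Signed.∣ᵤ⇒∣ {+ (p ℕ.^ k)} {↥ x} d
    ... | Signed.divides q eq = mkV q (↧ₙ x) ¬d (trans (*-denominator x) (trans (cong fromℤ (trans eq (ℤP.*-comm q (+ (p ℕ.^ k))))) (fromℤ-homo-* (+ (p ℕ.^ k)) q)))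

    -- Series with coefficients divisible by a power of p

    VS : ℕ → Series → Set
    VS k f = ∀ n → V k (f n)

    VS-cong : ∀ {k f g} → f ≈ g → VS k f → VS k g
    VS-cong p v n = V-subst (p .at n) (v n)

    VS-const : ∀ {k c} → V k c → VS k (const c)
    VS-const v zero    = v
    VS-const v (suc n) = V-0

    VS-∔ : ∀ {k f g} → VS k f → VS k g → VS k (f ∔ g)
    VS-∔ {f = f} {g} v w n = V-subst (sym (∔-at f g n)) (V-+ (v n) (w n))

    VS-⊝ : ∀ {k f} → VS k f → VS k (⊝ f)
    VS-⊝ {f = f} v n = V-subst (sym (⊝-at f n)) (V-neg (v n))

    VS-· : ∀ {j k f g} → VS j f → VS k g → VS (j ℕ.+ k) (f · g)
    VS-· {f = f} {g} v w n = V-subst (sym (·-def f g n)) (V-Σ (suc n) λ i _ → V-* (v i) (w (n ∸ i)))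

    VS-↑ : ∀ {k f} ℓ → VS k f → VS (ℓ ℕ.* k) (f ↑ ℓ)
    VS-↑ zero    v = VS-const (V-ℕ 1)
    VS-↑ (suc ℓ) v = VS-· v (VS-↑ ℓ v)

    VS-↑₀ : ∀ {f} ℓ → VS 0 f → VS 0 (f ↑ ℓ)
    VS-↑₀ {f} ℓ v n = subst (λ k → V k ((f ↑ ℓ) n)) (ℕP.*-zeroʳ ℓ) (VS-↑ ℓ v n)

    VS-comp : ∀ {s c} → VS 0 s → VS 0 c → VS 0 (comp s c)
    VS-comp {s} {c} v w n = V-subst (sym (comp-at s c n)) (V-Σ (suc n) λ k _ → V-* (w k) (VS-↑₀ k v n))

    VS-inv : ∀ {f} → VS 0 f → VS 0 (inv f)
    VS-inv {f} v = VS-cong (≈-sym (inv-comp f)) (VS-comp (VS-· (VS-const (V-ℤ (ℤ.- + 1))) (VS-∔ v (VS-⊝ (VS-const (V-ℕ 1))))) (λ _ → V-ℕ 1))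

    VS-qPow : ∀ k → VS 0 (qPow k)
    VS-qPow k n with k ℕ.≟ n
    ... | yes _ = V-ℕ 1
    ... | no  _ = V-0

    -- Factorials

    -- The factors kp + 1, ..., kp + r lie strictly between consecutive multiples of p.
    factorial-offset : ∀ k r → r < p → ∃[ w ] ((r ℕ.+ k ℕ.* p) ! ≡ (k ℕ.* p) ! ℕ.* w × ¬ p ∣ w)
    factorial-offset k zero    _   = 1 , sym (ℕP.*-identityʳ _) , p∤1
    factorial-offset k (suc r) r<p with factorial-offset k r (ℕP.<-trans (ℕP.n<1+n r) r<p)
    ... | w , eq , ¬w = (suc r ℕ.+ k ℕ.* p) ℕ.* w
        , trans (cong ((suc r ℕ.+ k ℕ.* p) ℕ.*_) eq) (trans (sym (ℕP.*-assoc (suc r ℕ.+ k ℕ.* p) ((k ℕ.* p) !) w)) (trans (cong (ℕ._* w) (ℕP.*-comm (suc r ℕ.+ k ℕ.* p) ((k ℕ.* p) !))) (ℕP.*-assoc ((k ℕ.* p) !) (suc r ℕ.+ k ℕ.* p) w)))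
        , p∤* (λ d → ℕP.<⇒≱ r<p (∣⇒≤ (∣m+n∣m⇒∣n (subst (p ∣_) (ℕP.+-comm (suc r) (k ℕ.* p)) d) (n∣m*n k)))) ¬w

    -- Each further block of p factors ends with the single multiple (k + 1) p; its other p - 1
    -- factors are handled by `factorial-offset`.
    factorial-multiple : ∀ k → ∃[ w ] ((k ℕ.* p) ! ≡ p ℕ.^ k ℕ.* (k ! ℕ.* w) × ¬ p ∣ w)
    factorial-multiple zero    = 1 , refl , p∤1
    factorial-multiple (suc k) with factorial-multiple k | factorial-offset k (ℕ.pred p) (ℕP.≤-reflexive (ℕP.suc-pred p {{ℕ.≢-nonZero p≢0}}))
    ... | w , eq , ¬w | w′ , eq′ , ¬w′ = w ℕ.* w′ , (begin
        (p ℕ.+ k ℕ.* p) !                            ≡⟨ cong (λ x → (x ℕ.+ k ℕ.* p) !) (sym sp) ⟩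
        suc (p′ ℕ.+ k ℕ.* p) ℕ.* (p′ ℕ.+ k ℕ.* p) !    ≡⟨ cong₂ ℕ._*_ (cong (ℕ._+ k ℕ.* p) sp) (trans eq′ (cong (ℕ._* w′) eq)) ⟩
        (suc k ℕ.* p) ℕ.* (p ℕ.^ k ℕ.* (k ! ℕ.* w) ℕ.* w′)
          ≡⟨ NS.solve 6 (λ k p q f w w′ → (k NS.:* p) NS.:* (q NS.:* (f NS.:* w) NS.:* w′) NS.:= p NS.:* q NS.:* (k NS.:* f NS.:* (w NS.:* w′))) refl (suc k) p (p ℕ.^ k) (k !) w w′ ⟩
        p ℕ.* p ℕ.^ k ℕ.* (suc k ℕ.* k ! ℕ.* (w ℕ.* w′)) ∎) , p∤* ¬w ¬w′
      where
      p′ = ℕ.pred p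
      sp : suc p′ ≡ p
      sp = ℕP.suc-pred p {{ℕ.≢-nonZero p≢0}}

    -- Legendre's recursion: for ℓ = kp + r with k ≥ 1 the exponent is e = k + e', where e' belongs
    -- to k!. By induction 4e' < k, so 4e < 5k ≤ pk ≤ ℓ. For k = 0 the exponent is 0 and ℓ ≥ 1 gives
    -- the strict bound.
    factorial-valuation : 5 ≤ p → ∀ ℓ → 1 ≤ ℓ → ∃[ e ] ∃[ w ] (ℓ ! ≡ p ℕ.^ e ℕ.* w × ¬ p ∣ w × 4 ℕ.* e < ℓ)
    factorial-valuation 5≤p ℓ 1≤ℓ = below (suc ℓ) ℓ ℕP.≤-refl 1≤ℓ
      where
      instance
        p-nonZero : ℕ.NonZero p
        p-nonZero = ℕ.≢-nonZero p≢0
      below : ∀ N ℓ → ℓ < N → 1 ≤ ℓ → ∃[ e ] ∃[ w ] (ℓ ! ≡ p ℕ.^ e ℕ.* w × ¬ p ∣ w × 4 ℕ.* e < ℓ)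
      below (suc N) ℓ (s≤s ℓ≤N) 1≤ℓ = go (ℓ ℕ./ p) (ℓ % p) (m≡m%n+[m/n]*n ℓ p) (m%n<n ℓ p)
        where
        quotient< : ∀ k r → ℓ ≡ r ℕ.+ suc k ℕ.* p → suc k < ℓ
        quotient< k r ℓ≡ = subst (suc k <_) (sym ℓ≡) (ℕP.<-≤-trans (ℕP.m<m*n (suc k) p (ℕP.≤-trans (s≤s (s≤s z≤n)) 5≤p)) (ℕP.m≤n+m (suc k ℕ.* p) r))
        go : ∀ k r → ℓ ≡ r ℕ.+ k ℕ.* p → r < p → ∃[ e ] ∃[ w ] (ℓ ! ≡ p ℕ.^ e ℕ.* w × ¬ p ∣ w × 4 ℕ.* e < ℓ)
        go zero r ℓ≡ r<p with factorial-offset 0 r r<p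
        ... | w , eq , ¬w = 0 , w , trans (cong _! ℓ≡) eq , ¬w , 1≤ℓ
        go (suc k) r ℓ≡ r<p with factorial-offset (suc k) r r<p | factorial-multiple (suc k) | below N (suc k) (ℕP.<-≤-trans (quotient< k r ℓ≡) ℓ≤N) (s≤s z≤n)
        ... | w , eq , ¬w | w′ , eq′ , ¬w′ | e , w″ , eq″ , ¬w″ , 4e<k = suc k ℕ.+ e , (w″ ℕ.* w′) ℕ.* w , (begin
            ℓ !                                                      ≡⟨ trans (cong _! ℓ≡) eq ⟩
            (suc k ℕ.* p) ! ℕ.* w                                    ≡⟨ cong (ℕ._* w) eq′ ⟩
            p ℕ.^ suc k ℕ.* (suc k ! ℕ.* w′) ℕ.* w                    ≡⟨ cong (λ x → p ℕ.^ suc k ℕ.* (x ℕ.* w′) ℕ.* w) eq″ ⟩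
            p ℕ.^ suc k ℕ.* ((p ℕ.^ e ℕ.* w″) ℕ.* w′) ℕ.* w
              ≡⟨ NS.solve 5 (λ q q′ a b c → q NS.:* ((q′ NS.:* a) NS.:* b) NS.:* c NS.:= (q NS.:* q′) NS.:* ((a NS.:* b) NS.:* c)) refl (p ℕ.^ suc k) (p ℕ.^ e) w″ w′ w ⟩
            (p ℕ.^ suc k ℕ.* p ℕ.^ e) ℕ.* ((w″ ℕ.* w′) ℕ.* w)         ≡⟨ cong (ℕ._* ((w″ ℕ.* w′) ℕ.* w)) (sym (ℕP.^-distribˡ-+-* p (suc k) e)) ⟩
            p ℕ.^ (suc k ℕ.+ e) ℕ.* ((w″ ℕ.* w′) ℕ.* w) ∎)
          , p∤* (p∤* ¬w″ ¬w′) ¬w , bound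
          where
          bound : 4 ℕ.* (suc k ℕ.+ e) < ℓ
          bound = ℕP.<-≤-trans (subst (_< 4 ℕ.* suc k ℕ.+ suc k) (sym (ℕP.*-distribˡ-+ 4 (suc k) e)) (ℕP.+-monoʳ-< (4 ℕ.* suc k) 4e<k))
            (ℕP.≤-trans (ℕP.≤-reflexive (ℕP.+-comm (4 ℕ.* suc k) (suc k))) (ℕP.≤-trans (ℕP.*-monoˡ-≤ (suc k) 5≤p)
              (ℕP.≤-trans (ℕP.≤-reflexive (ℕP.*-comm p (suc k))) (ℕP.≤-trans (ℕP.m≤n+m (suc k ℕ.* p) r) (ℕP.≤-reflexive (sym ℓ≡))))))

  -- The substitution q ↦ qᵖ

  subst-qPow-∣ : ∀ k f m → subst-qPow (suc k) f (m ℕ.* suc k) ≡ f m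
  subst-qPow-∣ k f m with suc k ∣? (m ℕ.* suc k)
  ... | yes _ = cong f (m*n/n≡m m (suc k))
  ... | no ¬d = contradiction (n∣m*n m) ¬d

  subst-qPow-∤ : ∀ k f n → ¬ suc k ∣ n → subst-qPow (suc k) f n ≡ 0ℚ
  subst-qPow-∤ k f n ¬d with suc k ∣? n
  ... | yes d = contradiction d ¬d
  ... | no _  = refl

  sign-+ : ∀ m n → sign (m ℕ.+ n) ≡ sign m * sign n
  sign-+ zero    n = sym (ℚP.*-identityˡ (sign n))
  sign-+ (suc m) n = trans (cong (- 1ℚ *_) (sign-+ m n)) (sym (ℚP.*-assoc (- 1ℚ) (sign m) (sign n)))

  sign-square : ∀ n → sign n * sign n ≡ 1ℚ
  sign-square zero    = refl
  sign-square (suc n) = trans (RS.solve 1 (λ s → (RS.con (- 1ℚ) RS.:* s) RS.:* (RS.con (- 1ℚ) RS.:* s) RS.:= s RS.:* s) refl (sign n)) (sign-square n)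

  even-or-sign : ∀ n → 2 ∣ n ⊎ sign n ≡ - 1ℚ
  even-or-sign 0 = inj₁ (2 ∣0)
  even-or-sign 1 = inj₂ refl
  even-or-sign (suc (suc n)) = [ (λ d → inj₁ (∣m∣n⇒∣m+n (∣-refl {2}) d)) , (λ e → inj₂ (trans (RS.solve 1 (λ s → RS.con (- 1ℚ) RS.:* (RS.con (- 1ℚ) RS.:* s) RS.:= s) refl (sign n)) e)) ]′ (even-or-sign n)

  !-invFact : ∀ n → fromℕ (n !) * invFact n ≡ 1ℚ
  !-invFact zero    = refl
  !-invFact (suc n) = trans (cong (_* invFact (suc n)) (fromℕ-homo-* (suc n) (n !)))
    (trans (RS.solve 4 (λ a b c d → (a RS.:* b) RS.:* (c RS.:* d) RS.:= (a RS.:* d) RS.:* (b RS.:* c)) refl (fromℕ (suc n)) (fromℕ (n !)) (invFact n) (+ 1 / suc n))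
      (cong₂ _*_ (suc*1/suc n) (!-invFact n)))

  expCoeff : ℚ → Series
  expCoeff x k = (x ^ℚ k) * invFact k

  deriv-expCoeff : ∀ x → deriv (expCoeff x) ≈ const x · expCoeff x
  deriv-expCoeff x .at k = trans (RS.solve 5 (λ n x p f i → n RS.:* ((x RS.:* p) RS.:* (f RS.:* i)) RS.:= (n RS.:* i) RS.:* (x RS.:* (p RS.:* f))) refl (fromℕ (suc k)) x (x ^ℚ k) (invFact k) (+ 1 / suc k))
    (trans (cong (_* (x * expCoeff x k)) (suc*1/suc k)) (trans (ℚP.*-identityˡ _) (sym (const-·-at x (expCoeff x) k))))

  -- The Frobenius substitution and the exponential formula

  module Frobenius (p′ : ℕ) where

    p : ℕ
    p = suc p′

    q^p-at-0 : qPow p 0 ≡ 0ℚ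
    q^p-at-0 = qPow-off p 0 (λ ())

    -- Taken as a composition rather than as `subst-qPow p`, so that multiplicativity and the chain
    -- rule are inherited; `subst-qPow≈ψ` identifies the two.
    ψ : Series → Series
    ψ = comp (qPow p)

    ψ-shift : ∀ f j → ψ f (p ℕ.+ j) ≡ ψ (tail f) j
    ψ-shift f j = trans (comp-horner (qPow p) q^p-at-0 f .at (p ℕ.+ j)) (trans (∔-at _ _ (p ℕ.+ j)) (trans (ℚP.+-identityˡ _) (qPow-·-+ p (ψ (tail f)) j)))

    ψ-< : ∀ f n → n < p → ψ f n ≡ const (f 0) n
    ψ-< f n n<p = trans (comp-horner (qPow p) q^p-at-0 f .at n) (trans (∔-at _ _ n) (trans (cong (λ z → const (f 0) n + z) (qPow-·-< p _ n n<p)) (ℚP.+-identityʳ _)))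

    ψ-at : ∀ f m → ψ f (m ℕ.* p) ≡ f m
    ψ-at f zero    = ψ-< f 0 (s≤s z≤n)
    ψ-at f (suc m) = trans (ψ-shift f (m ℕ.* p)) (ψ-at (tail f) m)

    ψ-∤ : ∀ f n → ¬ p ∣ n → ψ f n ≡ 0ℚ
    ψ-∤ f n = below (suc n) f n ℕP.≤-refl
      where
      below : ∀ N f n → n < N → ¬ p ∣ n → ψ f n ≡ 0ℚ
      below (suc N) f zero    _         ¬d = contradiction (p ∣0) ¬d
      below (suc N) f (suc n) (s≤s n<N) ¬d = [ high , (λ n<p → ψ-< f (suc n) n<p) ]′ (ℕP.≤-<-connex p (suc n))
        where
        high : p ≤ suc n → ψ f (suc n) ≡ 0ℚ
        high p≤n = trans (cong (ψ f) (sym (ℕP.m+[n∸m]≡n p≤n))) (trans (ψ-shift f (suc n ∸ p))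
          (below N (tail f) (suc n ∸ p) (ℕP.≤-<-trans (ℕP.m∸n≤m n p′) n<N) (λ d → ¬d (subst (p ∣_) (ℕP.m+[n∸m]≡n p≤n) (∣m∣n⇒∣m+n ∣-refl d)))))

    subst-qPow≈ψ : ∀ f → subst-qPow p f ≈ ψ f
    subst-qPow≈ψ f .at n = go (p ∣? n)
      where
      go : Dec (p ∣ n) → subst-qPow p f n ≡ ψ f n
      go (yes (divides m refl)) = trans (subst-qPow-∣ p′ f m) (sym (ψ-at f m))
      go (no ¬d)                = trans (subst-qPow-∤ p′ f n ¬d) (sym (ψ-∤ f n ¬d))

    D-ψ : ∀ f → D (ψ f) ≈ ψ (D f) · const (fromℕ p)
    D-ψ f = D-comp-log (qPow p) q^p-at-0 f (const (fromℕ p)) (≈-trans (D-qPow p) (·-comm _ _))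

    ψ-· : ∀ f g → ψ (f · g) ≈ ψ f · ψ g
    ψ-· = comp-· (qPow p) q^p-at-0

    ψ-cong : ∀ {f g} → f ≈ g → ψ f ≈ ψ g
    ψ-cong = comp-cong (qPow p) q^p-at-0

    ψ-const-· : ∀ c f → ψ (const c · f) ≈ const c · ψ f
    ψ-const-· = comp-const-· (qPow p) q^p-at-0

    decimate : Series → Series
    decimate X k = X (k ℕ.* p)

    -- The projection formula: a series in q^p passes through the extraction of the coefficients at
    -- multiples of p. Horner's rule for ψ Y removes one coefficient of Y at each step.
    ·-ψ-at : ∀ X Y m → (X · ψ Y) (m ℕ.* p) ≡ (Y · decimate X) m
    ·-ψ-at X Y m = trans (split .at (m ℕ.* p)) (trans (∔-at _ _ (m ℕ.* p)) (trans (cong (_+ (qPow p · (X · ψ (tail Y))) (m ℕ.* p)) (const-·-at (Y 0) X (m ℕ.* p))) (rest m)))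
      where
      split : X · ψ Y ≈ const (Y 0) · X ∔ qPow p · (X · ψ (tail Y))
      split = ≈-trans (·-cong ≈-refl (comp-horner (qPow p) q^p-at-0 Y)) (SS.solve 4 (λ X c q y → X SS.:* (c SS.:+ q SS.:* y) SS.:= c SS.:* X SS.:+ q SS.:* (X SS.:* y)) ≈-refl X (const (Y 0)) (qPow p) (ψ (tail Y)))
      rest : ∀ m → Y 0 * X (m ℕ.* p) + (qPow p · (X · ψ (tail Y))) (m ℕ.* p) ≡ (Y · decimate X) m
      rest zero    = trans (cong (λ z → Y 0 * X 0 + z) (qPow-·-< p _ 0 (s≤s z≤n))) (trans (ℚP.+-identityʳ _) (sym (·-at-0 Y (decimate X))))
      rest (suc m) = trans (cong (λ z → Y 0 * X (p ℕ.+ m ℕ.* p) + z) (trans (qPow-·-+ p (X · ψ (tail Y)) (m ℕ.* p)) (·-ψ-at X (tail Y) m))) (sym (·-suc Y (decimate X) m))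

    divided-power : divQPow p (pow t p) ≈ s₃ ↑ p
    divided-power .at n = trans (cong (pow t p) (ℕP.+-comm n p)) (trans (tp .at (p ℕ.+ n)) (qPow-·-+ p (s₃ ↑ p) n))
      where
      tp : pow t p ≈ qPow p · s₃ ↑ p
      tp = ≈-trans (pow≈↑ p t≈q·s₃) (≈-trans (↑-· (qPow 1) s₃ p) (·-cong (qPow-↑ p) ≈-refl))

    divided-subst : divQPow p (subst-qPow p t) ≈ ψ s₃
    divided-subst .at n = trans (cong (subst-qPow p t) (ℕP.+-comm n p)) (trans (ts .at (p ℕ.+ n)) (qPow-·-+ p (ψ s₃) n))
      where
      ψq : ψ (qPow 1) ≈ qPow p
      ψq = ≈-trans (ψ-cong (mk≈ λ { zero → refl ; (suc k) → trans (qPow-tail 0 .at k) (qPow-0 .at k) }))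
        (≈-trans (comp-shift (qPow p) q^p-at-0 (const 1ℚ)) (≈-trans (·-cong ≈-refl (comp-const (qPow p) q^p-at-0 1ℚ)) (≈-trans (·-comm _ _) (one-· (qPow p)))))
      ts : subst-qPow p t ≈ qPow p · ψ s₃
      ts = ≈-trans (subst-qPow≈ψ t) (≈-trans (ψ-cong t≈q·s₃) (≈-trans (ψ-· (qPow 1) s₃) (·-cong ψq ≈-refl)))

    denominator : Series
    denominator = divQPow p (subst-qPow p t)

    denominator-at-0 : denominator 0 ≡ 1ℚ
    denominator-at-0 = trans (divided-subst .at 0) (comp-at-0 (qPow p) q^p-at-0 s₃)

    tRatio≈ : tRatio p ≈ s₃ ↑ p · inv denominator
    tRatio≈ = ⊗≈· divided-power ≈-refl

    tRatio-at-0 : tRatio p 0 ≡ 1ℚ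
    tRatio-at-0 = trans (tRatio≈ .at 0) (trans (·-at-0 (s₃ ↑ p) (inv denominator)) (cong (_* 1ℚ) (↑-at-0 s₃ p s₃-at-0)))

    -- This is p P(q) - p P(q^p); the constant terms of the two P cancel.
    U-slope : Series
    U-slope = const (fromℕ p) · 𝓛 wP ∔ (⊝ (const (fromℕ p) · ψ (𝓛 wP)))

    D-tRatio : D (tRatio p) ≈ tRatio p · U-slope
    D-tRatio = ≈-trans (D-cong tRatio≈) (≈-trans (D-·-log (≈-trans (D-↑-log p D-s₃) (·-comm _ _)) (D-inv denominator-at-0 D-denominator)) (·-cong (≈-sym tRatio≈) ≈-refl))
      where
      D-denominator : D denominator ≈ denominator · (const (fromℕ p) · ψ (𝓛 wP))
      D-denominator = ≈-trans (D-cong divided-subst) (≈-trans (D-ψ s₃) (≈-trans (·-cong (≈-trans (ψ-cong D-s₃) (ψ-· s₃ (𝓛 wP))) ≈-refl)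
        (≈-trans (SS.solve 3 (λ s w c → (s SS.:* w) SS.:* c SS.:= s SS.:* (c SS.:* w)) ≈-refl (ψ s₃) (ψ (𝓛 wP)) (const (fromℕ p))) (·-cong (≈-sym divided-subst) ≈-refl))))

    D-U : D (U p) ≈ U-slope
    D-U = ·-cancelˡ (tRatio p) tRatio-at-0 (≈-trans (D-logS (tRatio p) tRatio-at-0) D-tRatio)

    -- Both sides have constant term 1 and logarithmic derivative -mp `𝓛 wP`. On the right the
    -- exponential contributes -m `U-slope`, whose part with ψ(`𝓛 wP`) cancels the logarithmic
    -- derivative of ψ(v^m).
    exponential : ∀ m → v₃ ↑ (m ℕ.* p) ≈ comp (U p) (expCoeff (- fromℕ m)) · ψ (v₃ ↑ m)
    exponential m = ode-unique (const (fromℕ (m ℕ.* p)) · (⊝ 𝓛 wP)) _ _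
      (trans (const-·-at (fromℕ (m ℕ.* p)) _ 0) (trans (cong (fromℕ (m ℕ.* p) *_) (⊝-at (𝓛 wP) 0)) (ℚP.*-zeroʳ (fromℕ (m ℕ.* p)))))
      (trans (↑-at-0 v₃ (m ℕ.* p) refl) (sym (trans (·-at-0 E (ψ (v₃ ↑ m))) (cong₂ _*_ (comp-at-0 (U p) refl (expCoeff x)) (trans (comp-at-0 (qPow p) q^p-at-0 (v₃ ↑ m)) (↑-at-0 v₃ m refl))))))
      (D-↑-log (m ℕ.* p) D-v₃)
      (≈-trans (D-· E (ψ (v₃ ↑ m))) (≈-trans (∔-cong (·-cong DE ≈-refl) (·-cong ≈-refl Dψ))
        (≈-trans (SS.solve 6 (λ M P w ψw E V → ((SS.:- M) SS.:* E SS.:* (P SS.:* w SS.:- P SS.:* ψw)) SS.:* V SS.:+ E SS.:* ((M SS.:* (SS.con (- 1ℚ) SS.:* ψw)) SS.:* V SS.:* P)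
            SS.:= ((M SS.:* P) SS.:* (SS.:- w)) SS.:* (E SS.:* V)) ≈-refl (const (fromℕ m)) (const (fromℕ p)) (𝓛 wP) (ψ (𝓛 wP)) E (ψ (v₃ ↑ m)))
          (·-cong (·-cong (≈-trans (≈-sym (const-* (fromℕ m) (fromℕ p))) (mk≈ λ n → cong (λ c → const c n) (sym (fromℕ-homo-* m p)))) ≈-refl) ≈-refl))))
      where
      x = - fromℕ m
      E = comp (U p) (expCoeff x)
      DE : D E ≈ (⊝ const (fromℕ m)) · E · U-slope
      DE = ≈-trans (D-comp (U p) refl (expCoeff x)) (·-cong (≈-trans (comp-cong (U p) refl (deriv-expCoeff x)) (≈-trans (comp-const-· (U p) refl x (expCoeff x)) (·-cong (const-neg (fromℕ m)) ≈-refl))) D-U)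
      Dψ : D (ψ (v₃ ↑ m)) ≈ (const (fromℕ m) · (const (- 1ℚ) · ψ (𝓛 wP))) · ψ (v₃ ↑ m) · const (fromℕ p)
      Dψ = ≈-trans (D-ψ (v₃ ↑ m)) (·-cong (≈-trans (ψ-cong (≈-trans (D-↑-log m D-v₃) (·-cong (·-cong ≈-refl (SS.solve 1 (λ w → SS.:- w SS.:= SS.con (- 1ℚ) SS.:* w) ≈-refl (𝓛 wP))) ≈-refl)))
        (≈-trans (ψ-· _ (v₃ ↑ m)) (·-cong (≈-trans (ψ-const-· (fromℕ m) _) (·-cong ≈-refl (ψ-const-· (- 1ℚ) (𝓛 wP)))) ≈-refl))) ≈-refl)

  -- Congruences modulo powers of p

  module Congruence (p′ : ℕ) (p-prime : Prime (suc p′)) (5≤p : 5 ≤ suc p′) where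

    open Frobenius p′
    open Localisation p p-prime

    -- Were p a factor of the complementary divisor c, cancelling it would make d a divisor of
    -- `suc k`. So d carries one factor p more than `suc k` does.
    new-divisor : ∀ {d k} → d ∣ suc k ℕ.* p → ¬ d ∣ suc k → ∃[ c ] (c ℕ.* d ≡ suc k ℕ.* p × ¬ p ∣ c)
    new-divisor {d} {k} (divides c eq) ¬d = c , sym eq , p∤c
      where
      p∤c : ¬ p ∣ c
      p∤c (divides c′ refl) = ¬d (divides c′ (ℕP.*-cancelʳ-≡ (suc k) (c′ ℕ.* d) p (trans eq (trans (ℕP.*-assoc c′ p d) (trans (cong (c′ ℕ.*_) (ℕP.*-comm p d)) (sym (ℕP.*-assoc c′ d p)))))))

    -- Divisors of `suc k` also divide `suc k * p`, so their contributions cancel and only the new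
    -- divisors remain.
    𝓛-difference : ∀ {j} φ k → (∀ d → d ∣ suc k ℕ.* p → ¬ d ∣ suc k → V j (φ d)) → V j (𝓛 φ (suc k ℕ.* p) - 𝓛 φ (suc k))
    𝓛-difference {j} φ k new = V-subst (sym total) (V-Σ N λ i _ → go i (suc i ∣? suc k) (suc i ∣? N))
      where
      N = suc k ℕ.* p
      summand : ℕ → ℚ
      summand i = φ (suc i) * u (suc i) N + - 1ℚ * (φ (suc i) * u (suc i) (suc k))
      total : 𝓛 φ N - 𝓛 φ (suc k) ≡ Σ< N summand
      total = trans (cong (λ z → 𝓛 φ N - z) (𝓛-truncate φ (ℕP.m≤m*n (suc k) p)))
        (trans (RS.solve 2 (λ a b → a RS.:- b RS.:= a RS.:+ RS.con (- 1ℚ) RS.:* b) refl (𝓛 φ N) (Σ< N (λ i → φ (suc i) * u (suc i) (suc k))))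
          (trans (cong (λ z → 𝓛 φ N + z) (sym (Σ<-*ˡ N (- 1ℚ) _))) (sym (Σ<-+ N _ _))))
      evaluate : ∀ i {x y z} → u (suc i) N ≡ x → u (suc i) (suc k) ≡ y → φ (suc i) * x + - 1ℚ * (φ (suc i) * y) ≡ z → V j z → V j (summand i)
      evaluate i refl refl refl v = v
      go : ∀ i → Dec (suc i ∣ suc k) → Dec (suc i ∣ N) → V j (summand i)
      go i (yes d) _       = evaluate i (u-∣ (∣m⇒∣m*n p d)) (u-∣ d) (RS.solve 1 (λ f → f RS.:* RS.con 1ℚ RS.:+ RS.con (- 1ℚ) RS.:* (f RS.:* RS.con 1ℚ) RS.:= RS.con 0ℚ) refl (φ (suc i))) V-0
      go i (no ¬d) (yes d) = evaluate i (u-∣ d) (u-∤ ¬d) (RS.solve 1 (λ f → f RS.:* RS.con 1ℚ RS.:+ RS.con (- 1ℚ) RS.:* (f RS.:* RS.con 0ℚ) RS.:= f) refl (φ (suc i))) (new (suc i) d ¬d)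
      go i (no ¬d) (no ¬e) = evaluate i (u-∤ ¬e) (u-∤ ¬d) (RS.solve 1 (λ f → f RS.:* RS.con 0ℚ RS.:+ RS.con (- 1ℚ) RS.:* (f RS.:* RS.con 0ℚ) RS.:= RS.con 0ℚ) refl (φ (suc i))) V-0

    V-𝕩 : ∀ r → V 0 (𝕩 r)
    V-𝕩 r₀ = V-ℕ 0
    V-𝕩 r₁ = V-ℕ 1
    V-𝕩 r₂ = V-ℤ (ℤ.- + 1)

    V-𝕙 : ∀ r → V 0 (𝕙 r)
    V-𝕙 r₀ = V-ℕ 2
    V-𝕙 r₁ = V-ℤ (ℤ.- + 1)
    V-𝕙 r₂ = V-ℤ (ℤ.- + 1)

    VS-𝓛 : ∀ {φ} → (∀ m → V 0 (φ m)) → VS 0 (𝓛 φ)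
    VS-𝓛 {φ} v n = V-Σ n λ i _ → V-* (v (suc i)) (V-u (suc i) n)
      where
      V-u : ∀ m n → V 0 (u m n)
      V-u m zero    = V-ℕ 0
      V-u m (suc n) = [ (λ e → V-subst (sym e) (V-ℕ 1)) , (λ e → V-subst (sym e) (V-ℕ 0)) ]′ (value₀₁ (m ∣? suc n))
        where
        value₀₁ : Dec (m ∣ suc n) → u m (suc n) ≡ 1ℚ ⊎ u m (suc n) ≡ 0ℚ
        value₀₁ (yes d) = inj₁ (u-∣ d)
        value₀₁ (no ¬d) = inj₂ (u-∤ ¬d)

    χ-part : ℕ → ℚ
    χ-part m = fromℕ 4 * (fromℕ 2 + - 1ℚ * 𝕙 (res m))

    V-χ-part : ∀ m → V 0 (χ-part m)
    V-χ-part m = V-* (V-ℕ 4) (V-+ (V-ℕ 2) (V-* (V-ℤ (ℤ.- + 1)) (V-𝕙 (res m))))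

    wP≡ : ∀ m → wP m ≡ fromℕ m * χ-part m
    wP≡ m = RS.solve 2 (λ m h → RS.con (fromℕ 4) RS.:* (RS.con (fromℕ 2) RS.:* (m RS.:* RS.con 1ℚ) RS.:+ RS.con (- 1ℚ) RS.:* (m RS.:* h)) RS.:= m RS.:* (RS.con (fromℕ 4) RS.:* (RS.con (fromℕ 2) RS.:+ RS.con (- 1ℚ) RS.:* h))) refl (fromℕ m) (𝕙 (res m))

    VS-𝓛wP : VS 0 (𝓛 wP)
    VS-𝓛wP = VS-𝓛 (λ m → V-subst (sym (wP≡ m)) (V-* (V-ℕ m) (V-χ-part m)))

    U-coefficient : ∀ n → fromℕ n * U p n ≡ fromℕ p * (𝓛 wP n - ψ (𝓛 wP) n)
    U-coefficient n = trans (sym (D-at (U p) n)) (trans (D-U .at n) (trans (∔-at _ _ n) (trans (cong₂ _+_ (const-·-at (fromℕ p) (𝓛 wP) n) (trans (⊝-at _ n) (cong -_ (const-·-at (fromℕ p) (ψ (𝓛 wP)) n))))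
      (RS.solve 3 (λ p a b → p RS.:* a RS.:- p RS.:* b RS.:= p RS.:* (a RS.:- b)) refl (fromℕ p) (𝓛 wP n) (ψ (𝓛 wP) n)))))

    -- For n = pk the coefficient is (1/k) Σ 4d(2 - 𝕙(d)) over d ∣ pk with d ∤ k, and then d/k = p/c with p ∤ c.
    VS-U : VS 1 (U p)
    VS-U n = go (p ∣? n)
      where
      multiple : ∀ k → V 1 (U p (k ℕ.* p))
      multiple zero    = V-0
      multiple (suc k) = V-subst (sym U≡) (𝓛-difference scaled k new)
        where
        K = fromℕ (suc k)
        1/K = + 1 / suc k
        scaled : ℕ → ℚ
        scaled m = 1/K * wP m
        KU : K * U p (suc k ℕ.* p) ≡ 𝓛 wP (suc k ℕ.* p) - 𝓛 wP (suc k)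
        KU = fromℕ-nonzero-cancel {p} (λ ()) (trans (sym (ℚP.*-assoc (fromℕ p) K _)) (trans (cong (_* U p (suc k ℕ.* p)) (trans (ℚP.*-comm (fromℕ p) K) (sym (fromℕ-homo-* (suc k) p))))
          (trans (U-coefficient (suc k ℕ.* p)) (cong (λ z → fromℕ p * (𝓛 wP (suc k ℕ.* p) - z)) (ψ-at (𝓛 wP) (suc k))))))
        U≡ : U p (suc k ℕ.* p) ≡ 𝓛 scaled (suc k ℕ.* p) - 𝓛 scaled (suc k)
        U≡ = fromℕ-nonzero-cancel {suc k} (λ ()) (trans KU (sym (begin
          K * (𝓛 scaled (suc k ℕ.* p) - 𝓛 scaled (suc k))
            ≡⟨ cong₂ (λ a b → K * (a - b)) (trans (𝓛-const-· 1/K wP .at (suc k ℕ.* p)) (const-·-at 1/K (𝓛 wP) (suc k ℕ.* p))) (trans (𝓛-const-· 1/K wP .at (suc k)) (const-·-at 1/K (𝓛 wP) (suc k))) ⟩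
          K * (1/K * 𝓛 wP (suc k ℕ.* p) - 1/K * 𝓛 wP (suc k))
            ≡⟨ RS.solve 4 (λ k i a b → k RS.:* (i RS.:* a RS.:- i RS.:* b) RS.:= (k RS.:* i) RS.:* (a RS.:- b)) refl K 1/K (𝓛 wP (suc k ℕ.* p)) (𝓛 wP (suc k)) ⟩
          (K * 1/K) * (𝓛 wP (suc k ℕ.* p) - 𝓛 wP (suc k))
            ≡⟨ trans (cong (_* (𝓛 wP (suc k ℕ.* p) - 𝓛 wP (suc k))) (suc*1/suc k)) (ℚP.*-identityˡ _) ⟩
          𝓛 wP (suc k ℕ.* p) - 𝓛 wP (suc k) ∎)))
        new : ∀ d → d ∣ suc k ℕ.* p → ¬ d ∣ suc k → V 1 (scaled d)
        new d d∣ ¬d = by-cofactor (new-divisor d∣ ¬d)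
          where
          by-cofactor : ∃[ c ] (c ℕ.* d ≡ suc k ℕ.* p × ¬ p ∣ c) → V 1 (scaled d)
          by-cofactor (c , cd≡ , p∤c) = V-cancel-unit c p∤c (V-subst (sym (begin
            fromℕ c * (1/K * wP d)                        ≡⟨ cong (λ z → fromℕ c * (1/K * z)) (wP≡ d) ⟩
            fromℕ c * (1/K * (fromℕ d * χ-part d))          ≡⟨ RS.solve 4 (λ c i d x → c RS.:* (i RS.:* (d RS.:* x)) RS.:= (c RS.:* d) RS.:* i RS.:* x) refl (fromℕ c) 1/K (fromℕ d) (χ-part d) ⟩
            (fromℕ c * fromℕ d) * 1/K * χ-part d           ≡⟨ cong (λ z → z * 1/K * χ-part d) (trans (sym (fromℕ-homo-* c d)) (trans (cong fromℕ cd≡) (fromℕ-homo-* (suc k) p))) ⟩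
            (K * fromℕ p) * 1/K * χ-part d                 ≡⟨ RS.solve 4 (λ k p i x → (k RS.:* p) RS.:* i RS.:* x RS.:= (k RS.:* i) RS.:* (p RS.:* x)) refl K (fromℕ p) 1/K (χ-part d) ⟩
            (K * 1/K) * (fromℕ p * χ-part d)               ≡⟨ trans (cong (_* (fromℕ p * χ-part d)) (suc*1/suc k)) (ℚP.*-identityˡ _) ⟩
            fromℕ p * χ-part d ∎)) (V-* V-p (V-χ-part d)))
      go : Dec (p ∣ n) → V 1 (U p n)
      go (yes (divides k refl)) = multiple k
      -- Away from the multiples of p the index n is a unit and the ψ term is absent, so the factor
      -- p in n U_n suffices.
      go (no ¬d) = V-cancel-unit n ¬d (V-subst (sym (U-coefficient n)) (V-* V-p (V-+ (VS-𝓛wP n) (V-neg (V-subst (sym (ψ-∤ (𝓛 wP) n ¬d)) V-0)))))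

    VS-C : VS 0 C
    VS-C = VS-cong (≈-sym C≈C₃) (VS-∔ (VS-const (V-ℕ 1)) (VS-· (VS-const (V-ℕ 3)) (VS-𝓛 (λ m → V-* (V-ℕ m) (V-* (V-ℕ m) (V-* (V-ℕ m) (V-* (V-ℕ m) (V-𝕩 (res m)))))))))

    -- The exponent 4 in d⁴ is what meets the modulus p⁴: each new divisor contributes one factor p
    -- for each of its four occurrences.
    C-difference : ∀ k → V 4 (C (k ℕ.* p) - C k)
    C-difference zero    = V-0
    C-difference (suc k) = V-subst (sym C≡) (V-*ˡ (V-ℕ 3) (𝓛-difference (momentAt 𝛘 4) k new))
      where
      C-suc : ∀ n → C (suc n) ≡ fromℕ 3 * 𝓜 𝛘 4 (suc n)
      C-suc n = trans (C≈C₃ .at (suc n)) (trans (∔-at _ _ (suc n)) (trans (ℚP.+-identityˡ _) (const-·-at (fromℕ 3) (𝓜 𝛘 4) (suc n))))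
      C≡ : C (suc k ℕ.* p) - C (suc k) ≡ fromℕ 3 * (𝓜 𝛘 4 (suc k ℕ.* p) - 𝓜 𝛘 4 (suc k))
      C≡ = trans (cong₂ _-_ (C-suc (p′ ℕ.+ k ℕ.* p)) (C-suc k)) (RS.solve 3 (λ c a b → c RS.:* a RS.:- c RS.:* b RS.:= c RS.:* (a RS.:- b)) refl (fromℕ 3) (𝓜 𝛘 4 (suc k ℕ.* p)) (𝓜 𝛘 4 (suc k)))
      new : ∀ d → d ∣ suc k ℕ.* p → ¬ d ∣ suc k → V 4 (momentAt 𝛘 4 d)
      new d d∣ ¬d = by-cofactor (new-divisor d∣ ¬d)
        where
        by-cofactor : ∃[ c ] (c ℕ.* d ≡ suc k ℕ.* p × ¬ p ∣ c) → V 4 (momentAt 𝛘 4 d)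
        by-cofactor (c , cd≡ , p∤c) = [ (λ e → contradiction e p∤c) , divisible ]′ (euclidsLemma c d p-prime (subst (p ∣_) (sym cd≡) (n∣m*n (suc k))))
          where
          divisible : p ∣ d → V 4 (momentAt 𝛘 4 d)
          divisible (divides d′ refl) = V-* Vd (V-* Vd (V-* Vd (V-* Vd (V-𝕩 (res (d′ ℕ.* p))))))
            where
            Vd : V 1 (fromℕ (d′ ℕ.* p))
            Vd = V-subst (sym (fromℕ-homo-* d′ p)) (V-* (V-ℕ d′) V-p)

    V-invFact : ∀ {j k y} ℓ e w → ℓ ! ≡ p ℕ.^ e ℕ.* w → ¬ p ∣ w → V j y → e ℕ.+ k ≤ j → V k (invFact ℓ * y)
    V-invFact {y = y} ℓ e w eq ¬w v le = V-cancel-p^ e (V-cancel-unit w ¬w (V-subst (sym (begin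
      fromℕ w * (fromℕ (p ℕ.^ e) * (invFact ℓ * y))    ≡⟨ RS.solve 4 (λ w q i y → w RS.:* (q RS.:* (i RS.:* y)) RS.:= ((q RS.:* w) RS.:* i) RS.:* y) refl (fromℕ w) (fromℕ (p ℕ.^ e)) (invFact ℓ) y ⟩
      ((fromℕ (p ℕ.^ e) * fromℕ w) * invFact ℓ) * y    ≡⟨ cong (λ z → (z * invFact ℓ) * y) (trans (sym (fromℕ-homo-* (p ℕ.^ e) w)) (cong fromℕ (sym eq))) ⟩
      (fromℕ (ℓ !) * invFact ℓ) * y                    ≡⟨ trans (cong (_* y) (!-invFact ℓ)) (ℚP.*-identityˡ y) ⟩
      y ∎)) (V-weaken le v)))

    V-^ℚ : ∀ {x} k → V 0 x → V 0 (x ^ℚ k)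
    V-^ℚ zero    v = V-ℕ 1
    V-^ℚ (suc k) v = V-* v (V-^ℚ k v)

    VS-s₃ : VS 0 s₃
    VS-s₃ n = V-finProd n n
      where
      V-1-q^ : ∀ m → VS 0 (1-q^ m)
      V-1-q^ m = VS-∔ (VS-const (V-ℕ 1)) (VS-⊝ (VS-qPow m))
      V-tFactor : ∀ m → VS 0 (tFactor m)
      V-tFactor m = VS-cong (≈-sym (tFactor≈ m)) (VS-· (VS-↑₀ 12 (V-1-q^ (3 ℕ.* m))) (VS-↑₀ 12 (VS-inv (VS-cong (≈-sym (1-q^≈ m)) (V-1-q^ m)))))
      V-finProd : ∀ N → VS 0 (finProd tFactor N)
      V-finProd zero    = VS-cong (≈-sym one≈const) (VS-const (V-ℕ 1))
      V-finProd (suc N) = VS-cong (≈-sym (finProd-suc N)) (VS-· (V-finProd N) (V-tFactor (suc N)))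

    VS-v₃ : ∀ m → VS 0 (v₃ ↑ m)
    VS-v₃ m = VS-↑₀ m (VS-inv VS-s₃)

    module _ (vanishing : (n ℓ : ℕ) → 1 ≤ n → 1 ≤ ℓ → ℓ ≤ 3 → coeff (n ℕ.* p) (C ⊗ pow (U p) ℓ) ≡ 0ℚ [modPow p ^ 4 ]) where

      -- Write e for the exponent of p in ℓ!. For ℓ ≤ 3 the bound 4e < ℓ forces e = 0, so ℓ! is a
      -- unit and the hypothesis applies. For ℓ ≥ 4 the factor p^ℓ from U^ℓ is enough, since e + 4 ≤
      -- ℓ.
      V-exp-term : ∀ x → V 0 x → ∀ n ℓ → 1 ≤ n → 1 ≤ ℓ → V 4 (expCoeff x ℓ * (C · U p ↑ ℓ) (n ℕ.* p))
      V-exp-term x vx n ℓ 1≤n 1≤ℓ = V-subst (sym (ℚP.*-assoc (x ^ℚ ℓ) (invFact ℓ) _)) (V-*ˡ (V-^ℚ ℓ vx) (go (factorial-valuation 5≤p ℓ 1≤ℓ) (ℕP.≤-<-connex ℓ 3)))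
        where
        y = (C · U p ↑ ℓ) (n ℕ.* p)
        small : ℓ ≤ 3 → V 4 y
        small ℓ≤3 = V-subst (trans (RS.solve 1 (λ x → x RS.:- RS.con 0ℚ RS.:= x) refl _) (⊗≈· ≈-refl (pow≈↑ ℓ ≈-refl) .at (n ℕ.* p))) (InPowZp⇒V (vanishing n ℓ 1≤n 1≤ℓ ℓ≤3))
        large : V ℓ y
        large = subst (λ k → V k y) (ℕP.*-identityʳ ℓ) (VS-· VS-C (VS-↑ ℓ VS-U) (n ℕ.* p))
        go : ∃[ e ] ∃[ w ] (ℓ ! ≡ p ℕ.^ e ℕ.* w × ¬ p ∣ w × 4 ℕ.* e < ℓ) → ℓ ≤ 3 ⊎ 3 < ℓ → V 4 (invFact ℓ * y)
        go (zero  , w , eq , ¬w , _)   (inj₁ ℓ≤3) = V-invFact ℓ 0 w eq ¬w (small ℓ≤3) ℕP.≤-refl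
        go (suc e , w , eq , ¬w , 4e<) (inj₁ ℓ≤3) = contradiction (ℕP.<-≤-trans 4e< ℓ≤3) (ℕP.≤⇒≯ (ℕP.≤-trans (ℕP.n≤1+n 3) (ℕP.m≤m*n 4 (suc e))))
        go (zero  , w , eq , ¬w , _)   (inj₂ 3<ℓ) = V-invFact ℓ 0 w eq ¬w large 3<ℓ
        go (suc e , w , eq , ¬w , 4e<) (inj₂ 3<ℓ) = V-invFact ℓ (suc e) w eq ¬w large
          -- With e for `suc e`: e + 4 ≤ 4e + 1 because e ≥ 1, and 4e + 1 ≤ ℓ.
          (ℕP.≤-trans (ℕP.≤-reflexive (ℕP.+-comm (suc e) 4)) (ℕP.≤-trans (s≤s (ℕP.≤-trans (ℕP.+-monoʳ-≤ 3 (ℕP.m≤n*m (suc e) 1)) (bound e))) 4e<))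
          where
          bound : ∀ e → 3 ℕ.+ 1 ℕ.* suc e ≤ 4 ℕ.* suc e
          bound e = ℕP.≤-trans (ℕP.+-monoˡ-≤ (1 ℕ.* suc e) (ℕP.m≤m*n 3 (suc e))) (ℕP.≤-reflexive (sym (ℕP.*-distribʳ-+ (suc e) 3 1)))

      V-bracket : ∀ x → V 0 x → ∀ k → V 4 ((C · comp (U p) (expCoeff x)) (k ℕ.* p) - C k)
      V-bracket x vx k = V-subst (sym rearranged) (V-+ (V-Σ (k ℕ.* p) λ i i<kp → V-exp-term x vx k (suc i) (positive k i<kp) (s≤s z≤n)) (C-difference k))
        where
        -- The hypothesis covers only n ≥ 1; for k = 0 the sum over ℓ ≥ 1 is empty, so it is never
        -- invoked there.
        positive : ∀ k {i} → i < k ℕ.* p → 1 ≤ k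
        positive (suc k) _ = s≤s z≤n
        tailSum = Σ< (k ℕ.* p) (λ i → expCoeff x (suc i) * (C · U p ↑ suc i) (k ℕ.* p))
        rearranged : (C · comp (U p) (expCoeff x)) (k ℕ.* p) - C k ≡ tailSum + (C (k ℕ.* p) - C k)
        rearranged = trans (cong (_- C k) (trans (·-comp (U p) refl C (expCoeff x) (k ℕ.* p)) (trans (Σ<-front (k ℕ.* p) _)
            (cong (_+ tailSum) (trans (ℚP.*-identityˡ _) (≈-trans (·-comm C (const 1ℚ)) (one-· C) .at (k ℕ.* p)))))))
          (RS.solve 3 (λ a b c → (a RS.:+ b) RS.:- c RS.:= b RS.:+ (a RS.:- c)) refl (C (k ℕ.* p)) tailSum (C k))

      -- An even prime would be 2, which p ≥ 5 excludes. Oddness makes the signs in `lagrange` agree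
      -- at mp and at m.
      sign-p : sign p ≡ - 1ℚ
      sign-p = [ (λ d → [ (λ ()) , (λ 2≡p → contradiction 5≤p (ℕP.<⇒≱ (subst (_< 5) 2≡p (s≤s (s≤s (s≤s z≤n)))))) ]′ (prime⇒irreducible p-prime d)) , (λ e → e) ]′ (even-or-sign p)

      sign-*p : ∀ m → sign (m ℕ.* p) ≡ sign m
      sign-*p zero    = refl
      sign-*p (suc m) = trans (sign-+ p (m ℕ.* p)) (cong₂ _*_ sign-p (sign-*p m))

      -- By `exponential` and the projection formula, `lagrange` at mp is coefficient m of v^m times
      -- the decimated C E, while `lagrange` at m has C in that place. The difference is the
      -- p-integral series v^m times one divisible by p⁴; a second factor (-1)^m removes the sign.
      congruence : ∀ m → V 4 (A (m ℕ.* p) - A m)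
      congruence m = V-subst undo (V-*ˡ (V-^ℚ m (V-ℤ (ℤ.- + 1))) (V-subst (sym difference) (VS-· (VS-v₃ m) bracket m)))
        where
        E = comp (U p) (expCoeff (- fromℕ m))
        bracket : VS 4 (decimate (C · E) ∔ (⊝ C))
        bracket k = V-subst (sym (trans (∔-at _ _ k) (cong (λ z → (C · E) (k ℕ.* p) + z) (⊝-at C k)))) (V-bracket (- fromℕ m) (V-neg (V-ℕ m)) k)
        at-mp : sign m * A (m ℕ.* p) ≡ (v₃ ↑ m · decimate (C · E)) m
        at-mp = trans (cong (_* A (m ℕ.* p)) (sym (sign-*p m))) (trans (sym (lagrange (m ℕ.* p)))
          (trans (≈-trans (·-cong ≈-refl (exponential m)) (≈-sym (·-assoc C E (ψ (v₃ ↑ m)))) .at (m ℕ.* p)) (·-ψ-at (C · E) (v₃ ↑ m) m)))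
        difference : sign m * A (m ℕ.* p) - sign m * A m ≡ (v₃ ↑ m · (decimate (C · E) ∔ (⊝ C))) m
        difference = trans (cong₂ _-_ at-mp (trans (sym (lagrange m)) (·-comm-at m C (v₃ ↑ m))))
          (sym (trans (SS.solve 3 (λ v d c → v SS.:* (d SS.:- c) SS.:= v SS.:* d SS.:- v SS.:* c) ≈-refl (v₃ ↑ m) (decimate (C · E)) C .at m)
            (trans (∔-at _ _ m) (cong (λ z → (v₃ ↑ m · decimate (C · E)) m + z) (⊝-at (v₃ ↑ m · C) m)))))
        undo : sign m * (sign m * A (m ℕ.* p) - sign m * A m) ≡ A (m ℕ.* p) - A m
        undo = trans (RS.solve 3 (λ s a b → s RS.:* (s RS.:* a RS.:- s RS.:* b) RS.:= (s RS.:* s) RS.:* (a RS.:- b)) refl (sign m) (A (m ℕ.* p)) (A m))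
          (trans (cong (_* (A (m ℕ.* p) - A m)) (sign-square m)) (ℚP.*-identityˡ _))

open import Data.Nat using (_*_)

theorem5p5 : (p : ℕ) → Prime p → 5 ≤ p →
    ((n ℓ : ℕ) → 1 ≤ n → 1 ≤ ℓ → ℓ ≤ 3 →
    coeff (n * p) (C ⊗ pow (U p) ℓ) ≡ 0ℚ [modPow p ^ 4 ]) →
    (m : ℕ) → 1 ≤ m → A (m * p) ≡ A m [modPow p ^ 4 ]
theorem5p5 (suc p′) p-prime 5≤p vanishing m _ = Localisation.V⇒InPowZp (suc p′) p-prime (Congruence.congruence p′ p-prime 5≤p vanishing m)
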